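{- For each $n\in\omega$, every consistent extension $T$ of $\mathsf{KP}$ in the language $\{\in\}$ of set theory that is axiomatized by a set of $\Sigma_n^{\mathrm{Levy}}$-sentences is incomplete, i.e., there is a sentence $\psi$ such that $T$ proves neither $\psi$ nor $\neg\psi$.
   Context: $\Sigma_n^{\mathrm{Levy}}$ is the Levy hierarchy of set-theoretic formulae: $\Sigma_0^{\mathrm{Levy}}=\Pi_0^{\mathrm{Levy}}$ are the formulae all of whose quantifiers are bounded (of the form $\exists x\in y$, $\forall x\in y$), and $\Sigma_{n+1}^{\mathrm{Levy}}$ formulae are of the form $\exists \vec{x}\,\varphi$ with $\varphi\in\Pi_n^{\mathrm{Levy}}$ ($\Pi_{n+1}^{\mathrm{Levy}}$ dually). $\mathsf{KP}$ here denotes Kripke–Platek set theory (extensionality, pairing, union, $\Delta_0$-separation, $\Delta_0$-collection) with the scheme of foundation limited to $\Pi_1^{\mathrm{Levy}}$-formulae (equivalently, $\in$-induction for $\Sigma_1^{\mathrm{Levy}}$-formulae); it does not include the axiom of infinity and is finitely axiomatizable. -}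

module Defs where

open import Data.Nat using (ℕ; zero; suc)
open import Data.Fin using (Fin; zero; suc)
open import Data.List using (List; []; _∷_; map)
open import Data.List.Membership.Propositional using (_∈_)
open import Data.List.Relation.Unary.All using (All)
open import Data.Product using (Σ; _×_)
open import Relation.Nullary using (¬_)

-- First-order language {∈} (with equality), de Bruijn variables.
-- Formula k : formulas whose free variables are among 0..k-1.
-- There are no function/constant symbols, so terms are variables.

infixr 6 _∧'_ _∨'_
infixr 5 _⇒'_
infix 8 _∈'_ _≐_

data Formula (k : ℕ) : Set where
  _∈'_ : Fin k → Fin k → Formula k
  _≐_  : Fin k → Fin k → Formula k
  ⊥'   : Formula k
  ¬'_  : Formula k → Formula k
  _∧'_ : Formula k → Formula k → Formula k
  _∨'_ : Formula k → Formula k → Formula k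
  _⇒'_ : Formula k → Formula k → Formula k
  ∀'   : Formula (suc k) → Formula k     -- binds variable 0
  ∃'   : Formula (suc k) → Formula k     -- binds variable 0

Sentence : Set
Sentence = Formula 0

_⇔'_ : ∀ {k} → Formula k → Formula k → Formula k
φ ⇔' ψ = (φ ⇒' ψ) ∧' (ψ ⇒' φ)

ext : ∀ {k m} → (Fin k → Fin m) → Fin (suc k) → Fin (suc m)
ext ρ zero    = zero
ext ρ (suc i) = suc (ρ i)

rename : ∀ {k m} → (Fin k → Fin m) → Formula k → Formula m
rename ρ (x ∈' y) = ρ x ∈' ρ y
rename ρ (x ≐ y)  = ρ x ≐ ρ y
rename ρ ⊥'       = ⊥'
rename ρ (¬' φ)   = ¬' rename ρ φ
rename ρ (φ ∧' ψ) = rename ρ φ ∧' rename ρ ψ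
rename ρ (φ ∨' ψ) = rename ρ φ ∨' rename ρ ψ
rename ρ (φ ⇒' ψ) = rename ρ φ ⇒' rename ρ ψ
rename ρ (∀' φ)   = ∀' (rename (ext ρ) φ)
rename ρ (∃' φ)   = ∃' (rename (ext ρ) φ)

wk : ∀ {k} → Formula k → Formula (suc k)
wk = rename suc

inst : ∀ {k} → Fin k → Fin (suc k) → Fin k
inst x zero    = x
inst x (suc i) = i

_[_] : ∀ {k} → Formula (suc k) → Fin k → Formula k
φ [ x ] = rename (inst x) φ

close : ∀ {k} → Formula k → Sentence
close {zero}  φ = φ
close {suc k} φ = close (∀' φ)

∀∈ : ∀ {k} → Fin k → Formula (suc k) → Formula k
∀∈ y φ = ∀' ((zero ∈' suc y) ⇒' φ)

∃∈ : ∀ {k} → Fin k → Formula (suc k) → Formula k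
∃∈ y φ = ∃' ((zero ∈' suc y) ∧' φ)

data Δ₀ {k : ℕ} : Formula k → Set where
  ∈-Δ₀ : ∀ x y → Δ₀ (x ∈' y)
  ≐-Δ₀ : ∀ x y → Δ₀ (x ≐ y)
  ⊥-Δ₀ : Δ₀ ⊥'
  ¬-Δ₀ : ∀ {φ} → Δ₀ φ → Δ₀ (¬' φ)
  ∧-Δ₀ : ∀ {φ ψ} → Δ₀ φ → Δ₀ ψ → Δ₀ (φ ∧' ψ)
  ∨-Δ₀ : ∀ {φ ψ} → Δ₀ φ → Δ₀ ψ → Δ₀ (φ ∨' ψ)
  ⇒-Δ₀ : ∀ {φ ψ} → Δ₀ φ → Δ₀ ψ → Δ₀ (φ ⇒' ψ)
  ∀∈-Δ₀ : ∀ y {φ} → Δ₀ φ → Δ₀ (∀∈ y φ)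
  ∃∈-Δ₀ : ∀ y {φ} → Δ₀ φ → Δ₀ (∃∈ y φ)

data IsΣ : ℕ → ∀ {k} → Formula k → Set
data IsΠ : ℕ → ∀ {k} → Formula k → Set

data IsΣ where
  Δ₀→Σ₀ : ∀ {k} {φ : Formula k} → Δ₀ φ → IsΣ 0 φ
  Π→Σ   : ∀ {n k} {φ : Formula k} → IsΠ n φ → IsΣ (suc n) φ
  ∃-Σ   : ∀ {n k} {φ : Formula (suc k)} → IsΣ (suc n) φ → IsΣ (suc n) (∃' φ)

data IsΠ where
  Δ₀→Π₀ : ∀ {k} {φ : Formula k} → Δ₀ φ → IsΠ 0 φ
  Σ→Π   : ∀ {n k} {φ : Formula k} → IsΣ n φ → IsΠ (suc n) φ
  ∀-Π   : ∀ {n k} {φ : Formula (suc k)} → IsΠ (suc n) φ → IsΠ (suc n) (∀' φ)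

infix 3 _⊢_

data _⊢_ {k : ℕ} (Γ : List (Formula k)) : Formula k → Set where
  ax   : ∀ {φ} → φ ∈ Γ → Γ ⊢ φ
  raa  : ∀ {φ} → (¬' φ ∷ Γ) ⊢ ⊥' → Γ ⊢ φ
  ¬I   : ∀ {φ} → (φ ∷ Γ) ⊢ ⊥' → Γ ⊢ ¬' φ
  ¬E   : ∀ {φ} → Γ ⊢ ¬' φ → Γ ⊢ φ → Γ ⊢ ⊥'
  ∧I   : ∀ {φ ψ} → Γ ⊢ φ → Γ ⊢ ψ → Γ ⊢ φ ∧' ψ
  ∧E₁  : ∀ {φ ψ} → Γ ⊢ φ ∧' ψ → Γ ⊢ φ
  ∧E₂  : ∀ {φ ψ} → Γ ⊢ φ ∧' ψ → Γ ⊢ ψ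
  ∨I₁  : ∀ {φ ψ} → Γ ⊢ φ → Γ ⊢ φ ∨' ψ
  ∨I₂  : ∀ {φ ψ} → Γ ⊢ ψ → Γ ⊢ φ ∨' ψ
  ∨E   : ∀ {φ ψ χ} → Γ ⊢ φ ∨' ψ → (φ ∷ Γ) ⊢ χ → (ψ ∷ Γ) ⊢ χ → Γ ⊢ χ
  ⇒I   : ∀ {φ ψ} → (φ ∷ Γ) ⊢ ψ → Γ ⊢ φ ⇒' ψ
  ⇒E   : ∀ {φ ψ} → Γ ⊢ φ ⇒' ψ → Γ ⊢ φ → Γ ⊢ ψ
  ∀I   : ∀ {φ} → map wk Γ ⊢ φ → Γ ⊢ ∀' φ
  ∀E   : ∀ {φ} → Γ ⊢ ∀' φ → (x : Fin k) → Γ ⊢ φ [ x ]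
  ∃I   : ∀ {φ} (x : Fin k) → Γ ⊢ φ [ x ] → Γ ⊢ ∃' φ
  ∃E   : ∀ {φ χ} → Γ ⊢ ∃' φ → (φ ∷ map wk Γ) ⊢ wk χ → Γ ⊢ χ
  ≐refl  : ∀ x → Γ ⊢ x ≐ x
  ≐subst : ∀ {x y} (φ : Formula (suc k)) → Γ ⊢ x ≐ y → Γ ⊢ φ [ x ] → Γ ⊢ φ [ y ]

Theory : Set₁
Theory = Sentence → Set

-- T ⊢ φ : φ is derivable from finitely many axioms of T.  The derivation
-- is carried out with one free variable available (level 1), reflecting
-- the standard convention that domains are nonempty.
wk₀ : Sentence → Formula 1
wk₀ = rename (λ ())

_⊩_ : Theory → Sentence → Set
T ⊩ φ = Σ (List Sentence) λ Γ → All T Γ × (map wk₀ Γ ⊢ wk₀ φ)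

Consistent : Theory → Set
Consistent T = ¬ (T ⊩ ⊥')

v0 : ∀ {k} → Fin (suc k)
v0 = zero
v1 : ∀ {k} → Fin (suc (suc k))
v1 = suc zero
v2 : ∀ {k} → Fin (suc (suc (suc k)))
v2 = suc (suc zero)
v3 : ∀ {k} → Fin (suc (suc (suc (suc k))))
v3 = suc (suc (suc zero))

Extensionality : Sentence
Extensionality = ∀' (∀' (∀' ((v0 ∈' v2) ⇔' (v0 ∈' v1)) ⇒' (v1 ≐ v0)))

Pairing : Sentence
Pairing = ∀' (∀' (∃' ((v2 ∈' v0) ∧' (v1 ∈' v0))))

Union : Sentence
Union = ∀' (∃' (∀∈ v1 (∀∈ v0 (v0 ∈' v2))))

Separation : ∀ {k} → Formula (suc k) → Sentence
Separation {k} φ =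
  close (∀' (∃' (∀' ((v0 ∈' v1) ⇔' ((v0 ∈' v2) ∧' rename ρ φ)))))
  where
  ρ : Fin (suc k) → Fin (suc (suc (suc k)))
  ρ zero    = zero
  ρ (suc i) = suc (suc (suc i))

-- Δ₀-collection for φ(x, y, p⃗) (var 0 = y, var 1 = x):
-- ∀p⃗ ∀a (∀x∈a ∃y φ → ∃b ∀x∈a ∃y∈b φ)
Collection : ∀ {k} → Formula (suc (suc k)) → Sentence
Collection {k} φ =
  close (∀' (∀∈ v0 (∃' (rename ρ₁ φ))
             ⇒' ∃' (∀∈ v1 (∃∈ v1 (rename ρ₂ φ)))))
  where
  ρ₁ : Fin (suc (suc k)) → Fin (suc (suc (suc k)))
  ρ₁ zero          = zero
  ρ₁ (suc zero)    = suc zero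
  ρ₁ (suc (suc i)) = suc (suc (suc i))
  ρ₂ : Fin (suc (suc k)) → Fin (suc (suc (suc (suc k))))
  ρ₂ zero          = zero
  ρ₂ (suc zero)    = suc zero
  ρ₂ (suc (suc i)) = suc (suc (suc (suc i)))

Foundation : ∀ {k} → Formula (suc k) → Sentence
Foundation {k} φ =
  close (∃' φ ⇒' ∃' (φ ∧' ∀∈ v0 (¬' rename ρ φ)))
  where
  ρ : Fin (suc k) → Fin (suc (suc k))
  ρ zero    = zero
  ρ (suc i) = suc (suc i)

data KP : Theory where
  kp-ext   : KP Extensionality
  kp-pair  : KP Pairing
  kp-union : KP Union
  kp-sep   : ∀ {k} (φ : Formula (suc k)) → Δ₀ φ → KP (Separation φ)
  kp-coll  : ∀ {k} (φ : Formula (suc (suc k))) → Δ₀ φ → KP (Collection φ)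
  kp-found : ∀ {k} (φ : Formula (suc k)) → IsΠ 1 φ → KP (Foundation φ)

{-# OPTIONS --safe #-}
module Submission where

-- Suppose T were complete.  Then truth in a model of T would be definable in it, contradicting
-- Tarski: a sentence holds iff it follows from Σₙ-sentences that are true, and these have a truth
-- predicate.  As the model may contain nonstandard proofs, truth is defined à la Rosser: φ(x) is
-- true iff some stage i proves φ(x), but not ¬φ(x), from a true Σₙ-premise.  A derivation at stage i
-- takes its premises at a stage j ∈ i; a set i of finite rank therefore admits only standard
-- derivations, and every other i admits all of them.  Instead of numerals the parameter x is used:
-- x is the code of φ itself, and that x is this code is a true Δ₀-premise.
-- The truth predicate for Δ₀-formulas and the stages are both inductive definitions given by
-- clauses, whose derivations are sets; Δ₀-collection and Δ₀-separation provide them.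
-- The model exists constructively because the conclusion is negative: Henkin axioms are added for
-- all formulas, and then every formula that is consistent at its turn.

-- `T` need not be recursively enumerable, so its axioms cannot be described inside the model.
-- Completeness turns every sentence true in the model into a theorem of `T`; the finitely many
-- axioms in its proof, all true, merge into one premise of fixed complexity. The bound `n` makes
-- truth of this premise definable. Standardness is not expressible inside the model either. It is
-- replaced by a case distinction: `Rank h i` or not, for one external number `h`. If the Rosser
-- formula is true of its own code, it is proved at every stage of sufficient height `h`, in
-- particular at the iterated singleton `clock h`, where it is then also refuted; derivations at
-- `clock h` are genuine, so it is false. If it is false, its refutation is present at all `i` with
-- `Rank h i`, while the remaining stages have only genuine derivations and cannot prove it; so it
-- is true. All inductions over formulas, shapes and heights run outside the model. Inside, a
-- derivation is just a set of judgements each of which is supported by others in the set.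

open import Defs
open import Data.Nat using (ℕ; zero; suc; _+_; _⊔_; _≤_; _<_; z≤n; s≤s; _≟_)
open import Data.Nat.Properties using (m≤m⊔n; m≤n⊔m; ≤-trans; ≤-refl; <-≤-trans; <-irrefl; m≤n⇒m≤1+n; m≤n⇒m<n∨m≡n)
open import Data.Fin using (Fin; zero; suc; _↑ˡ_; _↑ʳ_; #_) renaming (toℕ to idx)
open import Data.List using (List; []; _∷_; map; _++_; allFin; lookup)
open import Data.List.Membership.Propositional using (_∈_)
open import Data.List.Membership.Propositional.Properties using (∈-map⁺; ∈-map⁻; ∈-++⁺ˡ; ∈-++⁺ʳ; ∈-++⁻; ∈-allFin; ∈-lookup)
open import Data.List.Relation.Unary.Any using (here; there)
open import Data.List.Relation.Unary.All using (All; []; _∷_) renaming (lookup to All-lookup)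
open import Data.List.Relation.Unary.All.Properties using (++⁺)
open import Data.List.Properties using (map-++)
open import Data.Product using (Σ; _×_; _,_; proj₁; proj₂)
open import Data.Sum using (_⊎_; inj₁; inj₂)
open import Data.Empty using (⊥; ⊥-elim)
open import Data.Unit using (⊤; tt)
open import Data.Bool using (Bool; true; false; if_then_else_; _∨_)
open import Relation.Nullary using (¬_; yes; no)
open import Relation.Binary.PropositionalEquality using (_≡_; refl; sym; trans; cong; cong₂; subst; subst₂)
open import Function using (_∘_; id)
open import Data.Nat.Binary using (ℕᵇ; 2[1+_]; 1+[2_]; fromℕ; toℕ)
open import Data.Nat.Binary.Properties using (fromℕ-toℕ)

-- First-order logic in ⊥, → and ∀

infixr 5 _⊃_
data F : Set where
  mem eq : ℕ → ℕ → F
  bot    : F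
  _⊃_    : F → F → F
  all    : F → F

neg : F → F
neg φ = φ ⊃ bot

lift : (ℕ → ℕ) → ℕ → ℕ
lift r zero    = zero
lift r (suc n) = suc (r n)

infixr 5 _▸_ _▹_
_▸_ : {A : Set} → A → (ℕ → A) → ℕ → A
(a ▸ ρ) zero    = a
(a ▸ ρ) (suc n) = ρ n

_▹_ : {A : Set} {k : ℕ} → A → (Fin k → A) → Fin (suc k) → A
(a ▹ ρ) zero    = a
(a ▹ ρ) (suc i) = ρ i

ren : (ℕ → ℕ) → F → F
ren r (mem x y) = mem (r x) (r y)
ren r (eq x y)  = eq (r x) (r y)
ren r bot       = bot
ren r (φ ⊃ ψ)   = ren r φ ⊃ ren r ψ
ren r (all φ)   = all (ren (lift r) φ)

_⟨_⟩ : F → ℕ → F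
φ ⟨ x ⟩ = ren (x ▸ id) φ

ren-cong : ∀ {r s} → (∀ n → r n ≡ s n) → ∀ φ → ren r φ ≡ ren s φ
ren-cong h (mem x y) = cong₂ mem (h x) (h y)
ren-cong h (eq x y)  = cong₂ eq (h x) (h y)
ren-cong h bot       = refl
ren-cong h (φ ⊃ ψ)   = cong₂ _⊃_ (ren-cong h φ) (ren-cong h ψ)
ren-cong h (all φ)   = cong all (ren-cong (λ { zero → refl ; (suc n) → cong suc (h n) }) φ)

ren-∘ : ∀ r s φ → ren r (ren s φ) ≡ ren (r ∘ s) φ
ren-∘ r s (mem x y) = refl
ren-∘ r s (eq x y)  = refl
ren-∘ r s bot       = refl
ren-∘ r s (φ ⊃ ψ)   = cong₂ _⊃_ (ren-∘ r s φ) (ren-∘ r s ψ)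
ren-∘ r s (all φ)   = cong all (trans (ren-∘ (lift r) (lift s) φ)
                                      (ren-cong (λ { zero → refl ; (suc n) → refl }) φ))

ren-id : ∀ {r} → (∀ n → r n ≡ n) → ∀ φ → ren r φ ≡ φ
ren-id h (mem x y) = cong₂ mem (h x) (h y)
ren-id h (eq x y)  = cong₂ eq (h x) (h y)
ren-id h bot       = refl
ren-id h (φ ⊃ ψ)   = cong₂ _⊃_ (ren-id h φ) (ren-id h ψ)
ren-id h (all φ)   = cong all (ren-id (λ { zero → refl ; (suc n) → cong suc (h n) }) φ)

ren-⟨⟩ : ∀ r φ x → ren r (φ ⟨ x ⟩) ≡ ren (lift r) φ ⟨ r x ⟩
ren-⟨⟩ r φ x = trans (ren-∘ r (x ▸ id) φ)
  (trans (ren-cong (λ { zero → refl ; (suc n) → refl }) φ) (sym (ren-∘ (r x ▸ id) (lift r) φ)))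

ren-wk : ∀ r φ → ren (lift r) (ren suc φ) ≡ ren suc (ren r φ)
ren-wk r φ = trans (ren-∘ (lift r) suc φ) (sym (ren-∘ suc r φ))

-- A Hilbert calculus on single formulas, with variables from all of ℕ: neither contexts nor scopes
-- need codes, so each rule can become one Horn clause of `syn`.
data Thm : F → Set where
  axK    : ∀ {φ ψ} → Thm (φ ⊃ ψ ⊃ φ)
  axS    : ∀ {φ ψ χ} → Thm ((φ ⊃ ψ ⊃ χ) ⊃ (φ ⊃ ψ) ⊃ φ ⊃ χ)
  axDN   : ∀ {φ} → Thm (neg (neg φ) ⊃ φ)
  mp     : ∀ {φ ψ} → Thm (φ ⊃ ψ) → Thm φ → Thm ψ
  gen    : ∀ {φ} → Thm φ → Thm (all φ)
  axDist : ∀ {φ ψ} → Thm (all (ren suc φ ⊃ ψ) ⊃ φ ⊃ all ψ)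
  axInst : ∀ φ x → Thm (all φ ⊃ φ ⟨ x ⟩)
  axRefl : ∀ x → Thm (eq x x)
  axSub  : ∀ φ x y → Thm (eq x y ⊃ φ ⟨ x ⟩ ⊃ φ ⟨ y ⟩)

Thm-ren : ∀ r {φ} → Thm φ → Thm (ren r φ)
Thm-ren r axK = axK
Thm-ren r axS = axS
Thm-ren r axDN = axDN
Thm-ren r (mp d e) = mp (Thm-ren r d) (Thm-ren r e)
Thm-ren r (gen d) = gen (Thm-ren (lift r) d)
Thm-ren r (axDist {φ} {ψ}) =
  subst (λ χ → Thm (all (χ ⊃ ren (lift r) ψ) ⊃ ren r φ ⊃ all (ren (lift r) ψ))) (sym (ren-wk r φ)) axDist
Thm-ren r (axInst φ x) =
  subst (λ χ → Thm (all (ren (lift r) φ) ⊃ χ)) (sym (ren-⟨⟩ r φ x)) (axInst (ren (lift r) φ) (r x))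
Thm-ren r (axRefl x) = axRefl (r x)
Thm-ren r (axSub φ x y) =
  subst₂ (λ χ χ' → Thm (eq (r x) (r y) ⊃ χ ⊃ χ')) (sym (ren-⟨⟩ r φ x)) (sym (ren-⟨⟩ r φ y))
    (axSub (ren (lift r) φ) (r x) (r y))

-- The hypotheses are stored innermost first, so that discharging one is the identity on derivations.
_⇛_ : List F → F → F
[] ⇛ φ      = φ
(ψ ∷ Γ) ⇛ φ = Γ ⇛ (ψ ⊃ φ)

infix 3 _⊢ᶜ_
record _⊢ᶜ_ (Γ : List F) (φ : F) : Set where
  constructor der
  field thm : Thm (Γ ⇛ φ)
open _⊢ᶜ_ public

weak : ∀ {Γ φ} → Thm φ → Γ ⊢ᶜ φ
weak {[]}    d = der d
weak {ψ ∷ Γ} d = der (thm (weak {Γ} (mp axK d)))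

app : ∀ {Γ φ ψ} → Γ ⊢ᶜ φ ⊃ ψ → Γ ⊢ᶜ φ → Γ ⊢ᶜ ψ
app {[]}    (der d) (der e) = der (mp d e)
app {χ ∷ Γ} (der d) (der e) = der (thm (app {Γ} (app {Γ} (weak axS) (der d)) (der e)))

lam : ∀ {Γ φ ψ} → φ ∷ Γ ⊢ᶜ ψ → Γ ⊢ᶜ φ ⊃ ψ
lam (der d) = der d

h0 : ∀ {Γ φ} → φ ∷ Γ ⊢ᶜ φ
h0 {Γ} = der (thm (weak {Γ} (mp (mp axS axK) (axK {_} {bot}))))

wkᶜ : ∀ {Γ φ ψ} → Γ ⊢ᶜ φ → ψ ∷ Γ ⊢ᶜ φ
wkᶜ {Γ} d = der (thm (app {Γ} (weak axK) d))

h1 : ∀ {Γ φ ψ} → ψ ∷ φ ∷ Γ ⊢ᶜ φ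
h1 = wkᶜ h0

h2 : ∀ {Γ φ ψ χ} → χ ∷ ψ ∷ φ ∷ Γ ⊢ᶜ φ
h2 = wkᶜ h1

raaᶜ : ∀ {Γ φ} → neg φ ∷ Γ ⊢ᶜ bot → Γ ⊢ᶜ φ
raaᶜ d = app (weak axDN) (lam d)

efq : ∀ {Γ φ} → Γ ⊢ᶜ bot → Γ ⊢ᶜ φ
efq d = raaᶜ (wkᶜ d)

hyp : ∀ {Γ φ} → φ ∈ Γ → Γ ⊢ᶜ φ
hyp (here refl) = h0
hyp (there i)   = wkᶜ (hyp i)

allI : ∀ {Γ φ} → map (ren suc) Γ ⊢ᶜ φ → Γ ⊢ᶜ all φ
allI {[]}    (der d) = der (gen d)
allI {ψ ∷ Γ} (der d) = der (thm (app {Γ} (weak axDist) (allI {Γ} (der d))))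

allE : ∀ {Γ} φ x → Γ ⊢ᶜ all φ → Γ ⊢ᶜ φ ⟨ x ⟩
allE φ x d = app (weak (axInst φ x)) d

⟨0⟩-lift : ∀ φ → ren (lift suc) φ ⟨ 0 ⟩ ≡ φ
⟨0⟩-lift φ = trans (ren-∘ (0 ▸ id) (lift suc) φ) (ren-id (λ { zero → refl ; (suc n) → refl }) φ)

allE0 : ∀ {Γ} φ → Γ ⊢ᶜ all (ren (lift suc) φ) → Γ ⊢ᶜ φ
allE0 φ d = subst (_ ⊢ᶜ_) (⟨0⟩-lift φ) (allE (ren (lift suc) φ) 0 d)

-- Translation of natural deduction into the Hilbert calculus

lift' : ∀ {k} → (Fin k → ℕ) → Fin (suc k) → ℕ
lift' v = 0 ▹ (suc ∘ v)

tr : ∀ {k} → (Fin k → ℕ) → Formula k → F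
tr v (x ∈' y) = mem (v x) (v y)
tr v (x ≐ y)  = eq (v x) (v y)
tr v ⊥'       = bot
tr v (¬' φ)   = neg (tr v φ)
tr v (φ ∧' ψ) = neg (tr v φ ⊃ neg (tr v ψ))
tr v (φ ∨' ψ) = neg (tr v φ) ⊃ tr v ψ
tr v (φ ⇒' ψ) = tr v φ ⊃ tr v ψ
tr v (∀' φ)   = all (tr (lift' v) φ)
tr v (∃' φ)   = neg (all (neg (tr (lift' v) φ)))

tr-cong : ∀ {k} {v w : Fin k → ℕ} → (∀ i → v i ≡ w i) → ∀ φ → tr v φ ≡ tr w φ
tr-cong-lift : ∀ {k} {v w : Fin k → ℕ} → (∀ i → v i ≡ w i) → ∀ φ → tr (lift' v) φ ≡ tr (lift' w) φ
tr-cong h (x ∈' y) = cong₂ mem (h x) (h y)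
tr-cong h (x ≐ y)  = cong₂ eq (h x) (h y)
tr-cong h ⊥'       = refl
tr-cong h (¬' φ)   = cong neg (tr-cong h φ)
tr-cong h (φ ∧' ψ) = cong₂ (λ a b → neg (a ⊃ neg b)) (tr-cong h φ) (tr-cong h ψ)
tr-cong h (φ ∨' ψ) = cong₂ (λ a b → neg a ⊃ b) (tr-cong h φ) (tr-cong h ψ)
tr-cong h (φ ⇒' ψ) = cong₂ _⊃_ (tr-cong h φ) (tr-cong h ψ)
tr-cong h (∀' φ)   = cong all (tr-cong-lift h φ)
tr-cong h (∃' φ)   = cong (λ a → neg (all (neg a))) (tr-cong-lift h φ)
tr-cong-lift h = tr-cong (λ { zero → refl ; (suc i) → cong suc (h i) })

tr-rename : ∀ {k m} (v : Fin m → ℕ) (ρ : Fin k → Fin m) φ → tr v (rename ρ φ) ≡ tr (v ∘ ρ) φ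
tr-rename-lift : ∀ {k m} (v : Fin m → ℕ) (ρ : Fin k → Fin m) φ →
  tr (lift' v) (rename (ext ρ) φ) ≡ tr (lift' (v ∘ ρ)) φ
tr-rename v ρ (x ∈' y) = refl
tr-rename v ρ (x ≐ y)  = refl
tr-rename v ρ ⊥'       = refl
tr-rename v ρ (¬' φ)   = cong neg (tr-rename v ρ φ)
tr-rename v ρ (φ ∧' ψ) = cong₂ (λ a b → neg (a ⊃ neg b)) (tr-rename v ρ φ) (tr-rename v ρ ψ)
tr-rename v ρ (φ ∨' ψ) = cong₂ (λ a b → neg a ⊃ b) (tr-rename v ρ φ) (tr-rename v ρ ψ)
tr-rename v ρ (φ ⇒' ψ) = cong₂ _⊃_ (tr-rename v ρ φ) (tr-rename v ρ ψ)
tr-rename v ρ (∀' φ)   = cong all (tr-rename-lift v ρ φ)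
tr-rename v ρ (∃' φ)   = cong (λ a → neg (all (neg a))) (tr-rename-lift v ρ φ)
tr-rename-lift v ρ φ = trans (tr-rename (lift' v) (ext ρ) φ)
  (tr-cong (λ { zero → refl ; (suc i) → refl }) φ)

ren-tr : ∀ {k} r (v : Fin k → ℕ) φ → ren r (tr v φ) ≡ tr (r ∘ v) φ
ren-tr-lift : ∀ {k} r (v : Fin k → ℕ) φ → ren (lift r) (tr (lift' v) φ) ≡ tr (lift' (r ∘ v)) φ
ren-tr r v (x ∈' y) = refl
ren-tr r v (x ≐ y)  = refl
ren-tr r v ⊥'       = refl
ren-tr r v (¬' φ)   = cong neg (ren-tr r v φ)
ren-tr r v (φ ∧' ψ) = cong₂ (λ a b → neg (a ⊃ neg b)) (ren-tr r v φ) (ren-tr r v ψ)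
ren-tr r v (φ ∨' ψ) = cong₂ (λ a b → neg a ⊃ b) (ren-tr r v φ) (ren-tr r v ψ)
ren-tr r v (φ ⇒' ψ) = cong₂ _⊃_ (ren-tr r v φ) (ren-tr r v ψ)
ren-tr r v (∀' φ)   = cong all (ren-tr-lift r v φ)
ren-tr r v (∃' φ)   = cong (λ a → neg (all (neg a))) (ren-tr-lift r v φ)
ren-tr-lift r v φ = trans (ren-tr (lift r) (lift' v) φ) (tr-cong (λ { zero → refl ; (suc i) → refl }) φ)

tr-wk : ∀ {k} (v : Fin k → ℕ) φ → tr (lift' v) (wk φ) ≡ ren suc (tr v φ)
tr-wk v φ = trans (tr-rename (lift' v) suc φ) (sym (ren-tr suc v φ))

tr-map-wk : ∀ {k} (v : Fin k → ℕ) Γ → map (tr (lift' v)) (map wk Γ) ≡ map (ren suc) (map (tr v) Γ)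
tr-map-wk v []      = refl
tr-map-wk v (φ ∷ Γ) = cong₂ _∷_ (tr-wk v φ) (tr-map-wk v Γ)

tr-[] : ∀ {k} (v : Fin k → ℕ) φ x → tr v (φ [ x ]) ≡ tr (lift' v) φ ⟨ v x ⟩
tr-[] v φ x = trans (tr-rename v (inst x) φ)
  (trans (tr-cong (λ { zero → refl ; (suc i) → refl }) φ) (sym (ren-tr (v x ▸ id) (lift' v) φ)))

tr-sim : ∀ {k Γ} {φ : Formula k} → Γ ⊢ φ → (v : Fin k → ℕ) → map (tr v) Γ ⊢ᶜ tr v φ
tr-sim (ax i) v = hyp (∈-map⁺ (tr v) i)
tr-sim (raa d) v = raaᶜ (tr-sim d v)
tr-sim (¬I d) v = lam (tr-sim d v)
tr-sim (¬E d e) v = app (tr-sim d v) (tr-sim e v)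
tr-sim (∧I d e) v = lam (app (app h0 (wkᶜ (tr-sim d v))) (wkᶜ (tr-sim e v)))
tr-sim (∧E₁ d) v = raaᶜ (app (wkᶜ (tr-sim d v)) (lam (efq (app h1 h0))))
tr-sim (∧E₂ d) v = raaᶜ (app (wkᶜ (tr-sim d v)) (lam h1))
tr-sim (∨I₁ d) v = lam (efq (app h0 (wkᶜ (tr-sim d v))))
tr-sim (∨I₂ d) v = wkᶜ′ (tr-sim d v)
  where wkᶜ′ : ∀ {Γ φ ψ} → Γ ⊢ᶜ φ → Γ ⊢ᶜ ψ ⊃ φ
        wkᶜ′ d = lam (wkᶜ d)
tr-sim (∨E d e f) v = raaᶜ (app h0 (app (wkᶜ (lam (tr-sim f v)))
  (app (wkᶜ (tr-sim d v)) (lam (app h1 (app (wkᶜ (wkᶜ (lam (tr-sim e v)))) h0))))))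
tr-sim (⇒I d) v = lam (tr-sim d v)
tr-sim (⇒E d e) v = app (tr-sim d v) (tr-sim e v)
tr-sim {Γ = Γ} (∀I d) v = allI (subst (_⊢ᶜ _) (tr-map-wk v Γ) (tr-sim d (lift' v)))
tr-sim (∀E {φ} d x) v = subst (_ ⊢ᶜ_) (sym (tr-[] v φ x)) (allE _ (v x) (tr-sim d v))
tr-sim (∃I {φ} x d) v = lam (app (allE _ (v x) h0) (wkᶜ (subst (_ ⊢ᶜ_) (tr-[] v φ x) (tr-sim d v))))
tr-sim {Γ = Γ} (∃E {φ} {χ} d e) v = raaᶜ (app (wkᶜ (tr-sim d v)) (allI (lam (app h1
  (app (wkᶜ (wkᶜ (lam (subst₂ (λ Δ α → tr (lift' v) φ ∷ Δ ⊢ᶜ α) (tr-map-wk v Γ) (tr-wk v χ)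
    (tr-sim e (lift' v)))))) h0)))))
tr-sim (≐refl x) v = weak (axRefl (v x))
tr-sim (≐subst {x} {y} φ d e) v = subst (_ ⊢ᶜ_) (sym (tr-[] v φ y))
  (app (app (weak (axSub (tr (lift' v) φ) (v x) (v y))) (tr-sim d v)) (subst (_ ⊢ᶜ_) (tr-[] v φ x) (tr-sim e v)))

-- Translation back into natural deduction

_⊆_ : ∀ {A : Set} → List A → List A → Set
Γ ⊆ Δ = ∀ {φ} → φ ∈ Γ → φ ∈ Δ

∷-⊆ : ∀ {A : Set} {Γ Δ : List A} {ψ} → Γ ⊆ Δ → (ψ ∷ Γ) ⊆ (ψ ∷ Δ)
∷-⊆ s (here e)  = here e
∷-⊆ s (there i) = there (s i)

map-⊆ : ∀ {A B : Set} (f : A → B) {Γ Δ : List A} → Γ ⊆ Δ → map f Γ ⊆ map f Δ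
map-⊆ f s i with ∈-map⁻ f i
... | _ , j , refl = ∈-map⁺ f (s j)

weaken : ∀ {k} {Γ Δ : List (Formula k)} {φ} → Γ ⊆ Δ → Γ ⊢ φ → Δ ⊢ φ
weaken s (ax i) = ax (s i)
weaken s (raa d) = raa (weaken (∷-⊆ s) d)
weaken s (¬I d) = ¬I (weaken (∷-⊆ s) d)
weaken s (¬E d e) = ¬E (weaken s d) (weaken s e)
weaken s (∧I d e) = ∧I (weaken s d) (weaken s e)
weaken s (∧E₁ d) = ∧E₁ (weaken s d)
weaken s (∧E₂ d) = ∧E₂ (weaken s d)
weaken s (∨I₁ d) = ∨I₁ (weaken s d)
weaken s (∨I₂ d) = ∨I₂ (weaken s d)
weaken s (∨E d e f) = ∨E (weaken s d) (weaken (∷-⊆ s) e) (weaken (∷-⊆ s) f)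
weaken s (⇒I d) = ⇒I (weaken (∷-⊆ s) d)
weaken s (⇒E d e) = ⇒E (weaken s d) (weaken s e)
weaken s (∀I d) = ∀I (weaken (map-⊆ wk s) d)
weaken s (∀E d x) = ∀E (weaken s d) x
weaken s (∃I x d) = ∃I x (weaken s d)
weaken s (∃E d e) = ∃E (weaken s d) (weaken (∷-⊆ (map-⊆ wk s)) e)
weaken s (≐refl x) = ≐refl x
weaken s (≐subst φ d e) = ≐subst φ (weaken s d) (weaken s e)

wk₁ : ∀ {k} {Γ : List (Formula k)} {φ ψ} → Γ ⊢ φ → ψ ∷ Γ ⊢ φ
wk₁ = weaken there

conv : ∀ {k} {Γ : List (Formula k)} {φ ψ} → φ ≡ ψ → Γ ⊢ φ → Γ ⊢ ψ
conv refl d = d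

-- `σ` may identify variables, which derivations survive; `⊢ᵀ⇒back` sends all of them to the single
-- free variable that `_⊩_` provides.
back : ∀ {m} → (ℕ → Fin m) → F → Formula m
back σ (mem x y) = σ x ∈' σ y
back σ (eq x y)  = σ x ≐ σ y
back σ bot       = ⊥'
back σ (φ ⊃ ψ)   = back σ φ ⇒' back σ ψ
back σ (all φ)   = ∀' (back (zero ▸ (suc ∘ σ)) φ)

back-cong : ∀ {m} {σ τ : ℕ → Fin m} → (∀ n → σ n ≡ τ n) → ∀ φ → back σ φ ≡ back τ φ
back-cong h (mem x y) = cong₂ _∈'_ (h x) (h y)
back-cong h (eq x y)  = cong₂ _≐_ (h x) (h y)
back-cong h bot       = refl
back-cong h (φ ⊃ ψ)   = cong₂ _⇒'_ (back-cong h φ) (back-cong h ψ)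
back-cong h (all φ)   = cong ∀' (back-cong (λ { zero → refl ; (suc n) → cong suc (h n) }) φ)

back-ren : ∀ {m} (σ : ℕ → Fin m) r φ → back σ (ren r φ) ≡ back (σ ∘ r) φ
back-ren σ r (mem x y) = refl
back-ren σ r (eq x y)  = refl
back-ren σ r bot       = refl
back-ren σ r (φ ⊃ ψ)   = cong₂ _⇒'_ (back-ren σ r φ) (back-ren σ r ψ)
back-ren σ r (all φ)   = cong ∀' (trans (back-ren (zero ▸ (suc ∘ σ)) (lift r) φ)
                                        (back-cong (λ { zero → refl ; (suc n) → refl }) φ))

rename-back : ∀ {m l} (ρ : Fin m → Fin l) (σ : ℕ → Fin m) φ → rename ρ (back σ φ) ≡ back (ρ ∘ σ) φ
rename-back ρ σ (mem x y) = refl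
rename-back ρ σ (eq x y)  = refl
rename-back ρ σ bot       = refl
rename-back ρ σ (φ ⊃ ψ)   = cong₂ _⇒'_ (rename-back ρ σ φ) (rename-back ρ σ ψ)
rename-back ρ σ (all φ)   = cong ∀' (trans (rename-back (ext ρ) (zero ▸ (suc ∘ σ)) φ)
                                           (back-cong (λ { zero → refl ; (suc n) → refl }) φ))

back-⟨⟩ : ∀ {m} (σ : ℕ → Fin m) φ x → back σ (φ ⟨ x ⟩) ≡ back (zero ▸ (suc ∘ σ)) φ [ σ x ]
back-⟨⟩ σ φ x = trans (back-ren σ (x ▸ id) φ)
  (trans (back-cong (λ { zero → refl ; (suc n) → refl }) φ)
         (sym (rename-back (inst (σ x)) (zero ▸ (suc ∘ σ)) φ)))

a0 : ∀ {k} {Γ : List (Formula k)} {φ} → φ ∷ Γ ⊢ φ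
a0 = ax (here refl)
a1 : ∀ {k} {Γ : List (Formula k)} {φ ψ} → ψ ∷ φ ∷ Γ ⊢ φ
a1 = ax (there (here refl))
a2 : ∀ {k} {Γ : List (Formula k)} {φ ψ χ} → χ ∷ ψ ∷ φ ∷ Γ ⊢ φ
a2 = ax (there (there (here refl)))

back-Thm : ∀ {φ} → Thm φ → ∀ {m} (σ : ℕ → Fin m) → [] ⊢ back σ φ
back-Thm axK σ = ⇒I (⇒I a1)
back-Thm axS σ = ⇒I (⇒I (⇒I (⇒E (⇒E a2 a0) (⇒E a1 a0))))
back-Thm axDN σ = ⇒I (raa (⇒E a1 (⇒I (¬E a1 a0))))
back-Thm (mp d e) σ = ⇒E (back-Thm d σ) (back-Thm e σ)
back-Thm (gen d) σ = ∀I (back-Thm d (zero ▸ (suc ∘ σ)))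
back-Thm (axDist {φ} {ψ}) {m} σ = ⇒I (⇒I (∀I (⇒E (conv e (∀E a1 zero)) a0)))
  where
  e : rename (ext suc) (back (zero ▸ (suc ∘ σ)) (ren suc φ ⊃ ψ)) [ zero ]
      ≡ wk (back σ φ) ⇒' back (zero ▸ (suc ∘ σ)) ψ
  e = cong₂ _⇒'_
    (trans (cong (λ χ → rename (inst zero) (rename (ext suc) χ)) (back-ren (zero ▸ (suc ∘ σ)) suc φ))
      (trans (cong (rename (inst zero)) (rename-back (ext suc) (suc ∘ σ) φ))
        (trans (rename-back (inst zero) (ext suc ∘ suc ∘ σ) φ) (sym (rename-back suc σ φ)))))
    (trans (cong (rename (inst zero)) (rename-back (ext suc) (zero ▸ (suc ∘ σ)) ψ))
      (trans (rename-back (inst zero) (ext suc ∘ (zero ▸ (suc ∘ σ))) ψ)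
        (back-cong (λ { zero → refl ; (suc n) → refl }) ψ)))
back-Thm (axInst φ x) σ = ⇒I (conv (sym (back-⟨⟩ σ φ x)) (∀E a0 (σ x)))
back-Thm (axRefl x) σ = ≐refl (σ x)
back-Thm (axSub φ x y) σ = ⇒I (⇒I (conv (sym (back-⟨⟩ σ φ y))
  (≐subst _ a1 (conv (back-⟨⟩ σ φ x) a0))))

-- The round trip replaces ¬, ∧, ∨ and ∃ by their definitions from ⊥, → and ∀, so only
-- interderivability is left. It is required in every context so that it passes under binders and
-- discharged assumptions.
record Same {m : ℕ} (φ ψ : Formula m) : Set where
  constructor same
  field
    to   : ∀ {Γ} → Γ ⊢ φ → Γ ⊢ ψ
    from : ∀ {Γ} → Γ ⊢ ψ → Γ ⊢ φ

cut : ∀ {m} {Γ : List (Formula m)} {φ ψ} → φ ∷ Γ ⊢ ψ → Γ ⊢ φ → Γ ⊢ ψ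
cut d e = ⇒E (⇒I d) e

rename-cong : ∀ {a b} {r s : Fin a → Fin b} → (∀ i → r i ≡ s i) → ∀ χ → rename r χ ≡ rename s χ
rename-cong-ext : ∀ {a b} {r s : Fin a → Fin b} → (∀ i → r i ≡ s i) → ∀ χ → rename (ext r) χ ≡ rename (ext s) χ
rename-cong h (x ∈' y) = cong₂ _∈'_ (h x) (h y)
rename-cong h (x ≐ y)  = cong₂ _≐_ (h x) (h y)
rename-cong h ⊥'       = refl
rename-cong h (¬' φ)   = cong ¬'_ (rename-cong h φ)
rename-cong h (φ ∧' ψ) = cong₂ _∧'_ (rename-cong h φ) (rename-cong h ψ)
rename-cong h (φ ∨' ψ) = cong₂ _∨'_ (rename-cong h φ) (rename-cong h ψ)
rename-cong h (φ ⇒' ψ) = cong₂ _⇒'_ (rename-cong h φ) (rename-cong h ψ)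
rename-cong h (∀' φ)   = cong ∀' (rename-cong-ext h φ)
rename-cong h (∃' φ)   = cong ∃' (rename-cong-ext h φ)
rename-cong-ext h = rename-cong (λ { zero → refl ; (suc i) → cong suc (h i) })
rename-∘ : ∀ {a b c} {r : Fin b → Fin c} {s : Fin a → Fin b} χ → rename r (rename s χ) ≡ rename (r ∘ s) χ
rename-∘-ext : ∀ {a b c} {r : Fin b → Fin c} {s : Fin a → Fin b} χ →
  rename (ext r) (rename (ext s) χ) ≡ rename (ext (r ∘ s)) χ
rename-∘ (x ∈' y) = refl
rename-∘ (x ≐ y)  = refl
rename-∘ ⊥'       = refl
rename-∘ (¬' φ)   = cong ¬'_ (rename-∘ φ)
rename-∘ (φ ∧' ψ) = cong₂ _∧'_ (rename-∘ φ) (rename-∘ ψ)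
rename-∘ (φ ∨' ψ) = cong₂ _∨'_ (rename-∘ φ) (rename-∘ ψ)
rename-∘ (φ ⇒' ψ) = cong₂ _⇒'_ (rename-∘ φ) (rename-∘ ψ)
rename-∘ (∀' φ)   = cong ∀' (rename-∘-ext φ)
rename-∘ (∃' φ)   = cong ∃' (rename-∘-ext φ)
rename-∘-ext χ = trans (rename-∘ χ) (rename-cong (λ { zero → refl ; (suc i) → refl }) χ)
rename-id : ∀ {a} {r : Fin a → Fin a} → (∀ i → r i ≡ i) → ∀ χ → rename r χ ≡ χ
rename-id-ext : ∀ {a} {r : Fin a → Fin a} → (∀ i → r i ≡ i) → ∀ χ → rename (ext r) χ ≡ χ
rename-id h (x ∈' y) = cong₂ _∈'_ (h x) (h y)
rename-id h (x ≐ y)  = cong₂ _≐_ (h x) (h y)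
rename-id h ⊥'       = refl
rename-id h (¬' φ)   = cong ¬'_ (rename-id h φ)
rename-id h (φ ∧' ψ) = cong₂ _∧'_ (rename-id h φ) (rename-id h ψ)
rename-id h (φ ∨' ψ) = cong₂ _∨'_ (rename-id h φ) (rename-id h ψ)
rename-id h (φ ⇒' ψ) = cong₂ _⇒'_ (rename-id h φ) (rename-id h ψ)
rename-id h (∀' φ)   = cong ∀' (rename-id-ext h φ)
rename-id h (∃' φ)   = cong ∃' (rename-id-ext h φ)
rename-id-ext h = rename-id (λ { zero → refl ; (suc i) → cong suc (h i) })

wk-[0] : ∀ {m} (φ : Formula (suc m)) → rename (ext suc) φ [ zero ] ≡ φ
wk-[0] φ = trans (rename-∘ φ) (rename-id (λ { zero → refl ; (suc i) → refl }) φ)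

∀E0 : ∀ {m} {Γ : List (Formula (suc m))} {φ} → Γ ⊢ wk (∀' φ) → Γ ⊢ φ
∀E0 {φ = φ} d = conv (wk-[0] φ) (∀E d zero)

∃I0 : ∀ {m} {Γ : List (Formula (suc m))} {φ} → Γ ⊢ φ → Γ ⊢ wk (∃' φ)
∃I0 {φ = φ} d = ∃I zero (conv (sym (wk-[0] φ)) d)

back-tr : ∀ {k m} (v : Fin k → ℕ) (σ : ℕ → Fin m) φ → Same (rename (σ ∘ v) φ) (back σ (tr v φ))
back-tr-lift : ∀ {k m} (v : Fin k → ℕ) (σ : ℕ → Fin m) φ →
  Same (rename (ext (σ ∘ v)) φ) (back (zero ▸ (suc ∘ σ)) (tr (lift' v) φ))
back-tr v σ (x ∈' y) = same id id
back-tr v σ (x ≐ y)  = same id id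
back-tr v σ ⊥'       = same id id
back-tr v σ (¬' φ) with back-tr v σ φ
... | same to from = same (λ d → ⇒I (¬E (wk₁ d) (from a0))) (λ d → ¬I (⇒E (wk₁ d) (to a0)))
back-tr v σ (φ ∧' ψ) with back-tr v σ φ | back-tr v σ ψ
... | same to from | same to' from' = same
  (λ d → ⇒I (⇒E (⇒E a0 (to (∧E₁ (wk₁ d)))) (to' (∧E₂ (wk₁ d)))))
  (λ d → ∧I (raa (⇒E (wk₁ d) (⇒I (⇒I (¬E a2 (from a1))))))
            (raa (⇒E (wk₁ d) (⇒I (⇒I (¬E a2 (from' a0)))))))
back-tr v σ (φ ∨' ψ) with back-tr v σ φ | back-tr v σ ψ
... | same to from | same to' from' = same
  (λ d → ⇒I (∨E (wk₁ d) (raa (⇒E a2 (to a1))) (to' a0)))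
  (λ d → raa (¬E a0 (∨I₂ (from' (⇒E (wk₁ d) (⇒I (¬E a1 (∨I₁ (from a0)))))))))
back-tr v σ (φ ⇒' ψ) with back-tr v σ φ | back-tr v σ ψ
... | same to from | same to' from' = same
  (λ d → ⇒I (to' (⇒E (wk₁ d) (from a0)))) (λ d → ⇒I (from' (⇒E (wk₁ d) (to a0))))
back-tr v σ (∀' φ) with back-tr-lift v σ φ
... | same to from = same
  (λ d → cut (∀I (to (∀E0 a0))) d) (λ d → cut (∀I (from (∀E0 a0))) d)
back-tr v σ (∃' φ) with back-tr-lift v σ φ
... | same to from = same
  (λ d → ⇒I (∃E (wk₁ d) (⇒E (∀E0 a1) (to a0))))
  (λ d → raa (⇒E (wk₁ d) (∀I (⇒I (¬E a1 (∃I0 (from a0)))))))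
back-tr-lift v σ φ with back-tr (lift' v) (zero ▸ (suc ∘ σ)) φ
... | s = subst (λ χ → Same χ (back (zero ▸ (suc ∘ σ)) (tr (lift' v) φ)))
            (rename-cong (λ { zero → refl ; (suc i) → refl }) φ) s

-- Model existence

infix 3 _⊢ᵀ_
-- `gen` acts only inside `Thm`, never on hypotheses. Hence the deduction theorem `ded` holds for
-- open formulas too, and generalisation has to be recovered as `fresh-gen`.
data _⊢ᵀ_ (Th : F → Set) : F → Set where
  hy  : ∀ {φ} → Th φ → Th ⊢ᵀ φ
  th  : ∀ {φ} → Thm φ → Th ⊢ᵀ φ
  mpᵀ : ∀ {φ ψ} → Th ⊢ᵀ φ ⊃ ψ → Th ⊢ᵀ φ → Th ⊢ᵀ ψ

mono : ∀ {A B : F → Set} → (∀ {φ} → A φ → B ⊢ᵀ φ) → ∀ {φ} → A ⊢ᵀ φ → B ⊢ᵀ φ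
mono s (hy a)    = s a
mono s (th d)    = th d
mono s (mpᵀ d e) = mpᵀ (mono s d) (mono s e)

_⊕ᵀ_ : (F → Set) → F → F → Set
(A ⊕ᵀ ψ) φ = A φ ⊎ φ ≡ ψ

ded : ∀ {A ψ χ} → A ⊕ᵀ ψ ⊢ᵀ χ → A ⊢ᵀ ψ ⊃ χ
ded (hy (inj₁ a))    = mpᵀ (th axK) (hy a)
ded (hy (inj₂ refl)) = th (thm {[]} (lam h0))
ded (th d)           = mpᵀ (th axK) (th d)
ded (mpᵀ d e)        = mpᵀ (mpᵀ (th axS) (ded d)) (ded e)

none : {A : Set} → Fin 0 → A
none ()

⟪_⟫ : Theory → F → Set
⟪ T ⟫ φ = Σ Sentence λ ψ → T ψ × φ ≡ tr none ψ

Closed : F → Set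
Closed φ = ∀ r → ren r φ ≡ φ

tr-closed : (φ : Sentence) → Closed (tr none φ)
tr-closed φ r = trans (ren-tr r none φ) (tr-cong (λ ()) φ)

⇛-⊢ᵀ : ∀ {A : F → Set} {Γ φ} → All A Γ → A ⊢ᵀ Γ ⇛ φ → A ⊢ᵀ φ
⇛-⊢ᵀ []       d = d
⇛-⊢ᵀ (a ∷ as) d = mpᵀ (⇛-⊢ᵀ as d) (hy a)

⊩⇒⊢ᵀ : ∀ {T φ} → T ⊩ φ → ⟪ T ⟫ ⊢ᵀ tr none φ
⊩⇒⊢ᵀ {T} {φ} (Γ , ts , d) = subst (⟪ T ⟫ ⊢ᵀ_) (wk₀-tr φ) (⇛-⊢ᵀ (alls ts) (th (thm (tr-sim d v))))
  where
  v : Fin 1 → ℕ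
  v _ = 0
  wk₀-tr : ∀ ψ → tr v (wk₀ ψ) ≡ tr none ψ
  wk₀-tr ψ = trans (tr-rename v _ ψ) (tr-cong (λ ()) ψ)
  alls : ∀ {Δ} → All T Δ → All ⟪ T ⟫ (map (tr v) (map wk₀ Δ))
  alls []       = []
  alls {ψ ∷ _} (t ∷ ts) = (ψ , t , wk₀-tr ψ) ∷ alls ts

⊢ᵀ⇒back : ∀ {T χ} → ⟪ T ⟫ ⊢ᵀ χ → Σ (List Sentence) λ Γ → All T Γ × (map wk₀ Γ ⊢ back (λ _ → zero) χ)
⊢ᵀ⇒back (hy (ψ , t , refl)) = ψ ∷ [] , t ∷ [] ,
  Same.to (back-tr none (λ _ → zero) ψ) (conv (rename-cong (λ ()) ψ) a0)
⊢ᵀ⇒back (th d) = [] , [] , back-Thm d _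
⊢ᵀ⇒back (mpᵀ d e) with ⊢ᵀ⇒back d | ⊢ᵀ⇒back e
... | Γ , ts , d' | Δ , us , e' = Γ ++ Δ , ++⁺ ts us ,
  ⇒E (weaken (λ i → subst (_ ∈_) (sym (map-++ wk₀ Γ Δ)) (∈-++⁺ˡ i)) d')
     (weaken (λ i → subst (_ ∈_) (sym (map-++ wk₀ Γ Δ)) (∈-++⁺ʳ (map wk₀ Γ) i)) e')

-- Coding and enumeration of formulas

data Tm : Set where
  leaf : Tm
  node : Tm → Tm → Tm

num : ℕ → Tm
num zero    = leaf
num (suc n) = node leaf (num n)

unnum : Tm → ℕ
unnum leaf       = zero
unnum (node _ t) = suc (unnum t)

unnum-num : ∀ n → unnum (num n) ≡ n
unnum-num zero    = refl
unnum-num (suc n) = cong suc (unnum-num n)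

code : F → Tm
code (mem x y) = node (num 0) (node (num x) (num y))
code (eq x y)  = node (num 1) (node (num x) (num y))
code bot       = leaf
code (φ ⊃ ψ)   = node (num 2) (node (code φ) (code ψ))
code (all φ)   = node (num 3) (code φ)

-- Trees that are not codes are read as bot.
decode : Tm → F
decode (node leaf (node x y)) = mem (unnum x) (unnum y)
decode (node (node leaf leaf) (node x y)) = eq (unnum x) (unnum y)
decode (node (node leaf (node leaf leaf)) (node a b)) = decode a ⊃ decode b
decode (node (node leaf (node leaf (node leaf leaf))) a) = all (decode a)
decode _ = bot

decode-code : ∀ φ → decode (code φ) ≡ φ
decode-code (mem x y) = cong₂ mem (unnum-num x) (unnum-num y)
decode-code (eq x y)  = cong₂ eq (unnum-num x) (unnum-num y)
decode-code bot       = refl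
decode-code (φ ⊃ ψ)   = cong₂ _⊃_ (decode-code φ) (decode-code ψ)
decode-code (all φ)   = cong all (decode-code φ)

-- Formulas are enumerated by reading a binary numeral as a tree in reverse Polish notation.
run : ℕᵇ → List Tm → List Tm
run ℕᵇ.zero    st           = st
run 2[1+ b ]   st           = run b (leaf ∷ st)
run 1+[2 b ]   (t ∷ s ∷ st) = run b (node s t ∷ st)
run 1+[2 b ]   st           = run b st

polish : Tm → ℕᵇ → ℕᵇ
polish leaf       b = 2[1+ b ]
polish (node s t) b = polish s (polish t 1+[2 b ])

run-polish : ∀ t b st → run (polish t b) st ≡ run b (t ∷ st)
run-polish leaf       b st = refl
run-polish (node s t) b st = trans (run-polish s _ st) (run-polish t _ (s ∷ st))

top : List Tm → F
top []      = bot
top (t ∷ _) = decode t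

enum : ℕ → F
enum n = top (run (fromℕ n) [])

index : F → ℕ
index φ = toℕ (polish (code φ) ℕᵇ.zero)

enum-index : ∀ φ → enum (index φ) ≡ φ
enum-index φ = trans (cong (λ b → top (run b [])) (fromℕ-toℕ (polish (code φ) ℕᵇ.zero)))
  (trans (cong top (run-polish (code φ) ℕᵇ.zero [])) (decode-code φ))

-- Fresh variables

bnd : F → ℕ
bnd (mem x y) = suc x ⊔ suc y
bnd (eq x y)  = suc x ⊔ suc y
bnd bot       = 0
bnd (φ ⊃ ψ)   = bnd φ ⊔ bnd ψ
bnd (all φ)   = bnd φ

ren-agree : ∀ {r s} φ → (∀ n → n < bnd φ → r n ≡ s n) → ren r φ ≡ ren s φ
ren-agree (mem x y) h = cong₂ mem (h x (m≤m⊔n (suc x) (suc y))) (h y (m≤n⊔m (suc x) (suc y)))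
ren-agree (eq x y)  h = cong₂ eq (h x (m≤m⊔n (suc x) (suc y))) (h y (m≤n⊔m (suc x) (suc y)))
ren-agree bot       h = refl
ren-agree (φ ⊃ ψ)   h = cong₂ _⊃_ (ren-agree φ λ n l → h n (≤-trans l (m≤m⊔n (bnd φ) (bnd ψ))))
                                  (ren-agree ψ λ n l → h n (≤-trans l (m≤n⊔m (bnd φ) (bnd ψ))))
ren-agree (all φ)   h = cong all (ren-agree φ λ { zero l → refl ; (suc n) l → cong suc (h n (≤-trans (m≤n⇒m≤1+n ≤-refl) l)) })

-- The renaming that turns the fresh variable c into the variable to be bound.
abstr : ℕ → ℕ → ℕ
abstr c n with n ≟ c
... | yes _ = 0
... | no _  = suc n

abstr-self : ∀ c → abstr c c ≡ 0
abstr-self c with c ≟ c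
... | yes _ = refl
... | no ¬e = ⊥-elim (¬e refl)

abstr-< : ∀ {c n} → n < c → abstr c n ≡ suc n
abstr-< {c} {n} l with n ≟ c
... | yes refl = ⊥-elim (<-irrefl refl l)
... | no _     = refl

-- Freshness as an equation of renamings: binding `c` is then vacuous quantification, which `axDist`
-- provides.
Fresh : ℕ → F → Set
Fresh c φ = ren (abstr c) φ ≡ ren suc φ

bnd-fresh : ∀ {c} φ → bnd φ ≤ c → Fresh c φ
bnd-fresh φ l = ren-agree φ λ n l' → abstr-< (<-≤-trans l' l)

abstr-⟨⟩ : ∀ {c} φ → bnd φ ≤ c → ren (abstr c) (φ ⟨ c ⟩) ≡ φ
abstr-⟨⟩ {c} φ l = trans (ren-∘ (abstr c) (c ▸ id) φ)
  (trans (ren-agree φ λ { zero _ → abstr-self c ; (suc n) l' → abstr-< (<-≤-trans (≤-trans (m≤n⇒m≤1+n ≤-refl) l') l) })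
         (ren-id (λ _ → refl) φ))

-- Generalisation on constants: the renaming `abstr c` is pushed through the whole derivation, and
-- on the hypotheses it acts as mere weakening.
fresh-gen : ∀ {A c} → (∀ {φ} → A φ → Fresh c φ) → ∀ {φ} → A ⊢ᵀ φ → A ⊢ᵀ all (ren (abstr c) φ)
fresh-gen f {φ} (hy a) = subst (λ χ → _ ⊢ᵀ all χ) (sym (f a))
  (mpᵀ (mpᵀ (th axDist) (th (gen (thm {[]} (lam h0))))) (hy a))
fresh-gen {c = c} f (th d) = th (gen (Thm-ren (abstr c) d))
fresh-gen {c = c} f (mpᵀ {φ} {ψ} d e) = mpᵀ (mpᵀ (th (thm {[]} (lam (lam (allI
  (app (allE0 (φ' ⊃ ψ') h1) (allE0 φ' h0))))))) (fresh-gen f d)) (fresh-gen f e)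
  where
  φ' = ren (abstr c) φ
  ψ' = ren (abstr c) ψ

⋃ᵀ : (ℕ → F → Set) → F → Set
⋃ᵀ A φ = Σ ℕ λ m → A m φ

module Chain (A : ℕ → F → Set) (step : ∀ {m φ} → A m φ → A (suc m) φ) where
  up : ∀ {m n φ} → m ≤ n → A m φ → A n φ
  up {n = zero} z≤n a = a
  up {m} {suc n} l a with m≤n⇒m<n∨m≡n l
  ... | inj₁ (s≤s l') = step (up l' a)
  ... | inj₂ refl     = a

  compact : ∀ {φ} → ⋃ᵀ A ⊢ᵀ φ → Σ ℕ λ m → A m ⊢ᵀ φ
  compact (hy (m , a)) = m , hy a
  compact (th d) = 0 , th d
  compact (mpᵀ d e) with compact d | compact e
  ... | m , d' | n , e' = m ⊔ n , mpᵀ (mono (hy ∘ up (m≤m⊔n m n)) d') (mono (hy ∘ up (m≤n⊔m m n)) e')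

module Henkin (Th : F → Set) (closed : ∀ {φ} → Th φ → Closed φ) (con : ¬ (Th ⊢ᵀ bot)) where

  -- `hax` is the Henkin axiom for ∀ with a variable as witness. `size m` bounds the variables of
  -- the earlier axioms, so `wit m` is fresh for them and for `enum m`; the formulas of `Th` are
  -- closed.
  wit size : ℕ → ℕ
  hax : ℕ → F
  wit m = size m ⊔ bnd (enum m)
  hax m = enum m ⟨ wit m ⟩ ⊃ all (enum m)
  size zero    = 0
  size (suc m) = size m ⊔ bnd (hax m)

  Hk : ℕ → F → Set
  Hk zero    = Th
  Hk (suc m) = Hk m ⊕ᵀ hax m

  Hk-fresh : ∀ m {c φ} → size m ≤ c → Hk m φ → Fresh c φ
  Hk-fresh zero    {c} l t = trans (closed t (abstr c)) (sym (closed t suc))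
  Hk-fresh (suc m) l (inj₁ h)    = Hk-fresh m (≤-trans (m≤m⊔n (size m) _) l) h
  Hk-fresh (suc m) l (inj₂ refl) = bnd-fresh (hax m) (≤-trans (m≤n⊔m (size m) _) l)

  Hk-con : ∀ m → ¬ (Hk m ⊢ᵀ bot)
  Hk-con zero    = con
  Hk-con (suc m) d = Hk-con m (mpᵀ (mpᵀ (th (thm {[]} (lam (lam (app h1 (lam h1)))))) ¬hax) all-e)
    where
    ¬hax : Hk m ⊢ᵀ neg (hax m)
    ¬hax = ded d
    -- Refuting `hax m` proves its antecedent, the instance at the fresh `wit m`. Generalising gives
    -- its consequent, hence `hax m` itself.
    all-e : Hk m ⊢ᵀ all (enum m)
    all-e = subst (λ χ → Hk m ⊢ᵀ all χ) (abstr-⟨⟩ (enum m) (m≤n⊔m (size m) _))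
      (fresh-gen (Hk-fresh m (m≤m⊔n (size m) _))
        (mpᵀ (th (thm {[]} (lam (raaᶜ (app h1 (lam (efq (app h1 h0)))))))) ¬hax))

  module HkC = Chain Hk inj₁

  G : ℕ → F → Set
  G zero      = ⋃ᵀ Hk
  G (suc m) φ = G m φ ⊎ (φ ≡ enum m × ¬ (G m ⊕ᵀ enum m ⊢ᵀ bot))

  module GC = Chain G inj₁

  -- A member added at step `m` carries the evidence that it was consistent. So a derivation either
  -- avoids the new formula or hands over this evidence, and consistency is never decided.
  G-step : ∀ m {φ} → G (suc m) ⊢ᵀ φ → G m ⊢ᵀ φ ⊎ ((G m ⊕ᵀ enum m ⊢ᵀ φ) × ¬ (G m ⊕ᵀ enum m ⊢ᵀ bot))
  G-step m (hy (inj₁ g)) = inj₁ (hy g)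
  G-step m (hy (inj₂ (e , c))) = inj₂ (hy (inj₂ e) , c)
  G-step m (th d) = inj₁ (th d)
  G-step m (mpᵀ d e) with G-step m d | G-step m e
  ... | inj₁ d' | inj₁ e' = inj₁ (mpᵀ d' e')
  ... | inj₁ d' | inj₂ (e' , c) = inj₂ (mpᵀ (mono (hy ∘ inj₁) d') e' , c)
  ... | inj₂ (d' , c) | inj₁ e' = inj₂ (mpᵀ d' (mono (hy ∘ inj₁) e') , c)
  ... | inj₂ (d' , c) | inj₂ (e' , _) = inj₂ (mpᵀ d' e' , c)

  G-con : ∀ m → ¬ (G m ⊢ᵀ bot)
  G-con zero d with HkC.compact d
  ... | m , d' = Hk-con m d'
  G-con (suc m) d with G-step m d
  ... | inj₁ d'       = G-con m d'
  ... | inj₂ (d' , c) = c d'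

  H : F → Set
  H = ⋃ᵀ G

  H-con : ¬ (H ⊢ᵀ bot)
  H-con d with GC.compact d
  ... | m , d' = G-con m d'

  -- Maximality in positive form; deductive closure, stability under double negation and the
  -- negations of non-members all follow from it.
  H-add : ∀ {φ} → ¬ (H ⊕ᵀ φ ⊢ᵀ bot) → H φ
  H-add {φ} c = suc m , inj₂ (sym e , λ d → c (mono (λ { (inj₁ g) → hy (inj₁ (m , g)) ; (inj₂ refl) → hy (inj₂ e) }) d))
    where
    m = index φ
    e = enum-index φ

  H-closed : ∀ {φ} → H ⊢ᵀ φ → H φ
  H-closed d = H-add λ e → H-con (mpᵀ (ded e) d)

  H-stable : ∀ {φ} → ¬ ¬ H φ → H φ
  H-stable {φ} nn = H-add λ d → nn λ h → H-con (mpᵀ (ded d) (hy h))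

  H-neg : ∀ {φ} → ¬ H φ → H (neg φ)
  H-neg {φ} n = H-add λ d → n (H-closed (mpᵀ (th axDN) (ded d)))

  H-mp : ∀ {φ ψ} → H (φ ⊃ ψ) → H φ → H ψ
  H-mp f a = H-closed (mpᵀ (hy f) (hy a))

  H-wit : ∀ φ → Σ ℕ λ c → H (φ ⟨ c ⟩) → H (all φ)
  H-wit φ = wit (index φ) , H-mp (0 , suc (index φ) ,
    inj₂ (cong (λ χ → χ ⟨ wit (index φ) ⟩ ⊃ all χ) (sym (enum-index φ))))

-- Semantics and the term model

sem : {M : Set} (_∈ₘ_ _≈_ : M → M → Set) → F → (ℕ → M) → Set
sem _∈ₘ_ _≈_ (mem x y) ρ = ρ x ∈ₘ ρ y
sem _∈ₘ_ _≈_ (eq x y)  ρ = ρ x ≈ ρ y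
sem _∈ₘ_ _≈_ bot       ρ = ⊥
sem _∈ₘ_ _≈_ (φ ⊃ ψ)   ρ = sem _∈ₘ_ _≈_ φ ρ → sem _∈ₘ_ _≈_ ψ ρ
sem _∈ₘ_ _≈_ (all φ)   ρ = ∀ a → sem _∈ₘ_ _≈_ φ (a ▸ ρ)

-- The field drinker provides a witness for every existential statement, so that existential
-- quantifiers can be interpreted by Σ although the logic of the model is classical.
record Model (Th : F → Set) : Set₁ where
  field
    M       : Set
    _∈ₘ_    : M → M → Set
    _≈_     : M → M → Set
    el      : M
    stable∈ : ∀ {x y} → ¬ ¬ (x ∈ₘ y) → x ∈ₘ y
    stable≈ : ∀ {x y} → ¬ ¬ (x ≈ y) → x ≈ y
    drinker : ∀ φ ρ → Σ M λ c → sem _∈ₘ_ _≈_ φ (c ▸ ρ) → ∀ x → sem _∈ₘ_ _≈_ φ (x ▸ ρ)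
    sound   : ∀ {φ} → Thm φ → ∀ ρ → sem _∈ₘ_ _≈_ φ ρ
    models  : ∀ {φ} → Th ⊢ᵀ φ → Closed φ → ∀ ρ → sem _∈ₘ_ _≈_ φ ρ

-- The elements are the variables. There is no quotient by `eq`: equality of the model is the
-- relation `≈`, which is why later constructions come with congruence lemmas.
model-exists : (Th : F → Set) → (∀ {φ} → Th φ → Closed φ) → ¬ (Th ⊢ᵀ bot) → Model Th
model-exists Th closed con = record
  { M = ℕ ; _∈ₘ_ = λ x y → H (mem x y) ; _≈_ = λ x y → H (eq x y) ; el = 0
  ; stable∈ = H-stable ; stable≈ = H-stable
  ; drinker = λ φ ρ → let c , w = H-wit (ren (lift ρ) φ) in
      c , λ s x → from φ (x ▸ ρ) (subst H (⟨⟩-lift x φ ρ)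
                    (H-closed (mpᵀ (th (axInst _ x)) (hy (w (subst H (sym (⟨⟩-lift c φ ρ)) (to φ (c ▸ ρ) s)))))))
  ; sound = λ {φ} d ρ → from φ ρ (H-closed (th (Thm-ren ρ d)))
  ; models = λ {φ} d cl ρ → from φ ρ (subst H (sym (cl ρ)) (H-closed (mono (λ t → hy (0 , 0 , t)) d)))
  }
  where
  open Henkin Th closed con
  S : F → (ℕ → ℕ) → Set
  S = sem (λ x y → H (mem x y)) (λ x y → H (eq x y))
  ⟨⟩-lift : ∀ x φ ρ → ren (lift ρ) φ ⟨ x ⟩ ≡ ren (x ▸ ρ) φ
  ⟨⟩-lift x φ ρ = trans (ren-∘ (x ▸ id) (lift ρ) φ) (ren-cong (λ { zero → refl ; (suc n) → refl }) φ)
  to : ∀ φ ρ → S φ ρ → H (ren ρ φ)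
  from : ∀ φ ρ → H (ren ρ φ) → S φ ρ
  to (mem x y) ρ s = s
  to (eq x y)  ρ s = s
  to bot       ρ ()
  -- If `φ ⊃ ψ` were not in `H`, then `φ` would not be either; so `neg φ`, and with it `φ ⊃ ψ`,
  -- would be.
  to (φ ⊃ ψ)   ρ s = H-stable λ n →
    n (H-closed (mpᵀ (th (thm {[]} (lam (lam (efq (app h1 h0)))))) (hy (H-neg λ h →
      n (H-closed (mpᵀ (th axK) (hy (to ψ ρ (s (from φ ρ h)))))))))) 
  to (all φ)   ρ s = proj₂ (H-wit (ren (lift ρ) φ))
    (subst H (sym (⟨⟩-lift _ φ ρ)) (to φ _ (s (proj₁ (H-wit (ren (lift ρ) φ))))))
  from (mem x y) ρ h = h
  from (eq x y)  ρ h = h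
  from bot       ρ h = H-con (hy h)
  from (φ ⊃ ψ)   ρ h = λ s → from ψ ρ (H-mp h (to φ ρ s))
  from (all φ)   ρ h a = from φ (a ▸ ρ) (subst H (⟨⟩-lift a φ ρ) (H-closed (mpᵀ (th (axInst _ a)) (hy h))))

-- Elementary set theory in a model

-- Classical case distinctions take place under double negation; stable goals such as `Sat`, `≈` and
-- `D` allow one to leave it.
K : Set → Set
K A = ¬ ¬ A

ret : {A : Set} → A → K A
ret a n = n a

infixl 1 _>>=_
_>>=_ : {A B : Set} → K A → (A → K B) → K B
(m >>= f) n = m λ a → f a n

lem : {A : Set} → K (A ⊎ ¬ A)
lem n = n (inj₂ λ a → n (inj₁ a))

infix 2 _↔_
_↔_ : Set → Set → Set
A ↔ B = (A → B) × (B → A)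

module KPModel (T : Theory) (kp : ∀ φ → KP φ → T ⊩ φ) (𝔐 : Model ⟪ T ⟫) where
  open Model 𝔐 public

  ⟦_⟧ : F → (ℕ → M) → Set
  ⟦_⟧ = sem _∈ₘ_ _≈_

  ⟦⟧-stable : ∀ φ ρ → K (⟦ φ ⟧ ρ) → ⟦ φ ⟧ ρ
  ⟦⟧-stable (mem x y) ρ k = stable∈ k
  ⟦⟧-stable (eq x y)  ρ k = stable≈ k
  ⟦⟧-stable bot       ρ k = k id
  ⟦⟧-stable (φ ⊃ ψ)   ρ k = λ a → ⟦⟧-stable ψ ρ (k >>= λ f → ret (f a))
  ⟦⟧-stable (all φ)   ρ k = λ a → ⟦⟧-stable φ _ (k >>= λ f → ret (f a))

  -- ∃ can be a genuine Σ thanks to `drinker`; ∨ stays under `K`, since nothing selects a disjunct.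
  Sat : ∀ {k} → Formula k → (Fin k → M) → Set
  Sat (x ∈' y) ρ = ρ x ∈ₘ ρ y
  Sat (x ≐ y)  ρ = ρ x ≈ ρ y
  Sat ⊥'       ρ = ⊥
  Sat (¬' φ)   ρ = ¬ Sat φ ρ
  Sat (φ ∧' ψ) ρ = Sat φ ρ × Sat ψ ρ
  Sat (φ ∨' ψ) ρ = K (Sat φ ρ ⊎ Sat ψ ρ)
  Sat (φ ⇒' ψ) ρ = Sat φ ρ → Sat ψ ρ
  Sat (∀' φ)   ρ = ∀ a → Sat φ (a ▹ ρ)
  Sat (∃' φ)   ρ = Σ M λ a → Sat φ (a ▹ ρ)

  tr-to : ∀ {k} (φ : Formula k) {v ρ τ} → (∀ i → ρ (v i) ≡ τ i) → ⟦ tr v φ ⟧ ρ → Sat φ τ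
  tr-from : ∀ {k} (φ : Formula k) {v ρ τ} → (∀ i → ρ (v i) ≡ τ i) → Sat φ τ → ⟦ tr v φ ⟧ ρ
  tr-to (x ∈' y) h s = subst₂ _∈ₘ_ (h x) (h y) s
  tr-to (x ≐ y)  h s = subst₂ _≈_ (h x) (h y) s
  tr-to ⊥'       h s = s
  tr-to (¬' φ)   h s = λ a → s (tr-from φ h a)
  tr-to (φ ∧' ψ) {v} {ρ} h s =
      tr-to φ h (⟦⟧-stable (tr v φ) ρ λ n → s λ a _ → n a)
    , tr-to ψ h (⟦⟧-stable (tr v ψ) ρ λ n → s λ _ b → n b)
  tr-to (φ ∨' ψ) h s = λ n → n (inj₂ (tr-to ψ h (s λ a → n (inj₁ (tr-to φ h a)))))
  tr-to (φ ⇒' ψ) h s = λ a → tr-to ψ h (s (tr-from φ h a))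
  tr-to (∀' φ)   h s = λ a → tr-to φ (λ { zero → refl ; (suc i) → h i }) (s a)
  -- The drinker for the negation: if `φ` failed at `c`, it would fail everywhere.
  tr-to (∃' φ) {v} {ρ} h s with drinker (neg (tr (lift' v) φ)) ρ
  ... | c , d = c , tr-to φ (λ { zero → refl ; (suc i) → h i })
    (⟦⟧-stable (tr (lift' v) φ) (c ▸ ρ) λ n → s (d n))
  tr-from (x ∈' y) h s = subst₂ _∈ₘ_ (sym (h x)) (sym (h y)) s
  tr-from (x ≐ y)  h s = subst₂ _≈_ (sym (h x)) (sym (h y)) s
  tr-from ⊥'       h s = s
  tr-from (¬' φ)   h s = λ a → s (tr-to φ h a)
  tr-from (φ ∧' ψ) h (a , b) = λ n → n (tr-from φ h a) (tr-from ψ h b)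
  tr-from (φ ∨' ψ) {v} {ρ} h s = λ na → ⟦⟧-stable (tr v ψ) ρ λ nb →
    s λ { (inj₁ a) → na (tr-from φ h a) ; (inj₂ b) → nb (tr-from ψ h b) }
  tr-from (φ ⇒' ψ) h s = λ a → tr-from ψ h (s (tr-to φ h a))
  tr-from (∀' φ)   h s = λ a → tr-from φ (λ { zero → refl ; (suc i) → h i }) (s a)
  tr-from (∃' φ)   h (a , s) = λ n → n a (tr-from φ (λ { zero → refl ; (suc i) → h i }) s)

  pad : ∀ {k} → (Fin k → M) → ℕ → M
  pad {zero}  ρ n       = el
  pad {suc k} ρ zero    = ρ zero
  pad {suc k} ρ (suc n) = pad (ρ ∘ suc) n

  pad-idx : ∀ {k} (ρ : Fin k → M) i → pad ρ (idx i) ≡ ρ i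
  pad-idx ρ zero    = refl
  pad-idx ρ (suc i) = pad-idx (ρ ∘ suc) i

  Sat-stable : ∀ {k} (φ : Formula k) {ρ} → K (Sat φ ρ) → Sat φ ρ
  Sat-stable φ {ρ} k = tr-to φ (pad-idx ρ)
    (⟦⟧-stable (tr idx φ) (pad ρ) (k >>= λ s → ret (tr-from φ (pad-idx ρ) s)))

  ≈-refl : ∀ {x} → x ≈ x
  ≈-refl {x} = sound (axRefl 0) (λ _ → x)

  ≈-sym : ∀ {x y} → x ≈ y → y ≈ x
  ≈-sym {x} {y} e = sound (axSub (eq 0 1) 0 1) (x ▸ y ▸ λ _ → x) e ≈-refl

  ≈-trans : ∀ {x y z} → x ≈ y → y ≈ z → x ≈ z
  ≈-trans {x} {y} {z} e f = sound (axSub (eq 0 3) 1 0) (x ▸ y ▸ z ▸ λ _ → x) (≈-sym e) f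

  ∈-cong : ∀ {x x' y y'} → x ≈ x' → y ≈ y' → x ∈ₘ y → x' ∈ₘ y'
  ∈-cong {x} {x'} {y} {y'} e f i = sound (axSub (mem 3 0) 0 1) (y ▸ y' ▸ x' ▸ λ _ → x) f
    (sound (axSub (mem 0 3) 0 1) (x ▸ x' ▸ y ▸ λ _ → x) e i)

  ∈-congˡ : ∀ {x x' y} → x ≈ x' → x ∈ₘ y → x' ∈ₘ y
  ∈-congˡ e = ∈-cong e ≈-refl

  ∈-congʳ : ∀ {x y y'} → y ≈ y' → x ∈ₘ y → x ∈ₘ y'
  ∈-congʳ = ∈-cong ≈-refl

  ▹-cong : ∀ {k} {ρ τ : Fin k → M} {a b} → a ≈ b → (∀ i → ρ i ≈ τ i) → ∀ i → (a ▹ ρ) i ≈ (b ▹ τ) i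
  ▹-cong e h zero    = e
  ▹-cong e h (suc i) = h i

  Sat-cong : ∀ {k} (φ : Formula k) {ρ τ} → (∀ i → ρ i ≈ τ i) → Sat φ ρ → Sat φ τ
  Sat-cong (x ∈' y) h s = ∈-cong (h x) (h y) s
  Sat-cong (x ≐ y)  h s = ≈-trans (≈-sym (h x)) (≈-trans s (h y))
  Sat-cong ⊥'       h s = s
  Sat-cong (¬' φ)   h s = λ a → s (Sat-cong φ (≈-sym ∘ h) a)
  Sat-cong (φ ∧' ψ) h (a , b) = Sat-cong φ h a , Sat-cong ψ h b
  Sat-cong (φ ∨' ψ) h s = s >>= λ { (inj₁ a) → ret (inj₁ (Sat-cong φ h a)) ; (inj₂ b) → ret (inj₂ (Sat-cong ψ h b)) }
  Sat-cong (φ ⇒' ψ) h s = λ a → Sat-cong ψ h (s (Sat-cong φ (≈-sym ∘ h) a))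
  Sat-cong (∀' φ)   h s = λ a → Sat-cong φ (▹-cong ≈-refl h) (s a)
  Sat-cong (∃' φ)   h (a , s) = a , Sat-cong φ (▹-cong ≈-refl h) s

  ▹-ext : ∀ {k m} {r : Fin k → Fin m} {ρ : Fin m → M} {τ : Fin k → M} {a} →
    (∀ i → ρ (r i) ≈ τ i) → ∀ i → (a ▹ ρ) (ext r i) ≈ (a ▹ τ) i
  ▹-ext h zero    = ≈-refl
  ▹-ext h (suc i) = h i

  -- Agreement is required pointwise and only up to `≈`, since environments are functions and are
  -- not compared by equality.
  Sat-ren : ∀ {k m} (φ : Formula k) {r : Fin k → Fin m} {ρ τ} → (∀ i → ρ (r i) ≈ τ i) →
    Sat (rename r φ) ρ ↔ Sat φ τ
  Sat-ren (x ∈' y) h = ∈-cong (h x) (h y) , ∈-cong (≈-sym (h x)) (≈-sym (h y))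
  Sat-ren (x ≐ y)  h = (λ s → ≈-trans (≈-sym (h x)) (≈-trans s (h y)))
                     , (λ s → ≈-trans (h x) (≈-trans s (≈-sym (h y))))
  Sat-ren ⊥'       h = id , id
  Sat-ren (¬' φ)   h = let f , g = Sat-ren φ h in (λ s a → s (g a)) , (λ s a → s (f a))
  Sat-ren (φ ∧' ψ) h = let f , g = Sat-ren φ h ; f' , g' = Sat-ren ψ h in
    (λ (a , b) → f a , f' b) , (λ (a , b) → g a , g' b)
  Sat-ren (φ ∨' ψ) h = let f , g = Sat-ren φ h ; f' , g' = Sat-ren ψ h in
      (λ s → s >>= λ { (inj₁ a) → ret (inj₁ (f a)) ; (inj₂ b) → ret (inj₂ (f' b)) })
    , (λ s → s >>= λ { (inj₁ a) → ret (inj₁ (g a)) ; (inj₂ b) → ret (inj₂ (g' b)) })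
  Sat-ren (φ ⇒' ψ) h = let f , g = Sat-ren φ h ; f' , g' = Sat-ren ψ h in
    (λ s a → f' (s (g a))) , (λ s a → g' (s (f a)))
  Sat-ren (∀' φ)   h = (λ s a → proj₁ (Sat-ren φ (▹-ext h)) (s a)) , (λ s a → proj₂ (Sat-ren φ (▹-ext h)) (s a))
  Sat-ren (∃' φ)   h = (λ (a , s) → a , proj₁ (Sat-ren φ (▹-ext h)) s) , (λ (a , s) → a , proj₂ (Sat-ren φ (▹-ext h)) s)

  Sat-close : ∀ {k} (φ : Formula k) → Sat (close φ) none → ∀ ρ → Sat φ ρ
  Sat-close {zero}  φ s ρ = Sat-cong φ (λ ()) s
  Sat-close {suc k} φ s ρ = Sat-cong φ (λ { zero → ≈-refl ; (suc i) → ≈-refl })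
    (Sat-close (∀' φ) s (ρ ∘ suc) (ρ zero))

  holds : ∀ {φ} → T ⊩ φ → Sat φ none
  holds {φ} d = tr-to φ {none} (λ ()) (models (⊩⇒⊢ᵀ d) (tr-closed φ) λ _ → el)

  axiom : ∀ {φ} → KP φ → Sat φ none
  axiom {φ} a = holds (kp φ a)

  infixr 6 _∪_
  abstract
    ext≈ : ∀ {x y} → (∀ z → z ∈ₘ x ↔ z ∈ₘ y) → x ≈ y
    ext≈ h = axiom kp-ext _ _ h

    sep : ∀ {k} (φ : Formula (suc k)) → Δ₀ φ → (ρ : Fin k → M) (a : M) →
      Σ M λ b → ∀ x → x ∈ₘ b ↔ (x ∈ₘ a × Sat φ (x ▹ ρ))
    sep φ d ρ a with Sat-close _ (axiom (kp-sep φ d)) ρ a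
    ... | b , h = b , λ x →
        (λ i → proj₁ (proj₁ (h x) i) , proj₁ (Sat-ren φ λ { zero → ≈-refl ; (suc i) → ≈-refl }) (proj₂ (proj₁ (h x) i)))
      , (λ (i , s) → proj₂ (h x) (i , proj₂ (Sat-ren φ λ { zero → ≈-refl ; (suc i) → ≈-refl }) s))

    coll : ∀ {k} (φ : Formula (suc (suc k))) → Δ₀ φ → (ρ : Fin k → M) (a : M) →
      (∀ x → x ∈ₘ a → Σ M λ y → Sat φ (y ▹ x ▹ ρ)) →
      Σ M λ b → ∀ x → x ∈ₘ a → Σ M λ y → y ∈ₘ b × Sat φ (y ▹ x ▹ ρ)
    coll φ d ρ a h with Sat-close _ (axiom (kp-coll φ d)) ρ a
      (λ x i → let y , s = h x i in y , proj₂ (Sat-ren φ λ { zero → ≈-refl ; (suc zero) → ≈-refl ; (suc (suc i)) → ≈-refl }) s)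
    ... | b , g = b , λ x i → let y , j , s = g x i in
      y , j , proj₁ (Sat-ren φ λ { zero → ≈-refl ; (suc zero) → ≈-refl ; (suc (suc i)) → ≈-refl }) s

    ∅-spec : Σ M λ b → ∀ x → ¬ (x ∈ₘ b)
    ∅-spec with sep {0} ⊥' ⊥-Δ₀ none el
    ... | b , h = b , λ x i → proj₂ (proj₁ (h x) i)

    ∅ : M
    ∅ = proj₁ ∅-spec

    ∉∅ : ∀ {x} → ¬ (x ∈ₘ ∅)
    ∉∅ {x} = proj₂ ∅-spec x

    up-in : ∀ x y {b c} → x ∈ₘ c → y ∈ₘ c →
      (∀ z → z ∈ₘ b ↔ (z ∈ₘ c × K (z ≈ x ⊎ z ≈ y))) → ∀ z → z ∈ₘ b ↔ K (z ≈ x ⊎ z ≈ y)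
    up-in x y i j h z = (λ m → proj₂ (proj₁ (h z) m)) ,
      λ k → proj₂ (h z) (stable∈ (k >>= λ { (inj₁ e) → ret (∈-congˡ (≈-sym e) i)
                                          ; (inj₂ e) → ret (∈-congˡ (≈-sym e) j) }) , k)

    pairing : ∀ x y → Σ M λ c → x ∈ₘ c × y ∈ₘ c
    pairing x y = axiom kp-pair x y

    up-sep : ∀ x y c → Σ M λ b → ∀ z → z ∈ₘ b ↔ (z ∈ₘ c × K (z ≈ x ⊎ z ≈ y))
    up-sep x y c = sep {2} ((v0 ≐ v1) ∨' (v0 ≐ v2)) (∨-Δ₀ (≐-Δ₀ _ _) (≐-Δ₀ _ _)) (x ▹ y ▹ none) c

    up-from : ∀ x y → (Σ M λ c → x ∈ₘ c × y ∈ₘ c) → Σ M λ b → ∀ z → z ∈ₘ b ↔ K (z ≈ x ⊎ z ≈ y)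
    up-from x y (c , i , j) = proj₁ (up-sep x y c) , up-in x y i j (proj₂ (up-sep x y c))

    up-spec : ∀ x y → Σ M λ b → ∀ z → z ∈ₘ b ↔ K (z ≈ x ⊎ z ≈ y)
    up-spec x y = up-from x y (pairing x y)

    up : M → M → M
    up x y = proj₁ (up-spec x y)

    up-∈ : ∀ {x y z} → z ∈ₘ up x y → K (z ≈ x ⊎ z ≈ y)
    up-∈ {x} {y} {z} = proj₁ (proj₂ (up-spec x y) z)

    up-1 : ∀ {x y} → x ∈ₘ up x y
    up-1 {x} {y} = proj₂ (proj₂ (up-spec x y) x) (ret (inj₁ ≈-refl))

    up-2 : ∀ {x y} → y ∈ₘ up x y
    up-2 {x} {y} = proj₂ (proj₂ (up-spec x y) y) (ret (inj₂ ≈-refl))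

    up-ext : ∀ {x y d} → x ∈ₘ d → y ∈ₘ d → (∀ z → z ∈ₘ d → K (z ≈ x ⊎ z ≈ y)) → d ≈ up x y
    up-ext i j h = ext≈ λ z → (λ m → proj₂ (proj₂ (up-spec _ _) z) (h z m)) ,
      λ m → stable∈ (up-∈ m >>= λ { (inj₁ e) → ret (∈-congˡ (≈-sym e) i) ; (inj₂ e) → ret (∈-congˡ (≈-sym e) j) })

    up-cong : ∀ {x y x' y'} → x ≈ x' → y ≈ y' → up x y ≈ up x' y'
    up-cong e f = up-ext (∈-congˡ e up-1) (∈-congˡ f up-2) λ z m → up-∈ m >>=
      λ { (inj₁ g) → ret (inj₁ (≈-trans g e)) ; (inj₂ g) → ret (inj₂ (≈-trans g f)) }

    sing-∈ : ∀ {x z} → z ∈ₘ up x x → z ≈ x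
    sing-∈ m = stable≈ (up-∈ m >>= λ { (inj₁ e) → ret e ; (inj₂ e) → ret e })

    ⋃ : ∀ b → Σ M λ u → ∀ x y → x ∈ₘ y → y ∈ₘ b → x ∈ₘ u
    ⋃ b with axiom kp-union b
    ... | u , h = u , λ x y i j → h y j x i

    ∪-sep : ∀ x y u → Σ M λ b → ∀ z → z ∈ₘ b ↔ (z ∈ₘ u × K (z ∈ₘ x ⊎ z ∈ₘ y))
    ∪-sep x y u = sep {2} ((v0 ∈' v1) ∨' (v0 ∈' v2)) (∨-Δ₀ (∈-Δ₀ _ _) (∈-Δ₀ _ _)) (x ▹ y ▹ none) u

    ∪-in : ∀ x y {b u} → (∀ z w → z ∈ₘ w → w ∈ₘ up x y → z ∈ₘ u) →
      (∀ z → z ∈ₘ b ↔ (z ∈ₘ u × K (z ∈ₘ x ⊎ z ∈ₘ y))) → ∀ z → z ∈ₘ b ↔ K (z ∈ₘ x ⊎ z ∈ₘ y)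
    ∪-in x y g h z = (λ m → proj₂ (proj₁ (h z) m)) , λ k → proj₂ (h z)
      (stable∈ (k >>= λ { (inj₁ i) → ret (g z x i up-1) ; (inj₂ i) → ret (g z y i up-2) }) , k)

    ∪-spec : ∀ x y → Σ M λ b → ∀ z → z ∈ₘ b ↔ K (z ∈ₘ x ⊎ z ∈ₘ y)
    ∪-spec x y = let u , g = ⋃ (up x y) ; b , h = ∪-sep x y u in b , ∪-in x y g h

    _∪_ : M → M → M
    x ∪ y = proj₁ (∪-spec x y)

    ∪-∈ : ∀ {x y z} → z ∈ₘ (x ∪ y) → K (z ∈ₘ x ⊎ z ∈ₘ y)
    ∪-∈ {x} {y} {z} = proj₁ (proj₂ (∪-spec x y) z)

    ∪-1 : ∀ {x y z} → z ∈ₘ x → z ∈ₘ (x ∪ y)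
    ∪-1 {x} {y} {z} i = proj₂ (proj₂ (∪-spec x y) z) (ret (inj₁ i))

    ∪-2 : ∀ {x y z} → z ∈ₘ y → z ∈ₘ (x ∪ y)
    ∪-2 {x} {y} {z} i = proj₂ (proj₂ (∪-spec x y) z) (ret (inj₂ i))

    pair : M → M → M
    pair x y = up (up x x) (up x y)

    pair-cong : ∀ {x y x' y'} → x ≈ x' → y ≈ y' → pair x y ≈ pair x' y'
    pair-cong e f = up-cong (up-cong e e) (up-cong e f)

    up∈pair : ∀ {x y} → up x y ∈ₘ pair x y
    up∈pair = up-2

    pair≉∅ : ∀ {x y} → ¬ (pair x y ≈ ∅)
    pair≉∅ e = proj₂ ∅-spec _ (∈-congʳ e up-1)

    pair-inj₁ : ∀ {x y x' y'} → pair x y ≈ pair x' y' → x ≈ x'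
    pair-inj₁ e = stable≈ (up-∈ (∈-congʳ e up-1) >>= λ
      { (inj₁ f) → ret (≈-sym (sing-∈ (∈-congʳ (≈-sym f) up-1)))
      ; (inj₂ f) → ret (≈-sym (sing-∈ (∈-congʳ (≈-sym f) up-1))) })

    up-cancel : ∀ {x y y'} → up x y ≈ up x y' → y ≈ y'
    up-cancel e = stable≈ (up-∈ (∈-congʳ e up-2) >>= λ
      { (inj₂ f) → ret f
      ; (inj₁ f) → up-∈ (∈-congʳ (≈-sym e) up-2) >>= λ
        { (inj₁ g) → ret (≈-trans f (≈-sym g)) ; (inj₂ g) → ret (≈-sym g) } })

    -- Once the first components are identified, only `up x y` and `up x y'` differ; the degenerate
    -- case, where one of them is a singleton, needs the equation read in both directions.
    pair-inj₂ : ∀ {x y x' y'} → pair x y ≈ pair x' y' → y ≈ y'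
    pair-inj₂ {x} {y} {x'} {y'} e' = stable≈ (up-∈ (∈-congʳ e up-2) >>= λ
      { (inj₂ f) → ret (up-cancel f)
      ; (inj₁ f) → up-∈ (∈-congʳ (≈-sym e) up-2) >>= λ
        { (inj₁ g) → ret (≈-trans (up-cancel f) (≈-sym (up-cancel g))) ; (inj₂ g) → ret (≈-sym (up-cancel g)) } })
      where
      e : pair x y ≈ pair x y'
      e = ≈-trans e' (pair-cong (≈-sym (pair-inj₁ e')) ≈-refl)

  isUp isPair : ∀ {k} → Fin k → Fin k → Fin k → Formula k
  isUp d x y = (x ∈' d) ∧' (y ∈' d) ∧' ∀∈ d ((v0 ≐ suc x) ∨' (v0 ≐ suc y))
  isPair z x y = ∃∈ z (isUp v0 (suc x) (suc x)) ∧' ∃∈ z (isUp v0 (suc x) (suc y))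
    ∧' ∀∈ z (isUp v0 (suc x) (suc x) ∨' isUp v0 (suc x) (suc y))

  isUp-Δ₀ : ∀ {k} (d x y : Fin k) → Δ₀ (isUp d x y)
  isUp-Δ₀ d x y = ∧-Δ₀ (∈-Δ₀ _ _) (∧-Δ₀ (∈-Δ₀ _ _) (∀∈-Δ₀ _ (∨-Δ₀ (≐-Δ₀ _ _) (≐-Δ₀ _ _))))

  isPair-Δ₀ : ∀ {k} (d x y : Fin k) → Δ₀ (isPair d x y)
  isPair-Δ₀ d x y = ∧-Δ₀ (∃∈-Δ₀ _ (isUp-Δ₀ _ _ _)) (∧-Δ₀ (∃∈-Δ₀ _ (isUp-Δ₀ _ _ _))
    (∀∈-Δ₀ _ (∨-Δ₀ (isUp-Δ₀ _ _ _) (isUp-Δ₀ _ _ _))))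

  isUp-to : ∀ {k} (d x y : Fin k) ρ → Sat (isUp d x y) ρ → ρ d ≈ up (ρ x) (ρ y)
  isUp-to d x y ρ (i , j , h) = up-ext i j h

  isUp-from : ∀ {k} (d x y : Fin k) ρ → ρ d ≈ up (ρ x) (ρ y) → Sat (isUp d x y) ρ
  isUp-from d x y ρ e = ∈-congʳ (≈-sym e) up-1 , ∈-congʳ (≈-sym e) up-2 , λ z i → up-∈ (∈-congʳ e i)

  abstract
    isPair-to : ∀ {k} (d x y : Fin k) ρ → Sat (isPair d x y) ρ → ρ d ≈ pair (ρ x) (ρ y)
    isPair-to d x y ρ ((a , i , s) , (b , j , t) , h) = up-ext
      (∈-congˡ (isUp-to v0 (suc x) (suc x) (a ▹ ρ) s) i) (∈-congˡ (isUp-to v0 (suc x) (suc y) (b ▹ ρ) t) j)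
      λ z m → h z m >>= λ { (inj₁ s) → ret (inj₁ (isUp-to v0 (suc x) (suc x) (z ▹ ρ) s))
                          ; (inj₂ s) → ret (inj₂ (isUp-to v0 (suc x) (suc y) (z ▹ ρ) s)) }

    isPair-from : ∀ {k} (d x y : Fin k) ρ → ρ d ≈ pair (ρ x) (ρ y) → Sat (isPair d x y) ρ
    isPair-from d x y ρ e =
        (up (ρ x) (ρ x) , ∈-congʳ (≈-sym e) up-1 , isUp-from v0 (suc x) (suc x) (up (ρ x) (ρ x) ▹ ρ) ≈-refl)
      , (up (ρ x) (ρ y) , ∈-congʳ (≈-sym e) up-2 , isUp-from v0 (suc x) (suc y) (up (ρ x) (ρ y) ▹ ρ) ≈-refl)
      , λ z m → up-∈ (∈-congʳ e m) >>= λ { (inj₁ f) → ret (inj₁ (isUp-from v0 (suc x) (suc x) (z ▹ ρ) f))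
                                        ; (inj₂ f) → ret (inj₂ (isUp-from v0 (suc x) (suc y) (z ▹ ρ) f)) }

-- Inductive definitions given by clauses

infixr 6 _·_
data Pat (n : ℕ) : Set where
  ν   : Fin n → Pat n
  ◦   : Pat n
  _·_ : Pat n → Pat n → Pat n

-- A clause derives its head from its guard, the judgements in its body and, for every (y , b) in
-- its family, the judgements b for all elements of y (which become variable 0 of b).
record Clause : Set where
  constructor rule
  field
    {arity}  : ℕ
    head     : Pat arity
    guard    : Formula arity
    guard-Δ₀ : Δ₀ guard
    body     : List (Pat arity)
    family   : List (Fin arity × Pat (suc arity))
open Clause public

s1 : ∀ {n k} → (Fin n → Fin k) → Fin n → Fin (suc k)
s1 e i = suc (e i)
s2 : ∀ {n k} → (Fin n → Fin k) → Fin n → Fin (suc (suc k))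
s2 e = s1 (s1 e)
s3 : ∀ {n k} → (Fin n → Fin k) → Fin n → Fin (suc (suc (suc k)))
s3 e = s1 (s2 e)

exs : ∀ n {k} → Fin k → Formula (n + k) → Formula k
exs zero    u φ = φ
exs (suc n) u φ = exs n u (∃∈ (n ↑ʳ u) φ)

exs-Δ₀ : ∀ n {k} (u : Fin k) {φ} → Δ₀ φ → Δ₀ (exs n u φ)
exs-Δ₀ zero    u d = d
exs-Δ₀ (suc n) u d = exs-Δ₀ n u (∃∈-Δ₀ _ d)

⋀ ⋁ : ∀ {A : Set} {k} → (A → Formula k) → List A → Formula k
⋀ f []       = ¬' ⊥'
⋀ f (x ∷ xs) = f x ∧' ⋀ f xs
⋁ f []       = ⊥'
⋁ f (x ∷ xs) = f x ∨' ⋁ f xs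

⋀-Δ₀ : ∀ {A : Set} {k} {f : A → Formula k} → (∀ x → Δ₀ (f x)) → ∀ xs → Δ₀ (⋀ f xs)
⋀-Δ₀ d []       = ¬-Δ₀ ⊥-Δ₀
⋀-Δ₀ d (x ∷ xs) = ∧-Δ₀ (d x) (⋀-Δ₀ d xs)

⋁-Δ₀ : ∀ {A : Set} {k} {f : A → Formula k} → (∀ x → Δ₀ (f x)) → ∀ xs → Δ₀ (⋁ f xs)
⋁-Δ₀ d []       = ⊥-Δ₀
⋁-Δ₀ d (x ∷ xs) = ∨-Δ₀ (d x) (⋁-Δ₀ d xs)

rename-Δ₀ : ∀ {k m} {φ : Formula k} (r : Fin k → Fin m) → Δ₀ φ → Δ₀ (rename r φ)
rename-Δ₀ r (∈-Δ₀ x y) = ∈-Δ₀ _ _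
rename-Δ₀ r (≐-Δ₀ x y) = ≐-Δ₀ _ _
rename-Δ₀ r ⊥-Δ₀ = ⊥-Δ₀
rename-Δ₀ r (¬-Δ₀ d) = ¬-Δ₀ (rename-Δ₀ r d)
rename-Δ₀ r (∧-Δ₀ d e) = ∧-Δ₀ (rename-Δ₀ r d) (rename-Δ₀ r e)
rename-Δ₀ r (∨-Δ₀ d e) = ∨-Δ₀ (rename-Δ₀ r d) (rename-Δ₀ r e)
rename-Δ₀ r (⇒-Δ₀ d e) = ⇒-Δ₀ (rename-Δ₀ r d) (rename-Δ₀ r e)
rename-Δ₀ r (∀∈-Δ₀ y d) = ∀∈-Δ₀ (r y) (rename-Δ₀ (ext r) d)
rename-Δ₀ r (∃∈-Δ₀ y d) = ∃∈-Δ₀ (r y) (rename-Δ₀ (ext r) d)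

module KPPrograms (T : Theory) (kp : ∀ φ → KP φ → T ⊩ φ) (𝔐 : Model ⟪ T ⟫) where
  open KPModel T kp 𝔐 public

  eval : ∀ {n} → Pat n → (Fin n → M) → M
  eval (ν i)   σ = σ i
  eval ◦       σ = ∅
  eval (a · b) σ = pair (eval a σ) (eval b σ)

  eval-cong : ∀ {n} (p : Pat n) {σ τ} → (∀ i → σ i ≈ τ i) → eval p σ ≈ eval p τ
  eval-cong (ν i)   h = h i
  eval-cong ◦       h = ≈-refl
  eval-cong (a · b) h = pair-cong (eval-cong a h) (eval-cong b h)

  -- In p σ u: the values of the proper subpatterns of p are in u, which makes w ≈ eval p σ a Δ₀ property of u.
  In : ∀ {n} → Pat n → (Fin n → M) → M → Set
  In (ν i)   σ u = ⊤
  In ◦       σ u = ⊤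
  In (a · b) σ u = (eval a σ ∈ₘ u × eval b σ ∈ₘ u) × In a σ u × In b σ u

  _⊆ₘ_ : M → M → Set
  u ⊆ₘ v = ∀ {x} → x ∈ₘ u → x ∈ₘ v

  In-mono : ∀ {n} (p : Pat n) {σ u v} → u ⊆ₘ v → In p σ u → In p σ v
  In-mono (ν i)   s i' = tt
  In-mono ◦       s i' = tt
  In-mono (a · b) s ((i , j) , k , l) = (s i , s j) , In-mono a s k , In-mono b s l

  nodes : ∀ {n} → Pat n → (Fin n → M) → M
  nodes (ν i)   σ = ∅
  nodes ◦       σ = ∅
  nodes (a · b) σ = up (eval a σ) (eval b σ) ∪ (nodes a σ ∪ nodes b σ)

  In-nodes : ∀ {n} (p : Pat n) σ → In p σ (nodes p σ)
  In-nodes (ν i)   σ = tt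
  In-nodes ◦       σ = tt
  In-nodes (a · b) σ = (∪-1 up-1 , ∪-1 up-2)
    , In-mono a (λ i → ∪-2 (∪-1 i)) (In-nodes a σ) , In-mono b (λ i → ∪-2 (∪-2 i)) (In-nodes b σ)

  Is : ∀ {n} → Pat n → (Fin n → M) → M → M → Set
  Is p σ u w = w ≈ eval p σ × In p σ u

  isPat : ∀ {n k} → Pat n → (Fin n → Fin k) → Fin k → Fin k → Formula k
  isPat (ν i)   e u w = w ≐ e i
  isPat ◦       e u w = ∀∈ w ⊥'
  isPat (a · b) e u w = ∃∈ u (∃∈ (suc u) (isPair (suc (suc w)) v1 v0 ∧'
    isPat a (s2 e) (suc (suc u)) v1 ∧' isPat b (s2 e) (suc (suc u)) v0))

  isPat-Δ₀ : ∀ {n k} (p : Pat n) (e : Fin n → Fin k) u w → Δ₀ (isPat p e u w)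
  isPat-Δ₀ (ν i)   e u w = ≐-Δ₀ _ _
  isPat-Δ₀ ◦       e u w = ∀∈-Δ₀ _ ⊥-Δ₀
  isPat-Δ₀ (a · b) e u w = ∃∈-Δ₀ _ (∃∈-Δ₀ _ (∧-Δ₀ (isPair-Δ₀ _ _ _) (∧-Δ₀ (isPat-Δ₀ a _ _ _) (isPat-Δ₀ b _ _ _))))

  isPat-to : ∀ {n k} (p : Pat n) (e : Fin n → Fin k) u w ρ σ → (∀ i → ρ (e i) ≈ σ i) →
    Sat (isPat p e u w) ρ → Is p σ (ρ u) (ρ w)
  isPat-to (ν i)   e u w ρ σ h s = ≈-trans s (h i) , tt
  isPat-to ◦       e u w ρ σ h s = ext≈ (λ z → (λ i → ⊥-elim (s z i)) , (λ i → ⊥-elim (∉∅ i))) , tt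
  isPat-to (a · b) e u w ρ σ h (y , i , z , j , s , t , t') =
    let ya , ia = isPat-to a (s2 e) (suc (suc u)) v1 (z ▹ y ▹ ρ) σ h t
        zb , ib = isPat-to b (s2 e) (suc (suc u)) v0 (z ▹ y ▹ ρ) σ h t'
    in ≈-trans (isPair-to (suc (suc w)) v1 v0 (z ▹ y ▹ ρ) s) (pair-cong ya zb)
     , (∈-congˡ ya i , ∈-congˡ zb j) , ia , ib

  isPat-from : ∀ {n k} (p : Pat n) (e : Fin n → Fin k) u w ρ σ → (∀ i → ρ (e i) ≈ σ i) →
    Is p σ (ρ u) (ρ w) → Sat (isPat p e u w) ρ
  isPat-from (ν i)   e u w ρ σ h (q , _) = ≈-trans q (≈-sym (h i))
  isPat-from ◦       e u w ρ σ h (q , _) = λ z i → ∉∅ (∈-congʳ q i)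
  isPat-from (a · b) e u w ρ σ h (q , (i , j) , ia , ib) = eval a σ , i , eval b σ , j
    , isPair-from (suc (suc w)) v1 v0 (eval b σ ▹ eval a σ ▹ ρ) q
    , isPat-from a (s2 e) (suc (suc u)) v1 (eval b σ ▹ eval a σ ▹ ρ) σ h (≈-refl , ia)
    , isPat-from b (s2 e) (suc (suc u)) v0 (eval b σ ▹ eval a σ ▹ ρ) σ h (≈-refl , ib)

  evalF : ∀ {n k} → Pat n → (Fin n → Fin k) → Fin k → Formula k
  evalF p e w = ∃' (isPat p (s1 e) v0 (suc w))

  evalF-to : ∀ {n k} (p : Pat n) (e : Fin n → Fin k) w ρ → Sat (evalF p e w) ρ → ρ w ≈ eval p (ρ ∘ e)
  evalF-to p e w ρ (u , s) = proj₁ (isPat-to p (s1 e) v0 (suc w) (u ▹ ρ) (ρ ∘ e) (λ _ → ≈-refl) s)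

  evalF-from : ∀ {n k} (p : Pat n) (e : Fin n → Fin k) w ρ → ρ w ≈ eval p (ρ ∘ e) → Sat (evalF p e w) ρ
  evalF-from p e w ρ q = nodes p (ρ ∘ e) ,
    isPat-from p (s1 e) v0 (suc w) (nodes p (ρ ∘ e) ▹ ρ) (ρ ∘ e) (λ _ → ≈-refl) (q , In-nodes p (ρ ∘ e))

  _⊕_ : ∀ {n k} → (Fin n → M) → (Fin k → M) → Fin (n + k) → M
  _⊕_ {zero}  σ ρ = ρ
  _⊕_ {suc n} σ ρ = σ zero ▹ ((σ ∘ suc) ⊕ ρ)

  ⊕-ˡ : ∀ {n k} (σ : Fin n → M) (ρ : Fin k → M) i → (σ ⊕ ρ) (i ↑ˡ k) ≡ σ i
  ⊕-ˡ σ ρ zero    = refl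
  ⊕-ˡ σ ρ (suc i) = ⊕-ˡ (σ ∘ suc) ρ i

  ⊕-ʳ : ∀ {n k} (σ : Fin n → M) (ρ : Fin k → M) i → (σ ⊕ ρ) (n ↑ʳ i) ≡ ρ i
  ⊕-ʳ {zero}  σ ρ i = refl
  ⊕-ʳ {suc n} σ ρ i = ⊕-ʳ (σ ∘ suc) ρ i

  exs-to : ∀ n {k} (u : Fin k) φ ρ → Sat (exs n u φ) ρ → Σ (Fin n → M) λ σ → (∀ i → σ i ∈ₘ ρ u) × Sat φ (σ ⊕ ρ)
  exs-to zero    u φ ρ s = none , (λ ()) , s
  exs-to (suc n) u φ ρ s with exs-to n u _ ρ s
  ... | τ , h , a , i , t = a ▹ τ , (λ { zero → subst (a ∈ₘ_) (⊕-ʳ τ ρ u) i ; (suc j) → h j }) , t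

  exs-from : ∀ n {k} (u : Fin k) φ ρ (σ : Fin n → M) → (∀ i → σ i ∈ₘ ρ u) → Sat φ (σ ⊕ ρ) → Sat (exs n u φ) ρ
  exs-from zero    u φ ρ σ h s = s
  exs-from (suc n) u φ ρ σ h s = exs-from n u _ ρ (σ ∘ suc) (h ∘ suc)
    (σ zero , subst (σ zero ∈ₘ_) (sym (⊕-ʳ (σ ∘ suc) ρ u)) (h zero) , s)

  ⋀-to : ∀ {A : Set} {k} (f : A → Formula k) xs {ρ} → Sat (⋀ f xs) ρ → ∀ {x} → x ∈ xs → Sat (f x) ρ
  ⋀-to f (x ∷ xs) (s , t) (here refl) = s
  ⋀-to f (x ∷ xs) (s , t) (there i)   = ⋀-to f xs t i

  ⋀-from : ∀ {A : Set} {k} (f : A → Formula k) xs {ρ} → (∀ {x} → x ∈ xs → Sat (f x) ρ) → Sat (⋀ f xs) ρ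
  ⋀-from f []       h = id
  ⋀-from f (x ∷ xs) h = h (here refl) , ⋀-from f xs (h ∘ there)

  ⋁-to : ∀ {A : Set} {k} (f : A → Formula k) xs {ρ} → Sat (⋁ f xs) ρ → K (Σ A λ x → x ∈ xs × Sat (f x) ρ)
  ⋁-to f (x ∷ xs) s = s >>= λ
    { (inj₁ a) → ret (x , here refl , a)
    ; (inj₂ b) → ⋁-to f xs b >>= λ { (y , i , c) → ret (y , there i , c) } }

  ⋁-from : ∀ {A : Set} {k} (f : A → Formula k) xs {ρ x} → x ∈ xs → Sat (f x) ρ → Sat (⋁ f xs) ρ
  ⋁-from f (x ∷ xs) (here refl) s = ret (inj₁ s)
  ⋁-from f (x ∷ xs) (there i)   s = ret (inj₂ (⋁-from f xs i s))

  bodyF : ∀ {n k} (p u : Fin k) → Pat n → Formula (n + k)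
  bodyF {n} {k} p u b = ∃∈ (n ↑ʳ p) (isPat b (s1 (_↑ˡ k)) (suc (n ↑ʳ u)) v0)

  famE : ∀ {n k} → Fin (suc n) → Fin (suc (suc (n + k)))
  famE {n} {k} zero    = suc zero
  famE {n} {k} (suc i) = suc (suc (i ↑ˡ k))

  famF : ∀ {n k} (p u : Fin k) → Fin n × Pat (suc n) → Formula (n + k)
  famF {n} {k} p u (y , b) = ∀∈ (y ↑ˡ k) (∃∈ (suc (n ↑ʳ p)) (isPat b famE (suc (suc (n ↑ʳ u))) v0))

  -- The stock `u` bounds the values of the variables and of the subpatterns, and `p` bounds the
  -- premises; this keeps the formula Δ₀.
  clauseF : ∀ {k} → Fin k → Fin k → Fin k → Clause → Formula k
  clauseF {k} p u w (rule {n} h g _ bs fs) = exs n u (isPat h (_↑ˡ k) (n ↑ʳ u) (n ↑ʳ w)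
    ∧' rename (_↑ˡ k) g ∧' ⋀ (bodyF p u) bs ∧' ⋀ (famF p u) fs)

  clauseF-Δ₀ : ∀ {k} (p u w : Fin k) c → Δ₀ (clauseF p u w c)
  clauseF-Δ₀ p u w (rule {n} h g d bs fs) = exs-Δ₀ n u (∧-Δ₀ (isPat-Δ₀ h _ _ _) (∧-Δ₀ (rename-Δ₀ _ d)
    (∧-Δ₀ (⋀-Δ₀ (λ b → ∃∈-Δ₀ _ (isPat-Δ₀ b _ _ _)) bs) (⋀-Δ₀ (λ (y , b) → ∀∈-Δ₀ _ (∃∈-Δ₀ _ (isPat-Δ₀ b _ _ _))) fs))))

  record Step (c : Clause) (P u w : M) : Set where
    constructor step
    field
      σ   : Fin (arity c) → M
      σ∈  : ∀ i → σ i ∈ₘ u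
      hd  : Is (head c) σ u w
      gd  : Sat (guard c) σ
      bd  : ∀ {b} → b ∈ body c → Σ M λ w' → w' ∈ₘ P × Is b σ u w'
      fam : ∀ {y b} → (y , b) ∈ family c → ∀ a → a ∈ₘ σ y → Σ M λ w' → w' ∈ₘ P × Is b (a ▹ σ) u w'

  step-mono : ∀ {c P P' u u' w} → P ⊆ₘ P' → u ⊆ₘ u' → Step c P u w → Step c P' u' w
  step-mono {c} s t (step σ σ∈ (e , i) g b f) = step σ (λ i → t (σ∈ i)) (e , In-mono (head c) t i) g
    (λ {p} m → let w , j , e , i = b m in w , s j , e , In-mono p t i)
    (λ {_} {p} m a l → let w , j , e , i = f m a l in w , s j , e , In-mono p t i)

  ≡⇒≈ : ∀ {x y} → x ≡ y → x ≈ y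
  ≡⇒≈ refl = ≈-refl

  famE-eq : ∀ {n k} (σ : Fin n → M) (ρ : Fin k → M) a w' i → (w' ▹ a ▹ (σ ⊕ ρ)) (famE i) ≈ (a ▹ σ) i
  famE-eq σ ρ a w' zero    = ≈-refl
  famE-eq σ ρ a w' (suc i) = ≡⇒≈ (⊕-ˡ σ ρ i)

  clauseF-to : ∀ {k} (p u w : Fin k) c ρ → Sat (clauseF p u w c) ρ → Step c (ρ p) (ρ u) (ρ w)
  clauseF-to {k} p u w (rule {n} h g _ bs fs) ρ s with exs-to n u _ ρ s
  ... | σ , σ∈ , sh , sg , sb , sf = step σ σ∈
    (subst₂ (Is h σ) (⊕-ʳ σ ρ u) (⊕-ʳ σ ρ w) (isPat-to h (_↑ˡ k) (n ↑ʳ u) (n ↑ʳ w) (σ ⊕ ρ) σ (≡⇒≈ ∘ ⊕-ˡ σ ρ) sh))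
    (proj₁ (Sat-ren g (≡⇒≈ ∘ ⊕-ˡ σ ρ)) sg)
    (λ {b} m → let w' , i , t = ⋀-to (bodyF p u) bs sb m in
      w' , subst (w' ∈ₘ_) (⊕-ʳ σ ρ p) i , subst (λ v → Is b σ v w') (⊕-ʳ σ ρ u)
        (isPat-to b (s1 (_↑ˡ k)) (suc (n ↑ʳ u)) v0 (w' ▹ (σ ⊕ ρ)) σ (≡⇒≈ ∘ ⊕-ˡ σ ρ) t))
    (λ {y} {b} m a l → let w' , i , t = ⋀-to (famF p u) fs sf m a (subst (a ∈ₘ_) (sym (⊕-ˡ σ ρ y)) l) in
      w' , subst (w' ∈ₘ_) (⊕-ʳ σ ρ p) i , subst (λ v → Is b (a ▹ σ) v w') (⊕-ʳ σ ρ u)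
        (isPat-to b famE (suc (suc (n ↑ʳ u))) v0 (w' ▹ a ▹ (σ ⊕ ρ)) (a ▹ σ) (famE-eq σ ρ a w') t))

  clauseF-from : ∀ {k} (p u w : Fin k) c ρ → Step c (ρ p) (ρ u) (ρ w) → Sat (clauseF p u w c) ρ
  clauseF-from {k} p u w (rule {n} h g _ bs fs) ρ (step σ σ∈ sh sg sb sf) = exs-from n u _ ρ σ σ∈
    ( isPat-from h (_↑ˡ k) (n ↑ʳ u) (n ↑ʳ w) (σ ⊕ ρ) σ (≡⇒≈ ∘ ⊕-ˡ σ ρ)
        (subst₂ (Is h σ) (sym (⊕-ʳ σ ρ u)) (sym (⊕-ʳ σ ρ w)) sh)
    , proj₂ (Sat-ren g (≡⇒≈ ∘ ⊕-ˡ σ ρ)) sg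
    , ⋀-from (bodyF p u) bs (λ {b} m → let w' , i , t = sb m in
        w' , subst (w' ∈ₘ_) (sym (⊕-ʳ σ ρ p)) i
        , isPat-from b (s1 (_↑ˡ k)) (suc (n ↑ʳ u)) v0 (w' ▹ (σ ⊕ ρ)) σ (≡⇒≈ ∘ ⊕-ˡ σ ρ)
            (subst (λ v → Is b σ v w') (sym (⊕-ʳ σ ρ u)) t))
    , ⋀-from (famF p u) fs (λ {(y , b)} m a l → let w' , i , t = sf m a (subst (a ∈ₘ_) (⊕-ˡ σ ρ y) l) in
        w' , subst (w' ∈ₘ_) (sym (⊕-ʳ σ ρ p)) i
        , isPat-from b famE (suc (suc (n ↑ʳ u))) v0 (w' ▹ a ▹ (σ ⊕ ρ)) (a ▹ σ) (famE-eq σ ρ a w')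
            (subst (λ v → Is b (a ▹ σ) v w') (sym (⊕-ʳ σ ρ u)) t)) )

  -- Derivations as sets

  module Prog (prog : List Clause) where

    -- Self-support, without well-foundedness: each judgement of `P` follows by a clause from
    -- judgements of `P`. What is later shown of `D` rests on introduction and one-step inversion
    -- only.
    Correct : M → M → Set
    Correct P u = ∀ w → w ∈ₘ P → K (Σ Clause λ c → c ∈ prog × Step c P u w)

    correctF : ∀ {k} → Fin k → Fin k → Formula k
    correctF p u = ∀∈ p (⋁ (clauseF (suc p) (suc u) v0) prog)

    correctF-Δ₀ : ∀ {k} (p u : Fin k) → Δ₀ (correctF p u)
    correctF-Δ₀ p u = ∀∈-Δ₀ _ (⋁-Δ₀ (clauseF-Δ₀ _ _ _) prog)

    correctF-to : ∀ {k} (p u : Fin k) ρ → Sat (correctF p u) ρ → Correct (ρ p) (ρ u)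
    correctF-to p u ρ s w i = ⋁-to (clauseF (suc p) (suc u) v0) prog (s w i) >>= λ
      { (c , m , t) → ret (c , m , clauseF-to (suc p) (suc u) v0 c (w ▹ ρ) t) }

    correctF-from : ∀ {k} (p u : Fin k) ρ → Correct (ρ p) (ρ u) → Sat (correctF p u) ρ
    correctF-from p u ρ s w i = Sat-stable (⋁ (clauseF (suc p) (suc u) v0) prog) (s w i >>= λ
      { (c , m , t) → ret (⋁-from (clauseF (suc p) (suc u) v0) prog m (clauseF-from (suc p) (suc u) v0 c (w ▹ ρ) t)) })

    correct-step : ∀ {P P' u u' w} → P ⊆ₘ P' → u ⊆ₘ u' → w ∈ₘ P → Correct P u →
      K (Σ Clause λ c → c ∈ prog × Step c P' u' w)
    correct-step s t i h = h _ i >>= λ { (c , m , st) → ret (c , m , step-mono s t st) }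

    -- Placing the proof in its stock leaves a single unbounded quantifier in `drvF`, the form to
    -- which Δ₀-collection applies.
    record D (w : M) : Set where
      constructor drv
      field
        {stock proof} : M
        in-stock : proof ∈ₘ stock
        correct  : Correct proof stock
        in-proof : w ∈ₘ proof

    D-cong : ∀ {w w'} → w ≈ w' → D w → D w'
    D-cong e (drv i h j) = drv i h (∈-congˡ e j)

    drvF : ∀ {k} → Fin k → Formula k
    drvF w = ∃' (∃∈ v0 (correctF v0 v1 ∧' (suc (suc w) ∈' v0)))

    drvF-to : ∀ {k} (w : Fin k) ρ → Sat (drvF w) ρ → D (ρ w)
    drvF-to w ρ (u , P , i , h , j) = drv i (correctF-to v0 v1 (P ▹ u ▹ ρ) h) j

    drvF-from : ∀ {k} (w : Fin k) ρ → D (ρ w) → Sat (drvF w) ρ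
    drvF-from w ρ (drv {u} {P} i h j) = u , P , i , correctF-from v0 v1 (P ▹ u ▹ ρ) h , j

    D-stable : ∀ {w} → K (D w) → D w
    D-stable {w} k = drvF-to zero (w ▹ none)
      (Sat-stable (drvF zero) (k >>= λ d → ret (drvF-from zero (w ▹ none) d)))

    judgF : ∀ {n k} → Pat n → (Fin n → Fin k) → Formula k
    judgF p e = ∃' (evalF p (s1 e) v0 ∧' drvF v0)

    judgF-to : ∀ {n k} (p : Pat n) (e : Fin n → Fin k) ρ → Sat (judgF p e) ρ → D (eval p (ρ ∘ e))
    judgF-to p e ρ (w , s , d) = D-cong (evalF-to p (s1 e) v0 (w ▹ ρ) s) (drvF-to v0 (w ▹ ρ) d)

    judgF-from : ∀ {n k} (p : Pat n) (e : Fin n → Fin k) ρ → D (eval p (ρ ∘ e)) → Sat (judgF p e) ρ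
    judgF-from p e ρ d = w , evalF-from p (s1 e) v0 (w ▹ ρ) ≈-refl , drvF-from v0 (w ▹ ρ) d
      where w = eval p (ρ ∘ e)

    Good : (M → M → Set) → Set
    Good R = Σ M λ P → Σ M λ U → Correct P U × R P U

    Mono : (M → M → Set) → Set
    Mono R = ∀ {P P' U U'} → P ⊆ₘ P' → U ⊆ₘ U' → R P U → R P' U'

    -- Self-supporting sets are closed under union, since enlarging proof or stock preserves every
    -- step.
    good-× : ∀ {R S} → Mono R → Mono S → Good R → Good S → Good (λ P U → R P U × S P U)
    good-× mr ms (P , U , h , r) (P' , U' , h' , s) = P ∪ P' , U ∪ U' ,
      (λ w i → ∪-∈ i >>= λ { (inj₁ j) → correct-step ∪-1 ∪-1 j h ; (inj₂ j) → correct-step ∪-2 ∪-2 j h' })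
      , mr ∪-1 ∪-1 r , ms ∪-2 ∪-2 s

    good-all : ∀ {A : Set} (R : A → M → M → Set) → (∀ x → Mono (R x)) → ∀ xs → (∀ {x} → x ∈ xs → Good (R x)) →
      Good (λ P U → ∀ {x} → x ∈ xs → R x P U)
    good-all R m []       h = ∅ , ∅ , (λ w i → ⊥-elim (∉∅ i)) , λ ()
    good-all R m (x ∷ xs) h with good-× (m x) (λ s t r {y} i → m y s t (r i)) (h (here refl)) (good-all R m xs (h ∘ there))
    ... | P , U , c , r , rs = P , U , c , λ { (here refl) → r ; (there i) → rs i }

    Has : ∀ {n} → Pat n → (Fin n → M) → M → M → Set
    Has b σ P U = Σ M λ w → w ∈ₘ P × Is b σ U w

    Has-mono : ∀ {n} (b : Pat n) σ → Mono (Has b σ)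
    Has-mono b σ s t (w , i , e , j) = w , s i , e , In-mono b t j

    D-good : ∀ {n} (b : Pat n) σ → D (eval b σ) → Good (Has b σ)
    D-good b σ (drv {u} {P} _ h i) = P , u ∪ nodes b σ , (λ w j → correct-step id ∪-1 j h)
      , eval b σ , i , ≈-refl , In-mono b ∪-2 (In-nodes b σ)

    HasAll : ∀ {n} → M → Pat (suc n) → (Fin n → M) → M → M → Set
    HasAll y b σ P U = ∀ a → a ∈ₘ y → Has b (a ▹ σ) P U

    collF : ∀ {n} → Pat (suc n) → Formula (suc (suc n))
    collF b = ∃∈ v0 (correctF v0 v1 ∧' ∃∈ v0 (isPat b (s3 id) v2 v0))

    collF-Δ₀ : ∀ {n} (b : Pat (suc n)) → Δ₀ (collF b)
    collF-Δ₀ b = ∃∈-Δ₀ _ (∧-Δ₀ (correctF-Δ₀ _ _) (∃∈-Δ₀ _ (isPat-Δ₀ b _ _ _)))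

    -- The bound `B` from collection may contain junk; this retains only members of proofs that are
    -- correct for a stock in `B`.
    gatherF : Formula 2
    gatherF = ∃∈ v1 (∃∈ v0 (correctF v0 v1 ∧' (v2 ∈' v0)))

    gatherF-Δ₀ : Δ₀ gatherF
    gatherF-Δ₀ = ∃∈-Δ₀ _ (∃∈-Δ₀ _ (∧-Δ₀ (correctF-Δ₀ _ _) (∈-Δ₀ _ _)))

    collF-intro : ∀ {n a} (b : Pat (suc n)) (σ : Fin n → M) → D (eval b (a ▹ σ)) →
      Σ M λ u → Sat (collF b) (u ▹ a ▹ σ)
    collF-intro {a = a} b σ d with D-good b (a ▹ σ) d
    ... | p , u , c , w , j , q = u ∪ up p p , p , ∪-2 up-1
      , correctF-from v0 v1 (p ▹ (u ∪ up p p) ▹ a ▹ σ) (λ w' k → correct-step id ∪-1 k c)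
      , w , j , isPat-from b (s3 id) v2 v0 (w ▹ p ▹ (u ∪ up p p) ▹ a ▹ σ) (a ▹ σ) (λ _ → ≈-refl)
                  (proj₁ q , In-mono b ∪-1 (proj₂ q))

    -- `P` is a union of correct sets, and the stocks in `B` merge into `U`. `U` and `V` may be too
    -- large, which is harmless: correctness is monotone in the stock, and `gatherF` cuts `P` out of
    -- `V`.
    good-bounded : ∀ {n y B U V P} (b : Pat (suc n)) (σ : Fin n → M) →
      (∀ a → a ∈ₘ y → Σ M λ u → u ∈ₘ B × Sat (collF b) (u ▹ a ▹ σ)) →
      (∀ p u → p ∈ₘ u → u ∈ₘ B → p ∈ₘ U) → (∀ w p → w ∈ₘ p → p ∈ₘ U → w ∈ₘ V) →
      (∀ w → w ∈ₘ P ↔ (w ∈ₘ V × Sat gatherF (w ▹ B ▹ none))) → Good (HasAll y b σ)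
    good-bounded {y = y} {B} {U} {V} {P} b σ hB hU hV hP = P , U , P-correct , P-has
      where
      p⊆P : ∀ {p u} → u ∈ₘ B → p ∈ₘ u → Correct p u → p ⊆ₘ P
      p⊆P {p} {u} i j c {w} k = proj₂ (hP w)
        (hV w p k (hU p u j i) , u , i , p , j , correctF-from v0 v1 (p ▹ u ▹ w ▹ B ▹ none) c , k)
      P-correct : Correct P U
      P-correct w i with proj₂ (proj₁ (hP w) i)
      ... | u , i' , p , j , c , k with correctF-to v0 v1 (p ▹ u ▹ w ▹ B ▹ none) c
      ...   | c' = correct-step (p⊆P i' j c') (λ m → hU _ u m i') k c'
      P-has : HasAll y b σ P U
      P-has a i with hB a i
      ... | u , i' , p , j , c , w , k , s
        with isPat-to b (s3 id) v2 v0 (w ▹ p ▹ u ▹ a ▹ σ) (a ▹ σ) (λ _ → ≈-refl) s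
      ...   | e , q = w , p⊆P i' j (correctF-to v0 v1 (p ▹ u ▹ a ▹ σ) c) k , e , In-mono b (λ m → hU _ u m i') q

    gather : ∀ B V → Σ M λ P → ∀ w → w ∈ₘ P ↔ (w ∈ₘ V × Sat gatherF (w ▹ B ▹ none))
    gather B V = sep gatherF gatherF-Δ₀ (B ▹ none) V

    good-collected : ∀ {n y} (b : Pat (suc n)) (σ : Fin n → M) →
      (Σ M λ B → ∀ a → a ∈ₘ y → Σ M λ u → u ∈ₘ B × Sat (collF b) (u ▹ a ▹ σ)) → Good (HasAll y b σ)
    good-collected b σ (B , hB) with ⋃ B
    ... | U , hU with ⋃ U
    ...   | V , hV with gather B V
    ...     | P , hP = good-bounded b σ hB hU hV hP

    -- The infinitary rule: Δ₀-collection bounds the derivations of the premises, and Δ₀-separation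
    -- cuts their union out of the bound.
    D-good-all : ∀ {n} (y : M) (b : Pat (suc n)) (σ : Fin n → M) → (∀ a → a ∈ₘ y → D (eval b (a ▹ σ))) →
      Good (HasAll y b σ)
    D-good-all y b σ h = good-collected b σ (coll (collF b) (collF-Δ₀ b) σ y (λ a i → collF-intro b σ (h a i)))

    vars : ∀ {n} → (Fin n → M) → M
    vars {zero}  σ = ∅
    vars {suc n} σ = up (σ zero) (σ zero) ∪ vars (σ ∘ suc)

    vars-∈ : ∀ {n} (σ : Fin n → M) i → σ i ∈ₘ vars σ
    vars-∈ σ zero    = ∪-1 up-1
    vars-∈ σ (suc i) = ∪-2 (vars-∈ (σ ∘ suc) i)

    Premises : (c : Clause) → (Fin (arity c) → M) → M → M → Set
    Premises c σ P U = (∀ {b} → b ∈ body c → Has b σ P U) × (∀ {yb} → yb ∈ family c → HasAll (σ (proj₁ yb)) (proj₂ yb) σ P U)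

    extend : ∀ {c} → c ∈ prog → (σ : Fin (arity c) → M) → Sat (guard c) σ → Good (Premises c σ) → D (eval (head c) σ)
    extend {c} m σ g (P , U , cor , rb , rf) = drv {stock = U'} {proof = P'} (∪-2 (∪-2 (∪-2 up-1))) cor' (∪-2 up-1)
      where
      w = eval (head c) σ
      P' = P ∪ up w w
      -- Everything that the Δ₀ description of the new step quantifies over, and `P'` itself, as `D`
      -- demands.
      U' = U ∪ (nodes (head c) σ ∪ (vars σ ∪ up P' P'))
      new : ∀ {w'} → w' ≈ w → Step c P' U' w'
      new e = step σ (λ i → ∪-2 (∪-2 (∪-1 (vars-∈ σ i))))
        (e , In-mono (head c) (λ i → ∪-2 (∪-1 i)) (In-nodes (head c) σ)) g
        (λ {b} i → Has-mono b σ ∪-1 ∪-1 (rb i))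
        (λ {_} {b} i a j → Has-mono b (a ▹ σ) ∪-1 ∪-1 (rf i a j))
      cor' : Correct P' U'
      cor' w' i = ∪-∈ i >>= λ { (inj₁ j) → correct-step ∪-1 ∪-1 j cor ; (inj₂ j) → ret (c , m , new (sing-∈ j)) }

    D-intro : ∀ {c} → c ∈ prog → (σ : Fin (arity c) → M) → Sat (guard c) σ →
      (∀ {b} → b ∈ body c → D (eval b σ)) →
      (∀ {y b} → (y , b) ∈ family c → ∀ a → a ∈ₘ σ y → D (eval b (a ▹ σ))) →
      D (eval (head c) σ)
    D-intro {c} m σ g hb hf = extend m σ g
      (good-× (λ s t r {x} i → Has-mono x σ s t (r i)) (λ s t r {x} i a j → Has-mono (proj₂ x) (a ▹ σ) s t (r i a j))
        (good-all (λ b → Has b σ) (λ b → Has-mono b σ) (body c) (λ {b} i → D-good b σ (hb i)))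
        (good-all (λ (y , b) → HasAll (σ y) b σ) (λ (y , b) s t r a j → Has-mono b (a ▹ σ) s t (r a j)) (family c)
          (λ {(y , b)} i → D-good-all (σ y) b σ (hf i))))

    record Inverted (w : M) (c : Clause) : Set where
      constructor inv
      field
        σ   : Fin (arity c) → M
        hd  : w ≈ eval (head c) σ
        gd  : Sat (guard c) σ
        bd  : ∀ {b} → b ∈ body c → D (eval b σ)
        fam : ∀ {y b} → (y , b) ∈ family c → ∀ a → a ∈ₘ σ y → D (eval b (a ▹ σ))

    D-elim : ∀ {w} → D w → K (Σ Clause λ c → c ∈ prog × Inverted w c)
    D-elim (drv s h i) = h _ i >>= λ { (c , m , step σ _ hd gd bd fam) → ret (c , m , inv σ (proj₁ hd) gd
      (λ j → let w , k , e , _ = bd j in drv s h (∈-congˡ e k))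
      (λ j a l → let w , k , e , _ = fam j a l in drv s h (∈-congˡ e k))) }

-- Finite derivations inside and outside the model

renP : ∀ {n m} → (Fin n → Fin m) → Pat n → Pat m
renP r (ν i)   = ν (r i)
renP r ◦       = ◦
renP r (a · b) = renP r a · renP r b

fill : ∀ {n} → Pat n → (Fin n → Tm) → Tm
fill (ν i)   s = s i
fill ◦       s = leaf
fill (a · b) s = node (fill a s) (fill b s)

lit : ∀ {n} → Tm → Pat n
lit leaf       = ◦
lit (node a b) = lit a · lit b

clash : ∀ {m n} → Pat m → Pat n → Bool
clash (a · b) (c · d) = clash a c ∨ clash b d
clash (a · b) ◦       = true
clash ◦       (c · d) = true
clash _       _       = false

record Horn : Set where
  constructor horn
  field
    {arity} : ℕ
    head    : Pat arity
    body    : List (Pat arity)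

data Der {R : Set} (clause : R → Horn) : Tm → Set where
  tm : ∀ t → Der clause (node leaf t)
  by : ∀ r (s : Fin (Horn.arity (clause r)) → Tm) → All (λ b → Der clause (fill b s)) (Horn.body (clause r)) →
    Der clause (fill (Horn.head (clause r)) s)

-- Judgements carry a time: ν 0 is the time of the head and its element ν 1 that of the premises.
-- The judgement ◦ · t says that t is a tree.
timed : Horn → Clause
timed (horn {n} h bs) = rule (ν zero · renP (s2 id) h) (v1 ∈' v0) (∈-Δ₀ _ _)
  (map (λ b → ν v1 · renP (s2 id) b) bs ++ map (λ i → ν v1 · ◦ · ν (suc (suc i))) (allFin n)) []

-- `timed` demands a tree certificate for every variable of a clause, which excludes nonstandard
-- parameters such as the cut formula of modus ponens. For `tm-node` these are the certificates of
-- the two subtrees, so its own body is empty.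
tm-leaf tm-node : Horn
tm-leaf = horn {0} (◦ · ◦) []
tm-node = horn {2} (◦ · ν v0 · ν v1) []

K-Fin : ∀ {n} {A : Fin n → Set} → (∀ i → K (A i)) → K (∀ i → A i)
K-Fin {zero}  h = ret λ ()
K-Fin {suc n} h = h zero >>= λ a → K-Fin (h ∘ suc) >>= λ f → ret λ { zero → a ; (suc i) → f i }

K-All : {X : Set} {A : X → Set} (xs : List X) → (∀ {x} → x ∈ xs → K (A x)) → K (All A xs)
K-All []       h = ret []
K-All (x ∷ xs) h = h (here refl) >>= λ a → K-All xs (h ∘ there) >>= λ as → ret (a ∷ as)

module KPDerivations (T : Theory) (kp : ∀ φ → KP φ → T ⊩ φ) (𝔐 : Model ⟪ T ⟫) where
  open KPPrograms T kp 𝔐 public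

  ⌈_⌉ : Tm → M
  ⌈ leaf ⌉     = ∅
  ⌈ node a b ⌉ = pair ⌈ a ⌉ ⌈ b ⌉

  ⌈⌉-inj : ∀ s t → ⌈ s ⌉ ≈ ⌈ t ⌉ → s ≡ t
  ⌈⌉-inj leaf       leaf       e = refl
  ⌈⌉-inj leaf       (node _ _) e = ⊥-elim (pair≉∅ (≈-sym e))
  ⌈⌉-inj (node _ _) leaf       e = ⊥-elim (pair≉∅ e)
  ⌈⌉-inj (node a b) (node c d) e = cong₂ node (⌈⌉-inj a c (pair-inj₁ e)) (⌈⌉-inj b d (pair-inj₂ e))

  eval-fill : ∀ {n} (p : Pat n) s → eval p (⌈_⌉ ∘ s) ≡ ⌈ fill p s ⌉
  eval-fill (ν i)   s = refl
  eval-fill ◦       s = refl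
  eval-fill (a · b) s = cong₂ pair (eval-fill a s) (eval-fill b s)

  eval-lit : ∀ {n} t (σ : Fin n → M) → eval (lit t) σ ≡ ⌈ t ⌉
  eval-lit leaf       σ = refl
  eval-lit (node a b) σ = cong₂ pair (eval-lit a σ) (eval-lit b σ)

  eval-ren : ∀ {n m} (r : Fin n → Fin m) p (σ : Fin m → M) → eval (renP r p) σ ≡ eval p (σ ∘ r)
  eval-ren r (ν i)   σ = refl
  eval-ren r ◦       σ = refl
  eval-ren r (a · b) σ = cong₂ pair (eval-ren r a σ) (eval-ren r b σ)

  -- For concrete patterns this computes to the list of equations forced by the injectivity of
  -- pairs, ready for pattern matching.
  Unify : ∀ {m n} → Pat m → (Fin m → M) → Pat n → (Fin n → M) → Set
  Unify (a · b) τ (c · d) σ = Unify a τ c σ × Unify b τ d σ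
  Unify ◦       τ ◦       σ = ⊤
  Unify q       τ h       σ = eval q τ ≈ eval h σ

  unify : ∀ {m n} (q : Pat m) τ (h : Pat n) σ → eval q τ ≈ eval h σ → Unify q τ h σ
  unify (a · b) τ (c · d) σ e = unify a τ c σ (pair-inj₁ e) , unify b τ d σ (pair-inj₂ e)
  unify ◦       τ ◦       σ e = tt
  unify (ν i)   τ h       σ e = e
  unify ◦       τ (ν i)   σ e = e
  unify ◦       τ (c · d) σ e = e
  unify (a · b) τ (ν i)   σ e = e
  unify (a · b) τ ◦       σ e = e

  clash-≉ : ∀ {m n} (q : Pat m) τ (h : Pat n) σ → clash q h ≡ true → ¬ (eval q τ ≈ eval h σ)
  clash-≉ (a · b) τ (c · d) σ k e with clash a c in ac
  ... | true  = clash-≉ a τ c σ ac (pair-inj₁ e)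
  ... | false = clash-≉ b τ d σ k (pair-inj₂ e)
  clash-≉ (a · b) τ ◦ σ k e = pair≉∅ e
  clash-≉ ◦ τ (c · d) σ k e = pair≉∅ (≈-sym e)
  clash-≉ (ν i) τ (ν j) σ () e
  clash-≉ (ν i) τ ◦ σ () e
  clash-≉ (ν i) τ (c · d) σ () e
  clash-≉ ◦ τ (ν i) σ () e
  clash-≉ ◦ τ ◦ σ () e
  clash-≉ (a · b) τ (ν i) σ () e

  module Inversion (prog : List Clause) where
    open Prog prog public

    record Case {m} (q : Pat m) (τ : Fin m → M) (c : Clause) : Set where
      constructor case
      field
        σ   : Fin (arity c) → M
        un  : Unify q τ (head c) σ
        gd  : Sat (guard c) σ
        bd  : All (λ b → D (eval b σ)) (body c)
        fam : All (λ (y , b) → ∀ a → a ∈ₘ σ y → D (eval b (a ▹ σ))) (family c)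

    -- Case distinction over the clauses whose head can match q; the others are dropped by computation.
    Cases : ∀ {m} → Pat m → (Fin m → M) → List Clause → Set
    Cases q τ []       = ⊥
    Cases q τ (c ∷ cs) = if clash q (head c) then Cases q τ cs else (Case q τ c ⊎ Cases q τ cs)

    tabAll : {X : Set} {A : X → Set} (xs : List X) → (∀ {x} → x ∈ xs → A x) → All A xs
    tabAll []       h = []
    tabAll (x ∷ xs) h = h (here refl) ∷ tabAll xs (h ∘ there)

    find : ∀ {m} (q : Pat m) τ {c} cs → c ∈ cs → Inverted (eval q τ) c → Cases q τ cs
    find q τ (c ∷ cs) (here refl) (inv σ e g b f) with clash q (head c) in k
    ... | true  = ⊥-elim (clash-≉ q τ (head c) σ k e)
    ... | false = inj₁ (case σ (unify q τ (head c) σ e) g (tabAll (body c) b) (tabAll (family c) f))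
    find q τ (c ∷ cs) (there i) v with clash q (head c)
    ... | true  = find q τ cs i v
    ... | false = inj₂ (find q τ cs i v)

    invert : ∀ {m} (q : Pat m) τ → D (eval q τ) → K (Cases q τ prog)
    invert q τ d = D-elim d >>= λ { (c , m , v) → ret (find q τ prog m v) }

  -- There is an ∈-chain of length `h` below `i`, with `h` external: for each fixed `h` this makes
  -- sense in any model, whether or not it has an ω.
  Rank : ℕ → M → Set
  Rank zero    i = ⊤
  Rank (suc h) i = Σ M λ j → j ∈ₘ i × Rank h j

  Rank-≤ : ∀ {h h'} i → h ≤ h' → Rank h' i → Rank h i
  Rank-≤ i z≤n     r           = tt
  Rank-≤ i (s≤s l) (j , m , r) = j , m , Rank-≤ j l r

  Rank-cong : ∀ h {i j} → i ≈ j → Rank h i → Rank h j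
  Rank-cong zero    e r           = tt
  Rank-cong (suc h) e (j , m , r) = j , ∈-congʳ e m , r

  -- Zermelo's numerals: stages with `Rank h` but without `Rank (suc h)`, high enough for a given
  -- derivation and still of finite rank.
  clock : ℕ → M
  clock zero    = ∅
  clock (suc h) = up (clock h) (clock h)

  clock-Rank : ∀ h → Rank h (clock h)
  clock-Rank zero    = tt
  clock-Rank (suc h) = clock h , up-1 , clock-Rank h

  clock-¬Rank : ∀ h → ¬ Rank (suc h) (clock h)
  clock-¬Rank zero    (j , m , r) = ∉∅ m
  clock-¬Rank (suc h) (j , m , r) = clock-¬Rank h (Rank-cong (suc h) (sing-∈ m) r)

  -- Timed derivations

  module Timed {R : Set} (clause : R → Horn) (rules : List R) (complete : ∀ r → r ∈ rules) where
    prog : List Clause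
    prog = map timed (tm-leaf ∷ tm-node ∷ map clause rules)

    open Inversion prog public

    D-timed : ∀ {H} → H ∈ (tm-leaf ∷ tm-node ∷ map clause rules) → ∀ {i j} (s : Fin (Horn.arity H) → Tm) → j ∈ₘ i →
      (∀ {b} → b ∈ Horn.body H → D (pair j ⌈ fill b s ⌉)) → (∀ k → D (pair j ⌈ node leaf (s k) ⌉)) →
      D (pair i ⌈ fill (Horn.head H) s ⌉)
    D-timed {H@(horn {n} h bs)} m {i} {j} s ij db dv = subst D (cong (pair i) (eq₁ h))
      (D-intro (∈-map⁺ timed m) σ ij bodies λ ())
      where
      σ = i ▹ j ▹ (⌈_⌉ ∘ s)
      eq₁ : ∀ p → eval (renP (s2 id) p) σ ≡ ⌈ fill p s ⌉
      eq₁ p = trans (eval-ren (s2 id) p σ) (eval-fill p s)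
      bodies : ∀ {b} → b ∈ body (timed H) → D (eval b σ)
      bodies k with ∈-++⁻ (map (λ b → ν v1 · renP (s2 id) b) bs) k
      ... | inj₁ k' with ∈-map⁻ _ k'
      ...   | b , l , refl = subst D (cong (pair j) (sym (eq₁ b))) (db l)
      bodies k | inj₂ k' with ∈-map⁻ _ k'
      ...   | v , l , refl = dv v

    Eventually : Tm → Set
    Eventually t = Σ ℕ λ h → ∀ i → Rank h i → D (pair i ⌈ t ⌉)

    tree-D : ∀ t → Eventually (node leaf t)
    -- Height 1 even for a leaf: each timed clause asks for some earlier time `j ∈ i`.
    tree-D leaf = 1 , λ { i (j , m , r) → D-timed {tm-leaf} (here refl) none m (λ ()) λ () }
    tree-D (node a b) with tree-D a | tree-D b
    ... | h , f | h' , g = suc (h ⊔ h') , λ { i (j , m , r) → D-timed {tm-node} (there (here refl)) (a ▹ b ▹ none) m (λ ())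
      λ { zero → f j (Rank-≤ j (m≤m⊔n h h') r) ; (suc zero) → g j (Rank-≤ j (m≤n⊔m h h') r) } }

    tree-Ds : ∀ {n} (s : Fin n → Tm) → Σ ℕ λ h → ∀ j → Rank h j → ∀ k → D (pair j ⌈ node leaf (s k) ⌉)
    tree-Ds {zero}  s = 0 , λ _ _ ()
    tree-Ds {suc n} s with tree-D (s zero) | tree-Ds (s ∘ suc)
    ... | h , f | h' , g = h ⊔ h' , λ j r → λ { zero → f j (Rank-≤ j (m≤m⊔n h h') r)
                                             ; (suc k) → g j (Rank-≤ j (m≤n⊔m h h') r) k }

    -- All premises of a step, certificates included, sit at one earlier time, so a single chain of
    -- length `h` below `i` has room for a derivation of height `h`.
    Der⇒D : ∀ {t} → Der clause t → Eventually t
    Ders⇒D : ∀ {n} {s : Fin n → Tm} {bs} → All (λ b → Der clause (fill b s)) bs →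
      Σ ℕ λ h → ∀ j → Rank h j → ∀ {b} → b ∈ bs → D (pair j ⌈ fill b s ⌉)
    Der⇒D (tm t) = tree-D t
    Der⇒D (by r s ds) with Ders⇒D ds | tree-Ds s
    ... | h , f | h' , g = suc (h ⊔ h') , λ { i (j , m , rk) →
      D-timed (there (there (∈-map⁺ clause (complete r)))) s m
        (f j (Rank-≤ j (m≤m⊔n h h') rk)) (g j (Rank-≤ j (m≤n⊔m h h') rk)) }
    Ders⇒D [] = 0 , λ _ _ ()
    Ders⇒D (d ∷ ds) with Der⇒D d | Ders⇒D ds
    ... | h , f | h' , g = h ⊔ h' , λ j r → λ { (here refl) → f j (Rank-≤ j (m≤m⊔n h h') r)
                                             ; (there k) → g j (Rank-≤ j (m≤n⊔m h h') r) k }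

    Standard : M → Set
    Standard w = Σ Tm λ t → w ≈ ⌈ t ⌉ × Der clause t

    -- Each inversion passes to an element of `i` with a smaller bound `h`, so even an ill-founded
    -- set of judgements is unwound finitely often. The certificates first make the parameters
    -- genuine trees; the premises can then be read outside.
    D⇒Der : ∀ h {i w} → ¬ Rank h i → D (pair i w) → K (Standard w)
    D⇒Der zero    nr d = ⊥-elim (nr tt)
    D⇒Der (suc h) {i} {w} nr d = D-elim d >>= λ { (c , m , v) → from-clause m v }
      where
      from-horn : ∀ H → (∀ s → All (λ b → Der clause (fill b s)) (Horn.body H) → Der clause (fill (Horn.head H) s)) →
        Inverted (pair i w) (timed H) → K (Standard w)
      from-horn (horn {n} hd bs) mk (inv σ e g b f) =
        K-Fin vars-std >>= λ vs →
        K-All bs (bodies-std vs) >>= λ ds →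
        ret (fill hd (proj₁ ∘ vs) , ≈-trans (pair-inj₂ e) (σ-fill vs hd) , mk (proj₁ ∘ vs) ds)
        where
        nr' : ¬ Rank h (σ v1)
        nr' r = nr (σ v1 , ∈-congʳ (≈-sym (pair-inj₁ e)) g , r)
        Var : Fin n → Set
        Var k = Σ Tm λ t → σ (suc (suc k)) ≈ ⌈ t ⌉
        tree-arg : ∀ {x} → Standard (pair ∅ x) → Σ Tm λ t → x ≈ ⌈ t ⌉
        tree-arg (leaf , q , _)     = ⊥-elim (pair≉∅ q)
        tree-arg (node a b , q , _) = b , pair-inj₂ q
        vars-std : ∀ k → K (Var k)
        vars-std k = D⇒Der h nr' (b (∈-++⁺ʳ (map _ bs) (∈-map⁺ (λ i → ν v1 · ◦ · ν (suc (suc i))) (∈-allFin k))))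
          >>= λ st → ret (tree-arg st)
        σ-fill : (vs : ∀ k → Var k) → ∀ p → eval (renP (s2 id) p) σ ≈ ⌈ fill p (proj₁ ∘ vs) ⌉
        σ-fill vs p = ≈-trans (≡⇒≈ (eval-ren (s2 id) p σ))
          (≈-trans (eval-cong p (proj₂ ∘ vs)) (≡⇒≈ (eval-fill p (proj₁ ∘ vs))))
        bodies-std : (vs : ∀ k → Var k) → ∀ {p} → p ∈ bs → K (Der clause (fill p (proj₁ ∘ vs)))
        bodies-std vs {p} l = D⇒Der h nr' (b (∈-++⁺ˡ (∈-map⁺ (λ b → ν v1 · renP (s2 id) b) l))) >>= λ
          { (t , q , d) → ret (subst (Der clause) (⌈⌉-inj t _ (≈-trans (≈-sym q) (σ-fill vs p))) d) }
      from-clause : ∀ {c} → c ∈ prog → Inverted (pair i w) c → K (Standard w)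
      from-clause (here refl) v = from-horn tm-leaf (λ s _ → tm leaf) v
      from-clause (there (here refl)) v = from-horn tm-node (λ s _ → tm _) v
      from-clause (there (there m)) v with ∈-map⁻ timed m
      ... | H , m' , refl with ∈-map⁻ clause m'
      ...   | r , _ , refl = from-horn (clause r) (by r) v

-- The calculus as a set of Horn clauses

data D₀ : F → Set where
  mem : ∀ x y → D₀ (mem x y)
  eq  : ∀ x y → D₀ (eq x y)
  bot : D₀ bot
  _⊃_ : ∀ {φ ψ} → D₀ φ → D₀ ψ → D₀ (φ ⊃ ψ)
  ball : ∀ y {φ} → D₀ φ → D₀ (all (mem 0 (suc y) ⊃ φ))

conj : F → F → F
conj φ ψ = neg (φ ⊃ neg ψ)

-- U (suc n) consists of the conjunctions of formulas ∀x₁…∀xₖ ¬u with u in U n.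
data U : ℕ → Set where
  base : ∀ φ → D₀ φ → U 0
  stop : ∀ {n} → U n → U (suc n)
  uall : ∀ {n} → U (suc n) → U (suc n)
  both : ∀ {n} → U (suc n) → U (suc n) → U (suc n)

er : ∀ {n} → U n → F
er (base φ _) = φ
er (stop u)   = neg (er u)
er (uall u)   = all (er u)
er (both u v) = conj (er u) (er v)

-- This codes the shape: truth is evaluated along it by `peelJ`, while provability speaks of the
-- code of `er u`, and `erJ` links the two.
codeU : ∀ {n} → U n → Tm
codeU (base φ _) = code φ
codeU (stop u)   = node (num 0) (codeU u)
codeU (uall u)   = node (num 1) (codeU u)
codeU (both u v) = node (num 2) (node (codeU u) (codeU v))

-- The renamings that the calculus generates; unlike arbitrary functions they are finite data and
-- have codes.
data Rn : Set where
  wkR  : Rn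
  insR : ℕ → Rn
  liR  : Rn → Rn

⟦_⟧ᴿ : Rn → ℕ → ℕ
⟦ wkR ⟧ᴿ    = suc
⟦ insR x ⟧ᴿ = x ▸ id
⟦ liR r ⟧ᴿ  = lift ⟦ r ⟧ᴿ

codeR : Rn → Tm
codeR wkR      = leaf
codeR (insR x) = node leaf (num x)
codeR (liR r)  = node (num 1) (codeR r)

decodeR : Tm → ℕ → ℕ
decodeR leaf                = suc
decodeR (node leaf x)       = unnum x ▸ id
decodeR (node (node _ _) r) = lift (decodeR r)

module _ {n : ℕ} where
  sucP : Pat n → Pat n
  sucP x = ◦ · x
  tag : ℕ → Pat n → Pat n
  tag k x = lit (num k) · x
  memP eqP impP conjP andU : Pat n → Pat n → Pat n
  memP x y = tag 0 (x · y)
  eqP x y  = tag 1 (x · y)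
  impP a b = tag 2 (a · b)
  allP negP stopU allU : Pat n → Pat n
  allP a = tag 3 a
  negP a = impP a ◦
  conjP a b = negP (impP a (negP b))
  stopU s  = tag 0 s
  allU s   = tag 1 s
  andU s r = tag 2 (s · r)
  wkP : Pat n
  wkP = ◦
  insP liP : Pat n → Pat n
  insP x = ◦ · x
  liP r  = tag 1 r
  -- Tags of judgements start at 1, because `◦ · t` is the tree judgement.
  natJ provJ D₀J : Pat n → Pat n
  natJ x  = tag 1 x
  provJ a = tag 4 a
  D₀J a   = tag 5 a
  varJ renJ erJ hypJ : Pat n → Pat n → Pat n → Pat n
  varJ r x y = tag 2 (r · x · y)
  renJ r a b = tag 3 (r · a · b)
  erJ k s a  = tag 6 (k · s · a)
  hypJ k s c = tag 7 (k · s · c)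

  v4 : Fin (suc (suc (suc (suc (suc n)))))
  v4 = suc v3

data Rule : Set where
  nat-0 nat-s var-w var-i0 var-is var-l0 var-ls : Rule
  ren-mem ren-eq ren-bot ren-imp ren-all : Rule
  pr-K pr-S pr-DN pr-mp pr-gen pr-dist pr-inst pr-refl pr-sub : Rule
  d-mem d-eq d-bot d-imp d-ball : Rule
  er-0 er-stop er-all er-both hyp-er : Rule

a b c d e : ∀ {n} → Pat (suc (suc (suc (suc (suc n)))))
a = ν v0
b = ν v1
c = ν v2
d = ν v3
e = ν v4

-- The provability rules carry no well-formedness premises: `decode` reads every tree as a formula.
syn : Rule → Horn
syn r = horn {5} (proj₁ (clause r)) (proj₂ (clause r))
  where
  clause : Rule → Pat 5 × List (Pat 5)
  clause nat-0   = natJ ◦ , []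
  clause nat-s   = natJ (sucP a) , natJ a ∷ []
  clause var-w   = varJ wkP a (sucP a) , []
  clause var-i0  = varJ (insP a) ◦ a , []
  clause var-is  = varJ (insP a) (sucP b) b , []
  clause var-l0  = varJ (liP a) ◦ ◦ , []
  clause var-ls  = varJ (liP a) (sucP b) (sucP c) , varJ a b c ∷ []
  clause ren-mem = renJ a (memP b c) (memP d e) , varJ a b d ∷ varJ a c e ∷ []
  clause ren-eq  = renJ a (eqP b c) (eqP d e) , varJ a b d ∷ varJ a c e ∷ []
  clause ren-bot = renJ a ◦ ◦ , []
  clause ren-imp = renJ a (impP b c) (impP d e) , renJ a b d ∷ renJ a c e ∷ []
  clause ren-all = renJ a (allP b) (allP c) , renJ (liP a) b c ∷ []
  clause pr-K    = provJ (impP a (impP b a)) , []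
  clause pr-S    = provJ (impP (impP a (impP b c)) (impP (impP a b) (impP a c))) , []
  clause pr-DN   = provJ (impP (negP (negP a)) a) , []
  clause pr-mp   = provJ b , provJ (impP a b) ∷ provJ a ∷ []
  clause pr-gen  = provJ (allP a) , provJ a ∷ []
  clause pr-dist = provJ (impP (allP (impP c b)) (impP a (allP b))) , renJ wkP a c ∷ []
  clause pr-inst = provJ (impP (allP a) b) , renJ (insP c) a b ∷ []
  clause pr-refl = provJ (eqP a a) , []
  clause pr-sub  = provJ (impP (eqP a b) (impP d e)) , renJ (insP a) c d ∷ renJ (insP b) c e ∷ []
  -- Numerals are checked here, because truth is analysed only for genuine codes `code φ`, whereas
  -- provability tolerates any tree.
  clause d-mem   = D₀J (memP a b) , natJ a ∷ natJ b ∷ []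
  clause d-eq    = D₀J (eqP a b) , natJ a ∷ natJ b ∷ []
  clause d-bot   = D₀J ◦ , []
  clause d-imp   = D₀J (impP a b) , D₀J a ∷ D₀J b ∷ []
  clause d-ball  = D₀J (allP (impP (memP ◦ (sucP a)) b)) , natJ a ∷ D₀J b ∷ []
  clause er-0    = erJ ◦ a a , D₀J a ∷ []
  clause er-stop = erJ (sucP a) (stopU b) (negP c) , erJ a b c ∷ []
  clause er-all  = erJ (sucP a) (allU b) (allP c) , erJ (sucP a) b c ∷ []
  clause er-both = erJ (sucP a) (andU b c) (conjP d e) , erJ (sucP a) b d ∷ erJ (sucP a) c e ∷ []
  clause hyp-er  = hypJ a b c , erJ a b d ∷ provJ (impP d c) ∷ []

rules : List Rule
rules = nat-0 ∷ nat-s ∷ var-w ∷ var-i0 ∷ var-is ∷ var-l0 ∷ var-ls ∷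
  ren-mem ∷ ren-eq ∷ ren-bot ∷ ren-imp ∷ ren-all ∷
  pr-K ∷ pr-S ∷ pr-DN ∷ pr-mp ∷ pr-gen ∷ pr-dist ∷ pr-inst ∷ pr-refl ∷ pr-sub ∷
  d-mem ∷ d-eq ∷ d-bot ∷ d-imp ∷ d-ball ∷ er-0 ∷ er-stop ∷ er-all ∷ er-both ∷ hyp-er ∷ []

position : Rule → ℕ
position = λ
  { nat-0 → 0 ; nat-s → 1 ; var-w → 2 ; var-i0 → 3 ; var-is → 4 ; var-l0 → 5 ; var-ls → 6
  ; ren-mem → 7 ; ren-eq → 8 ; ren-bot → 9 ; ren-imp → 10 ; ren-all → 11
  ; pr-K → 12 ; pr-S → 13 ; pr-DN → 14 ; pr-mp → 15 ; pr-gen → 16 ; pr-dist → 17 ; pr-inst → 18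
  ; pr-refl → 19 ; pr-sub → 20 ; d-mem → 21 ; d-eq → 22 ; d-bot → 23 ; d-imp → 24 ; d-ball → 25
  ; er-0 → 26 ; er-stop → 27 ; er-all → 28 ; er-both → 29 ; hyp-er → 30 }

At : ℕ → List Rule → Rule → Set
At n       []       r = ⊥
At zero    (x ∷ xs) r = r ≡ x
At (suc n) (x ∷ xs) r = At n xs r

At-∈ : ∀ n xs {r} → At n xs r → r ∈ xs
At-∈ zero    (x ∷ xs) p = here p
At-∈ (suc n) (x ∷ xs) p = there (At-∈ n xs p)

rules-complete : ∀ r → r ∈ rules
rules-complete r = At-∈ (position r) rules (at r)
  where
  at : ∀ r → At (position r) rules r
  at = λ
    { nat-0 → refl ; nat-s → refl ; var-w → refl ; var-i0 → refl ; var-is → refl ; var-l0 → refl ; var-ls → refl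
    ; ren-mem → refl ; ren-eq → refl ; ren-bot → refl ; ren-imp → refl ; ren-all → refl
    ; pr-K → refl ; pr-S → refl ; pr-DN → refl ; pr-mp → refl ; pr-gen → refl ; pr-dist → refl ; pr-inst → refl
    ; pr-refl → refl ; pr-sub → refl ; d-mem → refl ; d-eq → refl ; d-bot → refl ; d-imp → refl ; d-ball → refl
    ; er-0 → refl ; er-stop → refl ; er-all → refl ; er-both → refl ; hyp-er → refl }

-- Soundness and completeness of the coded rules

vec : Tm → Tm → Tm → Tm → Tm → Fin 5 → Tm
vec t₀ t₁ t₂ t₃ t₄ = t₀ ▹ t₁ ▹ t₂ ▹ t₃ ▹ t₄ ▹ none

Meaning : Tm → Set
Judgement : ℕ → Tm → Set
Meaning leaf       = ⊤
Meaning (node k t) = Judgement (unnum k) t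
Judgement 1 x = Σ ℕ λ n → x ≡ num n
Judgement 2 (node r (node x y)) = decodeR r (unnum x) ≡ unnum y
Judgement 3 (node r (node a b)) = decode b ≡ ren (decodeR r) (decode a)
Judgement 4 a = Thm (decode a)
Judgement 5 a = Σ F λ φ → D₀ φ × a ≡ code φ
Judgement 6 (node k (node s a)) = Σ ℕ λ n → k ≡ num n × Σ (U n) λ u → s ≡ codeU u × decode a ≡ er u
Judgement 7 (node k (node s c)) = Σ ℕ λ n → k ≡ num n × Σ (U n) λ u → s ≡ codeU u × Thm (er u ⊃ decode c)
Judgement _ _ = ⊤

num-suc : ∀ {t} n → node leaf t ≡ num n → Σ ℕ λ m → n ≡ suc m × t ≡ num m
num-suc (suc m) refl = m , refl , refl

meaning : ∀ {t} → Der syn t → Meaning t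
meaning (tm t) = tt
meaning (by nat-0 s []) = 0 , refl
meaning (by nat-s s (p ∷ [])) with meaning p
... | n , e = suc n , cong (node leaf) e
meaning (by var-w s []) = refl
meaning (by var-i0 s []) = refl
meaning (by var-is s []) = refl
meaning (by var-l0 s []) = refl
meaning (by var-ls s (p ∷ [])) = cong suc (meaning p)
meaning (by ren-mem s (p ∷ q ∷ [])) = cong₂ mem (sym (meaning p)) (sym (meaning q))
meaning (by ren-eq s (p ∷ q ∷ [])) = cong₂ eq (sym (meaning p)) (sym (meaning q))
meaning (by ren-bot s []) = refl
meaning (by ren-imp s (p ∷ q ∷ [])) = cong₂ _⊃_ (meaning p) (meaning q)
meaning (by ren-all s (p ∷ [])) = cong all (meaning p)
meaning (by pr-K s []) = axK
meaning (by pr-S s []) = axS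
meaning (by pr-DN s []) = axDN
meaning (by pr-mp s (p ∷ q ∷ [])) = mp (meaning p) (meaning q)
meaning (by pr-gen s (p ∷ [])) = gen (meaning p)
meaning (by pr-dist s (p ∷ [])) =
  subst (λ χ → Thm (all (χ ⊃ decode (s v1)) ⊃ decode (s v0) ⊃ all (decode (s v1)))) (sym (meaning p)) axDist
meaning (by pr-inst s (p ∷ [])) = subst (λ χ → Thm (all (decode (s v0)) ⊃ χ)) (sym (meaning p)) (axInst _ _)
meaning (by pr-refl s []) = axRefl _
meaning (by pr-sub s (p ∷ q ∷ [])) = subst₂ (λ χ χ' → Thm (eq (unnum (s v0)) (unnum (s v1)) ⊃ χ ⊃ χ'))
  (sym (meaning p)) (sym (meaning q)) (axSub (decode (s v2)) _ _)
meaning (by d-mem s (p ∷ q ∷ [])) with meaning p | meaning q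
... | x , e | y , e' = mem x y , mem x y , cong₂ (λ s t → node (num 0) (node s t)) e e'
meaning (by d-eq s (p ∷ q ∷ [])) with meaning p | meaning q
... | x , e | y , e' = eq x y , eq x y , cong₂ (λ s t → node (num 1) (node s t)) e e'
meaning (by d-bot s []) = bot , bot , refl
meaning (by d-imp s (p ∷ q ∷ [])) with meaning p | meaning q
... | φ , d , e | ψ , d' , e' = φ ⊃ ψ , d ⊃ d' , cong₂ (λ s t → node (num 2) (node s t)) e e'
meaning (by d-ball s (p ∷ q ∷ [])) with meaning p | meaning q
... | y , e | φ , d , e' = all (mem 0 (suc y) ⊃ φ) , ball y d ,
  cong₂ (λ s t → node (num 3) (node (num 2) (node (node (num 0) (node leaf (node leaf s))) t))) e e'
meaning (by er-0 s (p ∷ [])) with meaning p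
... | φ , d , e = 0 , refl , base φ d , e , trans (cong decode e) (decode-code φ)
meaning (by er-stop s (p ∷ [])) with meaning p
... | n , e , u , e' , e'' = suc n , cong (node leaf) e , stop u , cong (node (num 0)) e' , cong neg e''
meaning (by er-all s (p ∷ [])) with meaning p
... | n , e , u , e' , e'' with num-suc n e
...   | m , refl , _ = suc m , e , uall u , cong (node (num 1)) e' , cong all e''
meaning (by er-both s (p ∷ q ∷ [])) with meaning p | meaning q
... | n , e , u , e' , e'' | n₁ , e₁ , u₁ , e₁' , e₁'' with num-suc n e | num-suc n₁ e₁
...   | m , refl , f | m₁ , refl , f₁ with num-inj m m₁ (trans (sym f) f₁)
  where
  num-inj : ∀ m n → num m ≡ num n → m ≡ n
  num-inj m n e = trans (sym (unnum-num m)) (trans (cong unnum e) (unnum-num n))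
...     | refl = suc m , e , both u u₁ , cong₂ (λ s t → node (num 2) (node s t)) e' e₁' , cong₂ conj e'' e₁''
meaning (by hyp-er s (p ∷ q ∷ [])) with meaning p
... | n , e , u , e' , e'' = n , e , u , e' , subst (λ χ → Thm (χ ⊃ decode (s v2))) e'' (meaning q)

var-der : ∀ r n → Der syn (node (num 2) (node (codeR r) (node (num n) (num (⟦ r ⟧ᴿ n)))))
var-der wkR      n       = by var-w (vec (num n) leaf leaf leaf leaf) []
var-der (insR x) zero    = by var-i0 (vec (num x) leaf leaf leaf leaf) []
var-der (insR x) (suc n) = by var-is (vec (num x) (num n) leaf leaf leaf) []
var-der (liR r)  zero    = by var-l0 (vec (codeR r) leaf leaf leaf leaf) []
var-der (liR r)  (suc n) = by var-ls (vec (codeR r) (num n) (num (⟦ r ⟧ᴿ n)) leaf leaf) (var-der r n ∷ [])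

ren-der : ∀ r φ → Der syn (node (num 3) (node (codeR r) (node (code φ) (code (ren ⟦ r ⟧ᴿ φ)))))
ren-der r (mem x y) = by ren-mem (vec (codeR r) (num x) (num y) (num (⟦ r ⟧ᴿ x)) (num (⟦ r ⟧ᴿ y)))
  (var-der r x ∷ var-der r y ∷ [])
ren-der r (eq x y)  = by ren-eq (vec (codeR r) (num x) (num y) (num (⟦ r ⟧ᴿ x)) (num (⟦ r ⟧ᴿ y)))
  (var-der r x ∷ var-der r y ∷ [])
ren-der r bot       = by ren-bot (vec (codeR r) leaf leaf leaf leaf) []
ren-der r (φ ⊃ ψ)   = by ren-imp (vec (codeR r) (code φ) (code ψ) (code (ren ⟦ r ⟧ᴿ φ)) (code (ren ⟦ r ⟧ᴿ ψ)))
  (ren-der r φ ∷ ren-der r ψ ∷ [])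
ren-der r (all φ)   = by ren-all (vec (codeR r) (code φ) (code (ren (lift ⟦ r ⟧ᴿ) φ)) leaf leaf) (ren-der (liR r) φ ∷ [])

prov-der : ∀ {φ} → Thm φ → Der syn (node (num 4) (code φ))
prov-der (axK {φ} {ψ}) = by pr-K (vec (code φ) (code ψ) leaf leaf leaf) []
prov-der (axS {φ} {ψ} {χ}) = by pr-S (vec (code φ) (code ψ) (code χ) leaf leaf) []
prov-der (axDN {φ}) = by pr-DN (vec (code φ) leaf leaf leaf leaf) []
prov-der (mp {φ} {ψ} p q) = by pr-mp (vec (code φ) (code ψ) leaf leaf leaf) (prov-der p ∷ prov-der q ∷ [])
prov-der (gen {φ} p) = by pr-gen (vec (code φ) leaf leaf leaf leaf) (prov-der p ∷ [])
prov-der (axDist {φ} {ψ}) = by pr-dist (vec (code φ) (code ψ) (code (ren suc φ)) leaf leaf) (ren-der wkR φ ∷ [])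
prov-der (axInst φ x) = by pr-inst (vec (code φ) (code (φ ⟨ x ⟩)) (num x) leaf leaf) (ren-der (insR x) φ ∷ [])
prov-der (axRefl x) = by pr-refl (vec (num x) leaf leaf leaf leaf) []
prov-der (axSub φ x y) = by pr-sub (vec (num x) (num y) (code φ) (code (φ ⟨ x ⟩)) (code (φ ⟨ y ⟩)))
  (ren-der (insR x) φ ∷ ren-der (insR y) φ ∷ [])

nat-der : ∀ n → Der syn (node (num 1) (num n))
nat-der zero    = by nat-0 (vec leaf leaf leaf leaf leaf) []
nat-der (suc n) = by nat-s (vec (num n) leaf leaf leaf leaf) (nat-der n ∷ [])

D₀-der : ∀ {φ} → D₀ φ → Der syn (node (num 5) (code φ))
D₀-der (mem x y) = by d-mem (vec (num x) (num y) leaf leaf leaf) (nat-der x ∷ nat-der y ∷ [])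
D₀-der (eq x y)  = by d-eq (vec (num x) (num y) leaf leaf leaf) (nat-der x ∷ nat-der y ∷ [])
D₀-der bot       = by d-bot (vec leaf leaf leaf leaf leaf) []
D₀-der (_⊃_ {φ} {ψ} d d') = by d-imp (vec (code φ) (code ψ) leaf leaf leaf) (D₀-der d ∷ D₀-der d' ∷ [])
D₀-der (ball y {φ} d) = by d-ball (vec (num y) (code φ) leaf leaf leaf) (nat-der y ∷ D₀-der d ∷ [])

er-der : ∀ {n} (u : U n) → Der syn (node (num 6) (node (num n) (node (codeU u) (code (er u)))))
er-der (base φ d) = by er-0 (vec (code φ) leaf leaf leaf leaf) (D₀-der d ∷ [])
er-der {suc n} (stop u) = by er-stop (vec (num n) (codeU u) (code (er u)) leaf leaf) (er-der u ∷ [])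
er-der {suc n} (uall u) = by er-all (vec (num n) (codeU u) (code (er u)) leaf leaf) (er-der u ∷ [])
er-der {suc n} (both u v) = by er-both (vec (num n) (codeU u) (codeU v) (code (er u)) (code (er v)))
  (er-der u ∷ er-der v ∷ [])

hyp-der : ∀ {n} (u : U n) φ → Thm (er u ⊃ φ) → Der syn (node (num 7) (node (num n) (node (codeU u) (code φ))))
hyp-der {n} u φ p = by hyp-er (vec (num n) (codeU u) (code φ) (code (er u)) leaf) (er-der u ∷ prov-der p ∷ [])

-- Partial truth predicates

module _ {n : ℕ} where
  lookJ : Pat n → Pat n → Pat n → Pat n
  lookJ i e x = tag 1 (i · e · x)
  -- Falsity is a judgement of its own because clauses are positive: a premise can demand a
  -- derivation but not its absence.
  trueJ falseJ ballP : Pat n → Pat n → Pat n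
  trueJ a e  = tag 2 (a · e)
  falseJ a e = tag 3 (a · e)
  ballP y a  = allP (impP (memP ◦ (sucP y)) a)
  -- Peeling chooses a value at each universal quantifier and a side at each conjunction until a
  -- `stop` is reached; `s'` and `e'` are the negated shape found there and its stack.
  peelJ : Pat n → Pat n → Pat n → Pat n → Pat n
  peelJ s e s' e' = tag 4 (s · e · s' · e')

-- Judgements about assignments, which are stacks ⟨x₀ , ⟨x₁ , … ∅⟩⟩; all variables beyond the stack denote ∅.
satProg : List Clause
satProg =
    plain (lookJ ◦ (a · b) a) []
  ∷ plain (lookJ (sucP a) (b · c) d) (lookJ a c d ∷ [])
  ∷ plain (lookJ a ◦ ◦) []
  ∷ rule {5} (trueJ (memP a b) c) (v3 ∈' v4) (∈-Δ₀ _ _) (lookJ a c d ∷ lookJ b c e ∷ []) []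
  ∷ rule {5} (falseJ (memP a b) c) (¬' (v3 ∈' v4)) (¬-Δ₀ (∈-Δ₀ _ _)) (lookJ a c d ∷ lookJ b c e ∷ []) []
  ∷ rule {5} (trueJ (eqP a b) c) (v3 ≐ v4) (≐-Δ₀ _ _) (lookJ a c d ∷ lookJ b c e ∷ []) []
  ∷ rule {5} (falseJ (eqP a b) c) (¬' (v3 ≐ v4)) (¬-Δ₀ (≐-Δ₀ _ _)) (lookJ a c d ∷ lookJ b c e ∷ []) []
  ∷ plain (falseJ ◦ a) []
  ∷ plain (trueJ (impP a b) c) (falseJ a c ∷ [])
  ∷ plain (trueJ (impP a b) c) (trueJ b c ∷ [])
  ∷ plain (falseJ (impP a b) c) (trueJ a c ∷ falseJ b c ∷ [])
  -- In the family, variable 0 is the element of `v3`, so its `c` and `d` are the `b` and `c` of the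
  -- head.
  ∷ rule {5} (trueJ (ballP a b) c) (¬' ⊥') (¬-Δ₀ ⊥-Δ₀) (lookJ a c d ∷ []) ((v3 , trueJ c (a · d)) ∷ [])
  ∷ rule {5} (falseJ (ballP a b) c) (v4 ∈' v3) (∈-Δ₀ _ _) (lookJ a c d ∷ falseJ b (e · c) ∷ []) []
  ∷ plain (peelJ (stopU a) b a b) []
  ∷ plain (peelJ (allU a) b c d) (peelJ a (e · b) c d ∷ [])
  ∷ plain (peelJ (andU a b) c d e) (peelJ a c d e ∷ [])
  ∷ plain (peelJ (andU a b) c d e) (peelJ b c d e ∷ [])
  ∷ []
  where
  plain : Pat 5 → List (Pat 5) → Clause
  plain h bs = rule h (¬' ⊥') (¬-Δ₀ ⊥-Δ₀) bs []

module KPSatisfaction (T : Theory) (kp : ∀ φ → KP φ → T ⊩ φ) (𝔐 : Model ⟪ T ⟫) where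
  open KPDerivations T kp 𝔐 public
  module S = Inversion satProg
  open S using (D-cong; D-stable; invert; case)

  args : M → M → M → M → M → Fin 5 → M
  args x₀ x₁ x₂ x₃ x₄ = x₀ ▹ x₁ ▹ x₂ ▹ x₃ ▹ x₄ ▹ none

  Look : M → M → M → Set
  Look i e x = S.D (eval {5} (lookJ a b c) (args i e x ∅ ∅))
  True False : M → M → Set
  True s e  = S.D (eval {5} (trueJ a b) (args s e ∅ ∅ ∅))
  False s e = S.D (eval {5} (falseJ a b) (args s e ∅ ∅ ∅))
  Peel : M → M → M → M → Set
  Peel s e s' e' = S.D (eval {5} (peelJ a b c d) (args s e s' e' ∅))

  args-cong : ∀ {x₀ x₁ x₂ x₃ x₄ y₀ y₁ y₂ y₃ y₄} → x₀ ≈ y₀ → x₁ ≈ y₁ → x₂ ≈ y₂ → x₃ ≈ y₃ → x₄ ≈ y₄ →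
    ∀ i → args x₀ x₁ x₂ x₃ x₄ i ≈ args y₀ y₁ y₂ y₃ y₄ i
  args-cong p q r s t = ▹-cong p (▹-cong q (▹-cong r (▹-cong s (▹-cong t λ ()))))

  Look-cong : ∀ {i i' e e' x x'} → i ≈ i' → e ≈ e' → x ≈ x' → Look i e x → Look i' e' x'
  Look-cong p q r = D-cong (eval-cong {5} (lookJ a b c) (args-cong p q r (≈-refl {∅}) (≈-refl {∅})))

  True-cong : ∀ {s s' e e'} → s ≈ s' → e ≈ e' → True s e → True s' e'
  True-cong p q = D-cong (eval-cong {5} (trueJ a b) (args-cong p q (≈-refl {∅}) (≈-refl {∅}) (≈-refl {∅})))

  False-cong : ∀ {s s' e e'} → s ≈ s' → e ≈ e' → False s e → False s' e'
  False-cong p q = D-cong (eval-cong {5} (falseJ a b) (args-cong p q (≈-refl {∅}) (≈-refl {∅}) (≈-refl {∅})))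

  Peel-cong : ∀ {s s' e e' t t' f f'} → s ≈ s' → e ≈ e' → t ≈ t' → f ≈ f' → Peel s e t f → Peel s' e' t' f'
  Peel-cong p q r s = D-cong (eval-cong {5} (peelJ a b c d) (args-cong p q r s (≈-refl {∅})))

  stk : List M → M
  stk []      = ∅
  stk (x ∷ l) = pair x (stk l)

  env : List M → ℕ → M
  env []      = λ _ → ∅
  env (x ∷ l) = x ▸ env l

  Look-env : ∀ n l {x} → Look ⌈ num n ⌉ (stk l) x → x ≈ env l n
  Look-env zero [] {x} d₀ = stable≈ (invert {5} (lookJ ◦ ◦ a) (args x ∅ ∅ ∅ ∅) d₀ >>= λ
    { (inj₁ (case σ (_ , _ , _ , q) _ _ _)) → ret q })
  Look-env zero (y ∷ l) {x} d₀ = stable≈ (invert {5} (lookJ ◦ (a · b) c) (args y (stk l) x ∅ ∅) d₀ >>= λ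
    { (inj₁ (case σ (_ , _ , (p , _) , q) _ _ _)) → ret (≈-trans q (≈-sym p)) })
  Look-env (suc n) [] {x} d₀ = stable≈ (invert {5} (lookJ (sucP a) ◦ b) (args ⌈ num n ⌉ x ∅ ∅ ∅) d₀ >>= λ
    { (inj₁ (case σ (_ , _ , _ , q) _ _ _)) → ret q })
  Look-env (suc n) (y ∷ l) {x} d₀ = stable≈
    (invert {5} (lookJ (sucP a) (b · c) d) (args ⌈ num n ⌉ y (stk l) x ∅) d₀ >>= λ
    { (inj₁ (case σ (_ , (_ , p) , (_ , q) , r) _ (d₁ ∷ []) _)) →
        ret (Look-env n l (Look-cong (≈-sym p) (≈-sym q) (≈-sym r) d₁)) })

  intro : ∀ i (σ : Fin (arity (lookup satProg i)) → M) → Sat (guard (lookup satProg i)) σ →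
    All (λ b → S.D (eval b σ)) (body (lookup satProg i)) →
    All (λ (y , b) → ∀ a → a ∈ₘ σ y → S.D (eval b (a ▹ σ))) (family (lookup satProg i)) →
    S.D (eval (head (lookup satProg i)) σ)
  intro i σ g bs fs = S.D-intro (∈-lookup {xs = satProg} i) σ g (All-lookup bs) (All-lookup fs)

  Look-intro : ∀ n l → Look ⌈ num n ⌉ (stk l) (env l n)
  Look-intro n       []      = intro (# 2) (args ⌈ num n ⌉ ∅ ∅ ∅ ∅) id [] []
  Look-intro zero    (x ∷ l) = intro (# 0) (args x (stk l) ∅ ∅ ∅) id [] []
  Look-intro (suc n) (x ∷ l) = intro (# 1) (args ⌈ num n ⌉ x (stk l) (env l n) ∅) id (Look-intro n l ∷ []) []

  -- Induction on the external formula; each case looks only one step into the derivation, which may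
  -- be ill-founded.
  True-⟦⟧ : ∀ {φ} → D₀ φ → ∀ l → True ⌈ code φ ⌉ (stk l) → ⟦ φ ⟧ (env l)
  False-⟦⟧ : ∀ {φ} → D₀ φ → ∀ l → False ⌈ code φ ⌉ (stk l) → ¬ ⟦ φ ⟧ (env l)
  True-⟦⟧ (mem x y) l d₀ = stable∈ (invert {5} (trueJ (memP a b) c) (args ⌈ num x ⌉ ⌈ num y ⌉ (stk l) ∅ ∅) d₀ >>= λ
    { (inj₁ (case σ (_ , (_ , p , q) , r) g (d₁ ∷ d₂ ∷ []) _)) → ret (∈-cong
        (Look-env x l (Look-cong (≈-sym p) (≈-sym r) ≈-refl d₁))
        (Look-env y l (Look-cong (≈-sym q) (≈-sym r) ≈-refl d₂)) g) })
  True-⟦⟧ (eq x y) l d₀ = stable≈ (invert {5} (trueJ (eqP a b) c) (args ⌈ num x ⌉ ⌈ num y ⌉ (stk l) ∅ ∅) d₀ >>= λ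
    { (inj₁ (case σ (_ , (_ , p , q) , r) g (d₁ ∷ d₂ ∷ []) _)) → ret (≈-trans (≈-sym
        (Look-env x l (Look-cong (≈-sym p) (≈-sym r) ≈-refl d₁)))
        (≈-trans g (Look-env y l (Look-cong (≈-sym q) (≈-sym r) ≈-refl d₂)))) })
  True-⟦⟧ bot l d₀ = invert {5} (trueJ ◦ a) (args (stk l) ∅ ∅ ∅ ∅) d₀ λ ()
  True-⟦⟧ (_⊃_ {φ} {ψ} h k) l d₀ s = ⟦⟧-stable ψ (env l)
    (invert {5} (trueJ (impP a b) c) (args ⌈ code φ ⌉ ⌈ code ψ ⌉ (stk l) ∅ ∅) d₀ >>= λ
    { (inj₁ (case σ (_ , (_ , p , q) , r) g (d₁ ∷ []) _)) →
        ⊥-elim (False-⟦⟧ h l (False-cong (≈-sym p) (≈-sym r) d₁) s)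
    ; (inj₂ (inj₁ (case σ (_ , (_ , p , q) , r) g (d₁ ∷ []) _))) →
        ret (True-⟦⟧ k l (True-cong (≈-sym q) (≈-sym r) d₁)) })
  True-⟦⟧ (ball y {φ} h) l d₀ z i = ⟦⟧-stable φ (z ▸ env l)
    (invert {5} (trueJ (ballP a b) c) (args ⌈ num y ⌉ ⌈ code φ ⌉ (stk l) ∅ ∅) d₀ >>= λ
    { (inj₁ (case σ un g (d₁ ∷ []) (f ∷ []))) → let _ , (_ , _ , (_ , _ , (_ , p)) , q) , r = un in
        ret (True-⟦⟧ h (z ∷ l) (True-cong (≈-sym q) (pair-cong ≈-refl (≈-sym r))
          (f z (∈-congʳ (≈-sym (Look-env y l (Look-cong (≈-sym p) (≈-sym r) ≈-refl d₁))) i)))) })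
  False-⟦⟧ (mem x y) l d₀ s = invert {5} (falseJ (memP a b) c) (args ⌈ num x ⌉ ⌈ num y ⌉ (stk l) ∅ ∅) d₀ λ
    { (inj₁ (case σ (_ , (_ , p , q) , r) g (d₁ ∷ d₂ ∷ []) _)) → g (∈-cong
        (≈-sym (Look-env x l (Look-cong (≈-sym p) (≈-sym r) ≈-refl d₁)))
        (≈-sym (Look-env y l (Look-cong (≈-sym q) (≈-sym r) ≈-refl d₂))) s) }
  False-⟦⟧ (eq x y) l d₀ s = invert {5} (falseJ (eqP a b) c) (args ⌈ num x ⌉ ⌈ num y ⌉ (stk l) ∅ ∅) d₀ λ
    { (inj₁ (case σ (_ , (_ , p , q) , r) g (d₁ ∷ d₂ ∷ []) _)) → g (≈-trans
        (Look-env x l (Look-cong (≈-sym p) (≈-sym r) ≈-refl d₁))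
        (≈-trans s (≈-sym (Look-env y l (Look-cong (≈-sym q) (≈-sym r) ≈-refl d₂))))) }
  False-⟦⟧ bot l d₀ s = s
  False-⟦⟧ (_⊃_ {φ} {ψ} h k) l d₀ s =
    invert {5} (falseJ (impP a b) c) (args ⌈ code φ ⌉ ⌈ code ψ ⌉ (stk l) ∅ ∅) d₀ λ
    { (inj₁ (case σ (_ , (_ , p , q) , r) g (d₁ ∷ d₂ ∷ []) _)) →
        False-⟦⟧ k l (False-cong (≈-sym q) (≈-sym r) d₂) (s (True-⟦⟧ h l (True-cong (≈-sym p) (≈-sym r) d₁))) }
  False-⟦⟧ (ball y {φ} h) l d₀ s =
    invert {5} (falseJ (ballP a b) c) (args ⌈ num y ⌉ ⌈ code φ ⌉ (stk l) ∅ ∅) d₀ λ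
    { (inj₁ (case σ un g (d₁ ∷ d₂ ∷ []) _)) → let _ , (_ , _ , (_ , _ , (_ , p)) , q) , r = un in
        False-⟦⟧ h (σ v4 ∷ l) (False-cong (≈-sym q) (pair-cong ≈-refl (≈-sym r)) d₂)
          (s (σ v4) (∈-congʳ (Look-env y l (Look-cong (≈-sym p) (≈-sym r) ≈-refl d₁)) g)) }

  ⟦⟧-True : ∀ {φ} → D₀ φ → ∀ l → ⟦ φ ⟧ (env l) → True ⌈ code φ ⌉ (stk l)
  ⟦⟧-False : ∀ {φ} → D₀ φ → ∀ l → ¬ ⟦ φ ⟧ (env l) → False ⌈ code φ ⌉ (stk l)
  ⟦⟧-True (mem x y) l s = intro (# 3) (args ⌈ num x ⌉ ⌈ num y ⌉ (stk l) (env l x) (env l y)) s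
    (Look-intro x l ∷ Look-intro y l ∷ []) []
  ⟦⟧-True (eq x y) l s = intro (# 5) (args ⌈ num x ⌉ ⌈ num y ⌉ (stk l) (env l x) (env l y)) s
    (Look-intro x l ∷ Look-intro y l ∷ []) []
  ⟦⟧-True bot l ()
  ⟦⟧-True (_⊃_ {φ} {ψ} h k) l s = D-stable (lem {⟦ φ ⟧ (env l)} >>= λ
    { (inj₁ t) → ret (intro (# 9) (args ⌈ code φ ⌉ ⌈ code ψ ⌉ (stk l) ∅ ∅) id (⟦⟧-True k l (s t) ∷ []) [])
    ; (inj₂ n) → ret (intro (# 8) (args ⌈ code φ ⌉ ⌈ code ψ ⌉ (stk l) ∅ ∅) id (⟦⟧-False h l n ∷ []) []) })
  ⟦⟧-True (ball y {φ} h) l s = intro (# 11) (args ⌈ num y ⌉ ⌈ code φ ⌉ (stk l) (env l y) ∅) id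
    (Look-intro y l ∷ []) ((λ z i → ⟦⟧-True h (z ∷ l) (s z i)) ∷ [])
  ⟦⟧-False (mem x y) l s = intro (# 4) (args ⌈ num x ⌉ ⌈ num y ⌉ (stk l) (env l x) (env l y)) s
    (Look-intro x l ∷ Look-intro y l ∷ []) []
  ⟦⟧-False (eq x y) l s = intro (# 6) (args ⌈ num x ⌉ ⌈ num y ⌉ (stk l) (env l x) (env l y)) s
    (Look-intro x l ∷ Look-intro y l ∷ []) []
  ⟦⟧-False bot l s = intro (# 7) (args (stk l) ∅ ∅ ∅ ∅) id [] []
  ⟦⟧-False (_⊃_ {φ} {ψ} h k) l s = intro (# 10) (args ⌈ code φ ⌉ ⌈ code ψ ⌉ (stk l) ∅ ∅) id
    (⟦⟧-True h l (⟦⟧-stable φ (env l) λ n → s λ t → ⊥-elim (n t)) ∷ ⟦⟧-False k l (λ t → s λ _ → t) ∷ []) []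
  ⟦⟧-False (ball y {φ} h) l s = D-stable λ n → s λ z i → ⟦⟧-stable φ (z ▸ env l) λ m →
    n (intro (# 12) (args ⌈ num y ⌉ ⌈ code φ ⌉ (stk l) (env l y) z) i (Look-intro y l ∷ ⟦⟧-False h (z ∷ l) m ∷ []) [])

  -- At a positive level, everything that peels off must be false one level down. As `m` is
  -- external, the recursion unfolds into one formula `truF m` per level; this is where a bound on
  -- the complexity of the axioms is required.
  Tru : ℕ → M → M → Set
  Tru zero    s e = True s e
  Tru (suc m) s e = ∀ s' e' → Peel s e s' e' → ¬ Tru m s' e'

  Tru-cong : ∀ m {s s' e e'} → s ≈ s' → e ≈ e' → Tru m s e → Tru m s' e'
  Tru-cong zero    p q t = True-cong p q t
  Tru-cong (suc m) p q t = λ s' e' d → t s' e' (Peel-cong (≈-sym p) (≈-sym q) ≈-refl ≈-refl d)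

  truF : ∀ {k} → ℕ → Fin k → Fin k → Formula k
  truF zero    s e = S.judgF {5} (trueJ a b) (s ▹ e ▹ s ▹ s ▹ s ▹ none)
  truF (suc m) s e = ∀' (∀' (S.judgF {5} (peelJ a b c d) (suc (suc s) ▹ suc (suc e) ▹ v1 ▹ v0 ▹ v0 ▹ none) ⇒' ¬' truF m v1 v0))

  truF-to : ∀ m {k} (s e : Fin k) ρ → Sat (truF m s e) ρ → Tru m (ρ s) (ρ e)
  truF-from : ∀ m {k} (s e : Fin k) ρ → Tru m (ρ s) (ρ e) → Sat (truF m s e) ρ
  truF-to zero    s e ρ t = S.judgF-to {5} (trueJ a b) (s ▹ e ▹ s ▹ s ▹ s ▹ none) ρ t
  truF-to (suc m) s e ρ t s' e' d₀ u = t s' e'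
    (S.judgF-from {5} (peelJ a b c d) (suc (suc s) ▹ suc (suc e) ▹ v1 ▹ v0 ▹ v0 ▹ none) (e' ▹ s' ▹ ρ) d₀)
    (truF-from m v1 v0 (e' ▹ s' ▹ ρ) u)
  truF-from zero    s e ρ t = S.judgF-from {5} (trueJ a b) (s ▹ e ▹ s ▹ s ▹ s ▹ none) ρ t
  truF-from (suc m) s e ρ t s' e' d₀ u = t s' e'
    (S.judgF-to {5} (peelJ a b c d) (suc (suc s) ▹ suc (suc e) ▹ v1 ▹ v0 ▹ v0 ▹ none) (e' ▹ s' ▹ ρ) d₀)
    (truF-to m v1 v0 (e' ▹ s' ▹ ρ) u)

  -- `s'` and `e'` range over the whole model, but peeling a standard shape over a stack of standard
  -- length leads only to such shapes and stacks again.
  record Part {m} (u : U (suc m)) (l : List M) (s' e' : M) : Set where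
    constructor part
    field
      u'   : U m
      l'   : List M
      s'≈  : s' ≈ ⌈ codeU u' ⌉
      e'≈  : e' ≈ stk l'
      refutes : ⟦ er u ⟧ (env l) → ¬ ⟦ er u' ⟧ (env l')

  Peel-part : ∀ {m} (u : U (suc m)) l {s' e'} → Peel ⌈ codeU u ⌉ (stk l) s' e' → K (Part u l s' e')
  Peel-part (stop u) l {s'} {e'} d₀ = invert {5} (peelJ (stopU a) b c d) (args ⌈ codeU u ⌉ (stk l) s' e' ∅) d₀ >>= λ
    { (inj₁ (case σ (_ , (_ , p) , q , r , t) g [] _)) →
        ret (part u l (≈-trans r (≈-sym p)) (≈-trans t (≈-sym q)) id) }
  Peel-part (uall u) l {s'} {e'} d₀ = invert {5} (peelJ (allU a) b c d) (args ⌈ codeU u ⌉ (stk l) s' e' ∅) d₀ >>= λ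
    { (inj₁ (case σ (_ , (_ , p) , q , r , t) g (d₁ ∷ []) _)) →
        Peel-part u (σ v4 ∷ l) (Peel-cong (≈-sym p) (pair-cong ≈-refl (≈-sym q)) (≈-sym r) (≈-sym t) d₁) >>= λ
        { (part u' l' x y f) → ret (part u' l' x y λ s → f (s (σ v4))) } }
  Peel-part (both u v) l {s'} {e'} d₀ = invert {5} (peelJ (andU a b) c d e) (args ⌈ codeU u ⌉ ⌈ codeU v ⌉ (stk l) s' e') d₀ >>= λ
    { (inj₁ (case σ (_ , (_ , p , p') , q , r , t) g (d₁ ∷ []) _)) →
        Peel-part u l (Peel-cong (≈-sym p) (≈-sym q) (≈-sym r) (≈-sym t) d₁) >>= λ
        { (part u' l' x y f) → ret (part u' l' x y λ s w → s λ s₁ _ → f s₁ w) }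
    ; (inj₂ (inj₁ (case σ (_ , (_ , p , p') , q , r , t) g (d₁ ∷ []) _))) →
        Peel-part v l (Peel-cong (≈-sym p') (≈-sym q) (≈-sym r) (≈-sym t) d₁) >>= λ
        { (part u' l' x y f) → ret (part u' l' x y λ s w → s λ _ s₂ → f s₂ w) } }

  -- Each direction rests on the other one level down, because peeling ends in a negation.
  Tru-⟦⟧ : ∀ {m} (u : U m) l → Tru m ⌈ codeU u ⌉ (stk l) → ⟦ er u ⟧ (env l)
  ⟦⟧-Tru : ∀ {m} (u : U m) l → ⟦ er u ⟧ (env l) → Tru m ⌈ codeU u ⌉ (stk l)
  Tru-⟦⟧ (base φ h) l t = True-⟦⟧ h l t
  Tru-⟦⟧ (stop u) l t s = t ⌈ codeU u ⌉ (stk l) (intro (# 13) (args ⌈ codeU u ⌉ (stk l) ∅ ∅ ∅) id [] []) (⟦⟧-Tru u l s)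
  Tru-⟦⟧ (uall u) l t z = Tru-⟦⟧ u (z ∷ l) λ s' e' d₁ →
    t s' e' (intro (# 14) (args ⌈ codeU u ⌉ (stk l) s' e' z) id (d₁ ∷ []) [])
  Tru-⟦⟧ (both u v) l t f = f
    (Tru-⟦⟧ u l λ s' e' d₁ → t s' e' (intro (# 15) (args ⌈ codeU u ⌉ ⌈ codeU v ⌉ (stk l) s' e') id (d₁ ∷ []) []))
    (Tru-⟦⟧ v l λ s' e' d₁ → t s' e' (intro (# 16) (args ⌈ codeU u ⌉ ⌈ codeU v ⌉ (stk l) s' e') id (d₁ ∷ []) []))
  ⟦⟧-Tru {zero}  (base φ h) l s = ⟦⟧-True h l s
  ⟦⟧-Tru {suc m} u l s s' e' d₀ t = Peel-part u l d₀ λ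
    { (part u' l' x y f) → f s (Tru-⟦⟧ u' l' (Tru-cong m x y t)) }

-- The Rosser–Tarski argument

record _⇔ᶜ_ (φ ψ : F) : Set where
  constructor equiv
  field
    to   : Thm (φ ⊃ ψ)
    from : Thm (ψ ⊃ φ)
open _⇔ᶜ_

thm₀ : ∀ {φ ψ} → φ ∷ [] ⊢ᶜ ψ → Thm (φ ⊃ ψ)
thm₀ d = thm (lam d)

use : ∀ {Γ φ ψ} → Thm (φ ⊃ ψ) → Γ ⊢ᶜ φ → Γ ⊢ᶜ ψ
use p d = app (weak p) d

⊃-subst : ∀ {Γ φ φ' ψ ψ'} → φ ≡ φ' → ψ ≡ ψ' → Γ ⊢ᶜ φ ⊃ ψ → Γ ⊢ᶜ φ' ⊃ ψ'
⊃-subst refl refl d = d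

⇔-refl : ∀ {φ} → φ ⇔ᶜ φ
⇔-refl = equiv (thm₀ h0) (thm₀ h0)

⇔-trans : ∀ {φ ψ χ} → φ ⇔ᶜ ψ → ψ ⇔ᶜ χ → φ ⇔ᶜ χ
⇔-trans p q = equiv (thm₀ (use (to q) (use (to p) h0))) (thm₀ (use (from p) (use (from q) h0)))

⊃-cong : ∀ {φ φ' ψ ψ'} → φ ⇔ᶜ φ' → ψ ⇔ᶜ ψ' → (φ ⊃ ψ) ⇔ᶜ (φ' ⊃ ψ')
⊃-cong p q = equiv (thm₀ (lam (use (to q) (app h1 (use (from p) h0)))))
                   (thm₀ (lam (use (from q) (app h1 (use (to p) h0)))))

neg-cong : ∀ {φ ψ} → φ ⇔ᶜ ψ → neg φ ⇔ᶜ neg ψ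
neg-cong p = ⊃-cong p ⇔-refl

all-mono : ∀ {φ ψ} → Thm (φ ⊃ ψ) → Thm (all φ ⊃ all ψ)
all-mono {φ} p = thm₀ (allI (use p (allE0 φ h0)))

all-cong : ∀ {φ ψ} → φ ⇔ᶜ ψ → all φ ⇔ᶜ all ψ
all-cong p = equiv (all-mono (to p)) (all-mono (from p))

¬¬-⇔ : ∀ {φ} → neg (neg φ) ⇔ᶜ φ
¬¬-⇔ = equiv axDN (thm₀ (lam (app h0 h1)))

-- Only up to provable equivalence: `tr` renders a bounded ∃ with a double negation under the
-- quantifier.
Δ₀⇒D₀ : ∀ {k} {φ : Formula k} → Δ₀ φ → (v : Fin k → ℕ) → Σ F λ χ → D₀ χ × χ ⇔ᶜ tr v φ
Δ₀⇒D₀ (∈-Δ₀ x y) v = mem (v x) (v y) , mem _ _ , ⇔-refl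
Δ₀⇒D₀ (≐-Δ₀ x y) v = eq (v x) (v y) , eq _ _ , ⇔-refl
Δ₀⇒D₀ ⊥-Δ₀ v = bot , bot , ⇔-refl
Δ₀⇒D₀ (¬-Δ₀ d) v with Δ₀⇒D₀ d v
... | χ , h , e = neg χ , (h ⊃ bot) , neg-cong e
Δ₀⇒D₀ (∧-Δ₀ d d') v with Δ₀⇒D₀ d v | Δ₀⇒D₀ d' v
... | χ , h , e | χ' , h' , e' = conj χ χ' , ((h ⊃ (h' ⊃ bot)) ⊃ bot) , neg-cong (⊃-cong e (neg-cong e'))
Δ₀⇒D₀ (∨-Δ₀ d d') v with Δ₀⇒D₀ d v | Δ₀⇒D₀ d' v
... | χ , h , e | χ' , h' , e' = (neg χ ⊃ χ') , ((h ⊃ bot) ⊃ h') , ⊃-cong (neg-cong e) e'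
Δ₀⇒D₀ (⇒-Δ₀ d d') v with Δ₀⇒D₀ d v | Δ₀⇒D₀ d' v
... | χ , h , e | χ' , h' , e' = (χ ⊃ χ') , (h ⊃ h') , ⊃-cong e e'
Δ₀⇒D₀ (∀∈-Δ₀ y d) v with Δ₀⇒D₀ d (lift' v)
... | χ , h , e = all (mem 0 (suc (v y)) ⊃ χ) , ball (v y) h , all-cong (⊃-cong ⇔-refl e)
Δ₀⇒D₀ (∃∈-Δ₀ y d) v with Δ₀⇒D₀ d (lift' v)
... | χ , h , e = neg (all (mem 0 (suc (v y)) ⊃ neg χ)) , (ball (v y) (h ⊃ bot) ⊃ bot) ,
  neg-cong (all-cong (⇔-trans (⊃-cong ⇔-refl (neg-cong e)) (equiv (from ¬¬-⇔) (to ¬¬-⇔))))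

Represents : ∀ {n} → F → U n → Set
Represents φ u = er u ⇔ᶜ φ

-- `U` is a Π-like hierarchy, so a Σ-formula enters through its negation.
uΣ : ∀ {n k} {φ : Formula k} → IsΣ n φ → (v : Fin k → ℕ) → Σ (U n) (Represents (neg (tr v φ)))
uΠ : ∀ {n k} {φ : Formula k} → IsΠ n φ → (v : Fin k → ℕ) → Σ (U n) (Represents (tr v φ))
uΣ (Δ₀→Σ₀ d) v with Δ₀⇒D₀ d v
... | χ , h , e = base (neg χ) (h ⊃ bot) , neg-cong e
uΣ (Π→Σ p) v with uΠ p v
... | u , e = stop u , neg-cong e
uΣ (∃-Σ p) v with uΣ p (lift' v)
... | u , e = uall u , ⇔-trans (all-cong e) (equiv (from ¬¬-⇔) (to ¬¬-⇔))
uΠ (Δ₀→Π₀ d) v with Δ₀⇒D₀ d v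
... | χ , h , e = base χ h , e
uΠ (Σ→Π p) v with uΣ p v
... | u , e = stop u , ⇔-trans (neg-cong e) ¬¬-⇔
uΠ (∀-Π p) v with uΠ p (lift' v)
... | u , e = uall u , all-cong e

-- Raising the level costs one negation, so the induction passes to the negated formula.
uD₀ : ∀ n {χ} → D₀ χ → Σ (U n) (Represents χ)
uD₀ zero    h = base _ h , ⇔-refl
uD₀ (suc n) h with uD₀ n (h ⊃ bot)
... | u , e = stop u , ⇔-trans (neg-cong e) ¬¬-⇔

-- Proofs and truth at a stage

module KPStage (n : ℕ) (T : Theory) (kp : ∀ φ → KP φ → T ⊩ φ) (𝔐 : Model ⟪ T ⟫) where
  open KPSatisfaction T kp 𝔐 public
  module P = Timed syn rules rules-complete

  -- One level above `n`: an axiom is the negation of a formula of `U n`, and positive levels are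
  -- closed under the conjunctions that merge several axioms.
  N : ℕ
  N = suc n

  isCode : ∀ {k} → Tm → Fin k → Formula k
  isCode leaf       w = ∀∈ w ⊥'
  -- The first witness is the element `up s t` of the Kuratowski pair, which bounds both components.
  isCode (node s t) w = ∃∈ w (∃∈ v0 (∃∈ v1 (isPair (suc (suc (suc w))) v1 v0 ∧' isCode s v1 ∧' isCode t v0)))

  isCode-Δ₀ : ∀ {k} t (w : Fin k) → Δ₀ (isCode t w)
  isCode-Δ₀ leaf       w = ∀∈-Δ₀ _ ⊥-Δ₀
  isCode-Δ₀ (node s t) w = ∃∈-Δ₀ _ (∃∈-Δ₀ _ (∃∈-Δ₀ _ (∧-Δ₀ (isPair-Δ₀ _ _ _) (∧-Δ₀ (isCode-Δ₀ s _) (isCode-Δ₀ t _)))))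

  isCode-to : ∀ {k} t (w : Fin k) ρ → Sat (isCode t w) ρ → ρ w ≈ ⌈ t ⌉
  isCode-to leaf       w ρ h = ext≈ λ z → (λ i → ⊥-elim (h z i)) , (λ i → ⊥-elim (∉∅ i))
  isCode-to (node s t) w ρ (x , _ , y , _ , z , _ , p , p₁ , p₂) =
    ≈-trans (isPair-to (suc (suc (suc w))) v1 v0 (z ▹ y ▹ x ▹ ρ) p)
      (pair-cong (isCode-to s v1 (z ▹ y ▹ x ▹ ρ) p₁) (isCode-to t v0 (z ▹ y ▹ x ▹ ρ) p₂))

  isCode-from : ∀ {k} t (w : Fin k) ρ → ρ w ≈ ⌈ t ⌉ → Sat (isCode t w) ρ
  isCode-from leaf       w ρ e = λ z i → ∉∅ (∈-congʳ e i)
  isCode-from (node s t) w ρ e = up ⌈ s ⌉ ⌈ t ⌉ , ∈-congʳ (≈-sym e) up∈pair , ⌈ s ⌉ , up-1 , ⌈ t ⌉ , up-2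
    , isPair-from (suc (suc (suc w))) v1 v0 τ e , isCode-from s v1 τ ≈-refl , isCode-from t v0 τ ≈-refl
    where τ = ⌈ t ⌉ ▹ ⌈ s ⌉ ▹ up ⌈ s ⌉ ⌈ t ⌉ ▹ ρ

  -- The formula with code c has, at stage i, a proof from a true formula of U N, evaluated at x.
  record Stage (i x c : M) : Set where
    constructor stage
    field
      s       : M
      derived : P.D (pair i (pair ⌈ num 7 ⌉ (pair ⌈ num N ⌉ (pair s c))))
      valid   : Tru N s (pair x ∅)

  stageP : Pat 3 → Pat 3
  stageP c = ν v0 · hypJ (lit (num N)) (ν v1) c

  at : M → M → M → Fin 3 → M
  at i s x = i ▹ s ▹ x ▹ none

  stage-eq : ∀ c σ → eval (stageP c) σ ≡ pair (σ v0) (pair ⌈ num 7 ⌉ (pair ⌈ num N ⌉ (pair (σ v1) (eval c σ))))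
  stage-eq c σ = cong (λ m → pair (σ v0) (pair ⌈ num 7 ⌉ (pair m (pair (σ v1) (eval c σ))))) (eval-lit (num N) σ)

  points : ∀ {k} (ρ : Fin k → M) (i x : Fin k) s j → (s ▹ ρ) ((suc i ▹ v0 ▹ suc x ▹ none) j) ≈ at (ρ i) s (ρ x) j
  points ρ i x s zero                = ≈-refl
  points ρ i x s (suc zero)          = ≈-refl
  points ρ i x s (suc (suc zero))    = ≈-refl

  abstract
    -- The code is given by a pattern, so that `R` can apply it to `x` and to the negation of `x`.
    stageF : ∀ {k} → Fin k → Fin k → Pat 3 → Formula k
    stageF i x c = ∃' (P.judgF (stageP c) (suc i ▹ v0 ▹ suc x ▹ none)
      ∧' ∃' (evalF (ν v0 · ◦) (suc (suc x) ▹ none) v0 ∧' truF N v1 v0))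

    stageF-to : ∀ {k} (i x : Fin k) c ρ → Sat (stageF i x c) ρ → Σ M λ s → Stage (ρ i) (ρ x) (eval c (at (ρ i) s (ρ x)))
    stageF-to i x c ρ (s , h , e , q , t) = s , stage s
      (subst P.D (stage-eq c (at (ρ i) s (ρ x))) (P.D-cong (eval-cong (stageP c) (points ρ i x s))
        (P.judgF-to (stageP c) (suc i ▹ v0 ▹ suc x ▹ none) (s ▹ ρ) h)))
      (Tru-cong N ≈-refl (evalF-to (ν v0 · ◦) (suc (suc x) ▹ none) v0 (e ▹ s ▹ ρ) q) (truF-to N v1 v0 (e ▹ s ▹ ρ) t))

    stageF-from : ∀ {k} (i x : Fin k) c ρ {w} → (∀ s → eval c (at (ρ i) s (ρ x)) ≡ w) → Stage (ρ i) (ρ x) w → Sat (stageF i x c) ρ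
    stageF-from i x c ρ f (stage s h t) = s
      , P.judgF-from (stageP c) (suc i ▹ v0 ▹ suc x ▹ none) (s ▹ ρ) (P.D-cong (eval-cong (stageP c) (λ j → ≈-sym (points ρ i x s j)))
          (subst P.D (sym (trans (stage-eq c (at (ρ i) s (ρ x)))
            (cong (λ m → pair (ρ i) (pair ⌈ num 7 ⌉ (pair ⌈ num N ⌉ (pair s m)))) (f s)))) h))
      , pair (ρ x) ∅ , evalF-from (ν v0 · ◦) (suc (suc x) ▹ none) v0 (pair (ρ x) ∅ ▹ s ▹ ρ) ≈-refl
      , truF-from N v1 v0 (pair (ρ x) ∅ ▹ s ▹ ρ) t

-- The Rosser formula and its truth value

module KPRosser (n : ℕ) (T : Theory) (isΣ : ∀ φ → T φ → IsΣ n φ) (kp : ∀ φ → KP φ → T ⊩ φ)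
  (𝔐 : Model ⟪ T ⟫) where
  open KPStage n T kp 𝔐

  -- The axioms used are collected along the derivation into one formula of level `N`, true because
  -- 𝔐 is a model of `T`; a purely logical theorem gets a trivial truth as its premise.
  premise : ∀ {χ} → ⟪ T ⟫ ⊢ᵀ χ → Σ (U N) λ u → (∀ ρ → ⟦ er u ⟧ ρ) × Thm (er u ⊃ χ)
  premise (hy (ψ , t , refl)) with uΣ (isΣ ψ t) none
  ... | u , e = stop u , (λ ρ → sound (from e') ρ (models (hy (ψ , t , refl)) (tr-closed ψ) ρ)) , to e'
    where e' = ⇔-trans (neg-cong e) ¬¬-⇔
  premise (th d) with uD₀ N (bot ⊃ bot)
  ... | u , e = u , (λ ρ → sound (from e) ρ id) , mp axK d
  premise (mpᵀ d d') with premise d | premise d'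
  ... | u , t , p | v , s , q = both u v , (λ ρ f → f (t ρ) (s ρ)) ,
    thm₀ (raaᶜ (app h1 (lam (lam (app h2 (app (use p h1) (use q h0)))))))

  refutation : M → M
  refutation x = pair ⌈ num 2 ⌉ (pair x ∅)

  abstract
    -- Rosser's trick: every stage that proves the formula with code x also refutes it.
    R : Formula 1
    R = ∀' (stageF v0 v1 (ν v2) ⇒' stageF v0 v1 (negP (ν v2)))

    R-to : ∀ {x} → Sat R (x ▹ none) → ∀ i → Stage i x x → Stage i x (refutation x)
    R-to {x} r i q = proj₂ (stageF-to v0 v1 (negP (ν v2)) (i ▹ x ▹ none)
      (r i (stageF-from v0 v1 (ν v2) (i ▹ x ▹ none) (λ _ → refl) q)))

    R-from : ∀ {x} → (∀ i → Stage i x x → K (Stage i x (refutation x))) → Sat R (x ▹ none)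
    R-from {x} r i q = Sat-stable (stageF v0 v1 (negP (ν v2)))
      (r i (proj₂ (stageF-to v0 v1 (ν v2) (i ▹ x ▹ none) q)) >>= λ p →
        ret (stageF-from v0 v1 (negP (ν v2)) (i ▹ x ▹ none) (λ _ → refl) p))

  Rꟳ : F
  Rꟳ = tr (lift' none) R

  ⌈R⌉ : M
  ⌈R⌉ = ⌈ code Rꟳ ⌉

  ρᴿ : ℕ → M
  ρᴿ = env (⌈R⌉ ∷ [])

  R-⟦⟧ : Sat R (⌈R⌉ ▹ none) → ⟦ Rꟳ ⟧ ρᴿ
  R-⟦⟧ = tr-from R λ { zero → refl }

  ⟦⟧-R : ⟦ Rꟳ ⟧ ρᴿ → Sat R (⌈R⌉ ▹ none)
  ⟦⟧-R = tr-to R λ { zero → refl }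

  split : ∀ {x y} t → pair x y ≈ ⌈ t ⌉ → Σ Tm λ l → Σ Tm λ r → t ≡ node l r × x ≈ ⌈ l ⌉ × y ≈ ⌈ r ⌉
  split leaf       q = ⊥-elim (pair≉∅ q)
  split (node l r) q = l , r , refl , pair-inj₁ q , pair-inj₂ q

  -- At a stage of finite rank the derivation is genuine, so the premise has a standard shape; for
  -- such shapes `Tru` is truth, and the calculus is sound in the model.
  Stage-sound : ∀ h {i} φ → ¬ Rank h i → Stage i ⌈R⌉ ⌈ code φ ⌉ → K (⟦ φ ⟧ ρᴿ)
  Stage-sound h {i} φ nr (stage s d₀ t₀) = P.D⇒Der h nr d₀ >>= λ { (t , q , d₁) → ret (read t q d₁) }
    where
    read : ∀ t → pair ⌈ num 7 ⌉ (pair ⌈ num N ⌉ (pair s ⌈ code φ ⌉)) ≈ ⌈ t ⌉ → Der syn t → ⟦ φ ⟧ ρᴿ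
    read t q d₁ with split t q
    ... | t₁ , t₂ , refl , q₁ , q₂ with split t₂ q₂ | ⌈⌉-inj (num 7) t₁ q₁
    ... | t₃ , t₄ , refl , q₃ , q₄ | refl with split t₄ q₄ | ⌈⌉-inj (num N) t₃ q₃
    ... | t₅ , t₆ , refl , q₅ , q₆ | refl with ⌈⌉-inj (code φ) t₆ q₆ | meaning d₁
    ... | refl | m , k , u , refl , p with trans (sym (unnum-num N)) (trans (cong unnum k) (unnum-num m))
    ... | refl = subst (λ χ → ⟦ χ ⟧ ρᴿ) (decode-code φ)
      (sound p ρᴿ (Tru-⟦⟧ u (⌈R⌉ ∷ []) (Tru-cong N q₅ ≈-refl t₀)))

  Stage-complete : ∀ φ (u : U N) → ⟦ er u ⟧ ρᴿ → Thm (er u ⊃ φ) → Σ ℕ λ h → ∀ i → Rank h i → Stage i ⌈R⌉ ⌈ code φ ⌉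
  Stage-complete φ u t p with P.Der⇒D (hyp-der u φ p)
  ... | h , f = h , λ i r → stage ⌈ codeU u ⌉ (f i r) (⟦⟧-Tru u (⌈R⌉ ∷ []) t)

  module Decided (decides : ∀ ψ → K (T ⊩ ψ ⊎ T ⊩ (¬' ψ))) where

    -- `T` decides the sentence `ψ` and cannot refute it, because `ψ` is true in a model of `T`. The
    -- guard `isR` of `ψ` is discharged by adding it to the premise, with variable 0 denoting `⌈R⌉`.
    proved : (χ : Formula 1) → Sat χ (⌈R⌉ ▹ none) →
      K (Σ ℕ λ h → ∀ i → Rank h i → Stage i ⌈R⌉ ⌈ code (tr (lift' none) χ) ⌉)
    proved χ s = decides ψ >>= λ
      { (inj₁ d) → ret (from-proof (premise (⊩⇒⊢ᵀ d)))
      ; (inj₂ d) → ⊥-elim (holds d ψ-true) }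
      where
      isR : Formula 1
      isR = isCode (code Rꟳ) v0
      ψ : Sentence
      ψ = ∀' (isR ⇒' χ)
      ψ-true : Sat ψ none
      ψ-true x e = Sat-cong χ (λ { zero → ≈-sym (isCode-to (code Rꟳ) v0 (x ▹ none) e) }) s
      -- `φ` has no free variable but 0, so instantiating the quantifier of `ψ` by variable 0 leaves
      -- it as it is.
      fixed : ∀ φ → tr (lift' none) φ ⟨ 0 ⟩ ≡ tr (lift' none) φ
      fixed φ = trans (ren-tr (0 ▸ id) (lift' none) φ) (tr-cong (λ { zero → refl }) φ)
      from-proof : Σ (U N) (λ u → (∀ ρ → ⟦ er u ⟧ ρ) × Thm (er u ⊃ tr none ψ)) →
        Σ ℕ λ h → ∀ i → Rank h i → Stage i ⌈R⌉ ⌈ code (tr (lift' none) χ) ⌉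
      from-proof (u , t , p) with Δ₀⇒D₀ (isCode-Δ₀ (code Rꟳ) (v0 {0})) (lift' none)
      ... | δ , δ₀ , e with uD₀ N δ₀
      ...   | v , e' = Stage-complete (tr (lift' none) χ) (both u v)
        (λ f → f (t ρᴿ) (sound (from e') ρᴿ (sound (from e) ρᴿ
          (tr-from isR {τ = ⌈R⌉ ▹ none} (λ { zero → refl }) (isCode-from (code Rꟳ) v0 (⌈R⌉ ▹ none) ≈-refl)))))
        (thm₀ (raaᶜ (app h1 (lam (lam (app h2 (app
          (⊃-subst (fixed isR) (fixed χ) (allE (tr (lift' none) (isR ⇒' χ)) 0 (use p h1)))
          (use (to e) (use (to e') h0)))))))))

    contradiction : ⊥
    contradiction = lem {Sat R (⌈R⌉ ▹ none)} λ { (inj₁ r) → if-true r ; (inj₂ r) → if-false r }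
      where
      if-true : ¬ Sat R (⌈R⌉ ▹ none)
      -- `clock h` has room for the proof of `R`, so by `R` also for its refutation; lacking
      -- `Rank (suc h)`, it is sound.
      if-true r = proved R r λ { (h , f) → Stage-sound (suc h) (neg Rꟳ) (clock-¬Rank h)
        (R-to r (clock h) (f (clock h) (clock-Rank h))) λ nr → nr (R-⟦⟧ r) }
      if-false : ¬ ¬ Sat R (⌈R⌉ ▹ none)
      -- A stage with `Rank h` has the refutation; any other stage is sound and so cannot prove the
      -- false `R`. Together this is what `R` asserts.
      if-false nr = proved (¬' R) nr λ { (h , f) → nr (R-from λ i q → lem {Rank h i} >>= λ
        { (inj₁ rk) → ret (f i rk)
        ; (inj₂ ¬rk) → Stage-sound h Rꟳ ¬rk q >>= λ t → ⊥-elim (nr (⟦⟧-R t)) }) }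

theoremC : (n : ℕ) (T : Theory)
    → (∀ φ → T φ → IsΣ n φ)
    → (∀ φ → KP φ → T ⊩ φ)
    → Consistent T
    → ¬ ¬ (Σ Sentence λ ψ → ¬ (T ⊩ ψ) × ¬ (T ⊩ (¬' ψ)))
theoremC n T isΣ kp con incomplete = KPRosser.Decided.contradiction n T isΣ kp
  (model-exists ⟪ T ⟫ (λ { (ψ , _ , refl) → tr-closed ψ }) (con ∘ ⊢ᵀ⇒back))
  -- Denying incompleteness decides each `ψ` up to double negation, as `decides` asks.
  λ ψ n → incomplete (ψ , (λ d → n (inj₁ d)) , (λ d → n (inj₂ d)))
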